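{- For every $\alpha\in(0,1]$ there is $\mu_0>0$ such that for every $0<\mu\leq\mu_0$ there is $\varepsilon_0>0$ such that for every $0<\varepsilon\leq\varepsilon_0$ there is $c_0>0$ such that for every $0<c\leq c_0$ there is $n_0$ such that the following holds for all $n\geq n_0$. Let $D$ be an $n$-vertex digraph with $\delta^0(D)\geq(1/2+\alpha)n$. Let $T$ be an oriented tree with $\mu n$ vertices and $\Delta^\pm(T)\leq cn/\log n$, and let $t\in V(T)$. Then $V(D)$ contains a vertex set $A$ of size $(\mu-\varepsilon)n$ and a vertex $v\in A$ such that, for every set $B\subset V(D)$ with $A\subset B$ and $|B|=\mu n$, the digraph $D[B]$ contains a copy of $T$ in which $t$ is copied to $v$.
   Context: Digraphs have edges that are ordered pairs of distinct vertices; $\delta^0(D)$ is the minimum over all vertices of the minimum of the in-degree and out-degree. An oriented tree is a tree with each edge given a direction; $\Delta^\pm(T)$ is the maximum degree of its underlying undirected tree. A copy of $T$ in $D$ is an injective map $V(T)\to V(D)$ mapping each directed edge of $T$ to an edge of $D$ with the same direction; "$t$ is copied to $v$" means $t$ is mapped to $v$. $D[B]$ is the subdigraph induced on $B$. Quantities such as $\mu n$ and $(\mu-\varepsilon)n$ are assumed to be integers (rounding is ignored).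
   Formalization: The parameters α, μ, ε, c are rational instead of real; sizes μn and (μ−ε)n are rounded down, and log n is taken as the integer part of log₂ n, which only rescales c₀. -}

module Defs where

open import Data.Nat using (ℕ; zero; suc; _+_; _≤_)
open import Data.Bool using (Bool; true; false; _∨_; T)
open import Data.Fin using (Fin; zero; suc)
import Data.Fin.Subset
open import Data.List using (List; []; _∷_; length)
open import Data.List.Relation.Unary.Unique.Propositional using (Unique)
open import Data.Product using (Σ; _×_; ∃)
open import Relation.Binary.PropositionalEquality using (_≡_)
open import Data.Integer using (ℤ; +_)
open import Data.Rational using (ℚ; _/_)
open import Data.Empty using (⊥)

toℚ : ℕ → ℚ
toℚ n = + n / 1

count : ∀ {n} → (Fin n → Bool) → ℕ
count {zero}  P = 0
count {suc n} P = if′ (P zero) + count (λ i → P (suc i))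
  where
  if′ : Bool → ℕ
  if′ true  = 1
  if′ false = 0

record Digraph (n : ℕ) : Set where
  field
    arc     : Fin n → Fin n → Bool
    noLoops : ∀ v → arc v v ≡ false
open Digraph public

outdeg indeg : ∀ {n} → Digraph n → Fin n → ℕ
outdeg D v = count (λ w → arc D v w)
indeg  D v = count (λ w → arc D w v)

MinSemiDegree≥ : ∀ {n} → Digraph n → ℚ → Set
MinSemiDegree≥ {n} D k = ∀ v → (k Data.Rational.≤ toℚ (outdeg D v)) × (k Data.Rational.≤ toℚ (indeg D v))

adj : ∀ {n} → Digraph n → Fin n → Fin n → Bool
adj D u v = arc D u v ∨ arc D v u

deg : ∀ {n} → Digraph n → Fin n → ℕ
deg D v = count (λ w → adj D v w)

data Reach {n} (D : Digraph n) : Fin n → Fin n → Set where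
  here : ∀ {u} → Reach D u u
  step : ∀ {u v w} → T (adj D u v) → Reach D v w → Reach D u w

data Path {n} (D : Digraph n) : List (Fin n) → Set where
  single : ∀ {u} → Path D (u ∷ [])
  cons   : ∀ {u v vs} → T (adj D u v) → Path D (v ∷ vs) → Path D (u ∷ v ∷ vs)

last : ∀ {A : Set} → A → List A → A
last a []       = a
last a (b ∷ bs) = last b bs

Cycle : ∀ {n} → Digraph n → List (Fin n) → Set
Cycle D []       = ⊥
Cycle D (u ∷ vs) = (3 ≤ length (u ∷ vs)) × Unique (u ∷ vs) × Path D (u ∷ vs) × T (adj D (last u vs) u)

record OrientedTree (m : ℕ) : Set where
  field
    digraph   : Digraph m
    oriented  : ∀ u v → T (arc digraph u v) → arc digraph v u ≡ false
    connected : ∀ u v → Reach digraph u v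
    acyclic   : ∀ vs → Cycle digraph vs → ⊥
open OrientedTree public

CopyIn : ∀ {m n} → OrientedTree m → Digraph n → Data.Fin.Subset.Subset n
       → Fin m → Fin n → Set
CopyIn {m} {n} Tr D B t v =
  Σ (Fin m → Fin n) λ f →
      (∀ i j → f i ≡ f j → i ≡ j)
    × (∀ i j → T (arc (digraph Tr) i j) → T (arc D (f i) (f j)))
    × (∀ i → f i Data.Fin.Subset.∈ B)
    × f t ≡ v

-- Embed all of T, delete from the image the images of a set L of about εn vertices to get A, and repair by
-- exchanges. To absorb a vertex x of B \ A, find i ∈ I whose neighbours are mapped into the right
-- neighbourhoods of x and whose image y lies in the right neighbourhoods of the images of the neighbours of
-- some ℓ ∈ L; then send i to x and ℓ to y. The vertices of I ∪ L have degree at most 2 and are pairwise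
-- nonadjacent, so exchanges at distinct i do not interfere, and it suffices that for every x and every
-- one or two neighbourhoods in D at least |L| vertices i ∈ I qualify.
--
-- A random greedy embedding has this property by a Chernoff bound, where the bound on Δ·log n beats the union
-- bound over polynomially many requirements. It is derandomised by conditional expectations: for every
-- requirement each i ∈ I carries a weight that drops as the vertices around i are placed well, and each vertex
-- is placed so that the sum over all requirements of the products of weights does not increase. Since any two
-- neighbourhoods in D share 2αn vertices, a placement subject to two constraints succeeds with probability
-- bounded below.
--
-- If T has many leaves, then I and L consist of leaves, and T is embedded from the root t. Otherwise most
-- vertices have no branching vertex nearby; then I and L consist of far apart vertices of degree 2, and the
-- vertices of I, each followed by its two neighbours, are placed first, so that their images are unconstrained.
module Submission where

-- Tree edges to earlier vertices and requirements share a budget of two constraints per vertex, and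
-- this shapes the construction. A leaf in `I` spends one on its parent and one on the neighbour of
-- some leaf in `L`; its parent spends one on its own earlier neighbour and one on `x`, which serves
-- all its leaves in `I` only if they have the same orientation. A vertex of degree 2 in `I` has two
-- constraints from `ℓ` and nothing left for tree edges, so it precedes its neighbours, each of
-- which has the edge to it and one constraint from `x`. The remaining vertices have no requirement
-- but may join two placed pieces, so those next to a triple must have degree at most 2. Divided by
-- `N`, the weight of a chain starts at 1 - 1/N and ends at 1 or 1 - 1/(2Δ), where N = 2Δ(2a)^(κ+1):
-- up to 2Δ chains share a vertex, and each of κ + 1 good choices multiplies the deficit by 2a. With
-- fewer than Δl hits a requirement keeps weight at least 2^(-l), while all weights together are at
-- most n(2n)^κ 2^(-j) once |I| is at least Nj. Taking Δl about |L| and j - l about 3 log n, this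
-- needs |I| of order Δ log n + |L|, which is small against |T|.

module Combinatorics where
  open import Defs
  open import Data.Nat hiding (_≟_)
  open import Data.Nat.Properties hiding (_≟_)
  open import Data.Nat.DivMod using (_/_; _%_; m≡m%n+[m/n]*n; m%n<n; m/n*n≤m)
  open import Data.Nat.ListAction using (sum; product)
  open import Data.Nat.Logarithm using (⌊log₂_⌋; ⌊log₂⌋-mono-≤; ⌊log₂[2^n]⌋≡n)
  open import Data.Nat.Tactic.RingSolver using (solve-∀)
  import Data.Bool as Bool
  open import Data.Bool using (Bool; true; false; T; _∧_; not; if_then_else_)
  open import Data.Bool.Properties using (T?; T-∧; T-∨; T-≡; ∨-comm)
  import Data.Fin as Fin
  open import Data.Fin using (Fin; zero; suc; _≟_)
  import Data.Fin.Properties as Finₚ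
  open import Data.Fin.Subset using (Subset; ∣_∣; ⊥; inside; outside) renaming (_∈_ to _∈ₛ_; _⊆_ to _⊆ₛ_)
  import Data.Fin.Subset.Properties as Subsetₚ
  open import Data.Fin.Subset.Properties using (∉⊥; ∣⊥∣≡0; p⊆q⇒∣p∣≤∣q∣)
  open import Data.List hiding (sum; product; last; lookup; find)
  open import Data.List.Properties using (length-map; length-++; length-filter; length-tabulate; map-cong; take++drop≡id; length-take; length-drop; filter-none; filter-reject; filter-++; ++-identityʳ)
  open import Data.List.Membership.Propositional using (_∈_; _∉_; find; lose)
  open import Data.List.Membership.Propositional.Properties
  import Data.List.Membership.DecPropositional as DecMem
  import Data.List.Relation.Unary.Any as Any
  import Data.List.Relation.Unary.Any.Properties as Anyₚ
  open import Data.List.Relation.Unary.Any using (here; there)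
  import Data.List.Relation.Unary.All as All
  open import Data.List.Relation.Unary.All using (All; []; _∷_)
  import Data.List.Relation.Unary.AllPairs as AllPairs
  open import Data.List.Relation.Unary.AllPairs using (AllPairs; []; _∷_)
  open import Data.List.Relation.Unary.Unique.Propositional using (Unique)
  open import Data.List.Relation.Unary.Unique.Propositional.Properties using (allFin⁺; filter⁺; ++⁺; map⁺; drop⁺; take⁺)
  import Data.Vec as Vec
  import Data.Vec.Properties as Vecₚ
  open import Data.Vec using (_[_]≔_; lookup; _∷_)
  open import Data.Vec.Properties using ([]=⇒lookup; lookup⇒[]=; lookup∘update; lookup∘update′)
  open import Data.Product using (Σ; ∃; _×_; _,_; proj₁; proj₂)
  open import Data.Sum using (_⊎_; inj₁; inj₂; [_,_]′)
  open import Data.Empty using (⊥-elim)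
  open import Data.Unit using (tt)
  open import Function using (_∘_; id)
  open import Function.Bundles using (Equivalence)
  open import Relation.Nullary using (¬_; Dec; yes; no)
  open import Relation.Nullary.Decidable using (⌊_⌋; toWitness; _×-dec_; ¬?; decidable-stable)
  open import Relation.Binary.PropositionalEquality hiding (J)

  private variable
    A : Set
    m n : ℕ

  module _ {n : ℕ} where
    open DecMem (_≟_ {n}) public using (_∈?_)

  -- Inequalities for powers

  ^-distribʳ-* : ∀ k x y → (x * y) ^ k ≡ x ^ k * y ^ k
  ^-distribʳ-* zero    x y = refl
  ^-distribʳ-* (suc k) x y = trans (cong (x * y *_) (^-distribʳ-* k x y)) (lem x y (x ^ k) (y ^ k))
    where
    lem : ∀ x y X Y → x * y * (X * Y) ≡ x * X * (y * Y)
    lem = solve-∀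

  -- The two leading terms of the binomial expansion of the right side.
  bernoulli : ∀ x k → x ^ suc k + suc k * x ^ k ≤ suc x ^ suc k
  bernoulli x zero = ≤-reflexive (+-comm (x * 1) 1)
  bernoulli x (suc k) = begin
    x * X + (2 + k) * X                     ≡⟨ lem x X k ⟩
    (suc x * X + X) + k * X                 ≤⟨ m≤m+n _ (suc k * x ^ k) ⟩
    (suc x * X + X) + k * X + suc k * x ^ k ≡⟨ lem₂ x (x ^ k) k ⟩
    suc x * (X + suc k * x ^ k)             ≤⟨ *-monoʳ-≤ (suc x) (bernoulli x k) ⟩
    suc x * suc x ^ suc k                   ∎
    where
    open ≤-Reasoning
    X = x ^ suc k
    lem : ∀ x X k → x * X + (2 + k) * X ≡ (suc x * X + X) + k * X
    lem = solve-∀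
    lem₂ : ∀ x y k → (suc x * (x * y) + x * y) + k * (x * y) + suc k * y
                     ≡ suc x * (x * y + suc k * y)
    lem₂ = solve-∀

  -- The linear term of the binomial expansion alone is at least `x ^ suc x`. In quotients, (1 -
  -- 1/(x+1))^(x+1) ≤ 1/2; this makes the initial potential small.
  2*pred^≤ : ∀ x → 2 * x ^ suc x ≤ suc x ^ suc x
  2*pred^≤ x = begin
    2 * (x * x ^ x)                 ≡⟨ lem x (x ^ x) ⟩
    x * x ^ x + x * x ^ x           ≤⟨ +-monoʳ-≤ (x * x ^ x) (m≤n+m _ (x ^ x)) ⟩
    x ^ suc x + suc x * x ^ x       ≤⟨ bernoulli x x ⟩
    suc x ^ suc x ∎
    where
    open ≤-Reasoning
    lem : ∀ x y → 2 * (x * y) ≡ x * y + x * y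
    lem = solve-∀

  -- Bernoulli's inequality (1 - 1/(x+1))^k ≥ 1 - k/(x+1), cleared of denominators.
  bernoulli-pred : ∀ x k → suc x ^ suc k ≤ suc x * x ^ k + k * suc x ^ k
  bernoulli-pred x zero = m≤m+n (suc x * 1) 0
  bernoulli-pred x (suc k) = begin
    suc x * (suc x * P)                          ≤⟨ *-monoʳ-≤ (suc x) (bernoulli-pred x k) ⟩
    suc x * (suc x * Q + k * P)                  ≡⟨ lem x Q P k ⟩
    suc x * (x * Q) + k * (suc x * P) + suc x * Q ≤⟨ +-monoʳ-≤ (suc x * (x * Q) + k * (suc x * P))
                                                     (*-monoʳ-≤ (suc x) (^-monoˡ-≤ k (n≤1+n x))) ⟩
    suc x * (x * Q) + k * (suc x * P) + suc x * P ≡⟨ lem₂ x Q P k ⟩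
    suc x * (x * Q) + suc k * (suc x * P)        ∎
    where
    open ≤-Reasoning
    P = suc x ^ k
    Q = x ^ k
    lem : ∀ x Q P k → suc x * (suc x * Q + k * P) ≡ suc x * (x * Q) + k * (suc x * P) + suc x * Q
    lem = solve-∀
    lem₂ : ∀ x Q P k → suc x * (x * Q) + k * (suc x * P) + suc x * P ≡ suc x * (x * Q) + suc k * (suc x * P)
    lem₂ = solve-∀

  -- By Bernoulli, (1 - 1/(x+1))^k ≥ 1 - k/(x+1) ≥ 1/2: the first `k` hits at most halve the weight
  -- of a requirement.
  ^≤2*pred^ : ∀ x k → k + k ≤ suc x → suc x ^ k ≤ 2 * x ^ k
  ^≤2*pred^ x k 2k≤ = *-cancelˡ-≤ (suc x) (begin
      suc x * P                   ≤⟨ +-cancelʳ-≤ (suc x * P) (suc x * P) (suc x * Q + suc x * Q) key ⟩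
      suc x * Q + suc x * Q       ≡⟨ lem x Q ⟩
      suc x * (2 * Q)             ∎)
    where
    open ≤-Reasoning
    P = suc x ^ k
    Q = x ^ k
    lem : ∀ x Q → suc x * Q + suc x * Q ≡ suc x * (2 * Q)
    lem = solve-∀
    lem₂ : ∀ x Q P k → (suc x * Q + k * P) + (suc x * Q + k * P) ≡ (suc x * Q + suc x * Q) + (k + k) * P
    lem₂ = solve-∀
    key : suc x * P + suc x * P ≤ (suc x * Q + suc x * Q) + suc x * P
    key = begin
      suc x * P + suc x * P                     ≤⟨ +-mono-≤ (bernoulli-pred x k) (bernoulli-pred x k) ⟩
      (suc x * Q + k * P) + (suc x * Q + k * P) ≡⟨ lem₂ x Q P k ⟩
      (suc x * Q + suc x * Q) + (k + k) * P     ≤⟨ +-monoʳ-≤ (suc x * Q + suc x * Q) (*-monoˡ-≤ P 2k≤) ⟩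
      (suc x * Q + suc x * Q) + suc x * P       ∎

  *^-mono : ∀ c {x y} k l → c * x ^ k ≤ y ^ k → c ^ l * x ^ (k * l) ≤ y ^ (k * l)
  *^-mono c {x} {y} k zero    h = begin
    1 * x ^ (k * 0) ≡⟨ cong (λ z → 1 * x ^ z) (*-zeroʳ k) ⟩
    1               ≡⟨ cong (y ^_) (*-zeroʳ k) ⟨
    y ^ (k * 0)     ∎
    where open ≤-Reasoning
  *^-mono c {x} {y} k (suc l) h = begin
    c * c ^ l * x ^ (k * suc l)         ≡⟨ cong (c * c ^ l *_) (split x) ⟩
    c * c ^ l * (x ^ k * x ^ (k * l))   ≡⟨ lem c (c ^ l) (x ^ k) (x ^ (k * l)) ⟩
    (c * x ^ k) * (c ^ l * x ^ (k * l)) ≤⟨ *-mono-≤ h (*^-mono c k l h) ⟩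
    y ^ k * y ^ (k * l)                 ≡⟨ split y ⟨
    y ^ (k * suc l)                     ∎
    where
    open ≤-Reasoning
    split : ∀ z → z ^ (k * suc l) ≡ z ^ k * z ^ (k * l)
    split z = trans (cong (z ^_) (*-suc k l)) (^-distribˡ-+-* z k (k * l))
    lem : ∀ c C X Y → c * C * (X * Y) ≡ (c * X) * (C * Y)
    lem = solve-∀

  ^≤*pred^ : ∀ x k l → k + k ≤ suc x → suc x ^ (k * l) ≤ 2 ^ l * x ^ (k * l)
  ^≤*pred^ x k l 2k≤ = begin
    suc x ^ (k * l)              ≡⟨ ^-*-assoc (suc x) k l ⟨
    (suc x ^ k) ^ l              ≤⟨ ^-monoˡ-≤ l (^≤2*pred^ x k 2k≤) ⟩
    (2 * x ^ k) ^ l              ≡⟨ ^-distribʳ-* l 2 (x ^ k) ⟩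
    2 ^ l * (x ^ k) ^ l          ≡⟨ cong (2 ^ l *_) (^-*-assoc x k l) ⟩
    2 ^ l * x ^ (k * l)          ∎
    where open ≤-Reasoning

  -- The end of the Chernoff argument: the potential of R requirements starts at R (N-1)^I and bounds the
  -- final weight of a requirement with h hits.
  hits-bound : ∀ x k l j E I h c {R} → k + k ≤ suc x →
    (let N = suc x * suc E) → N * j ≤ I → I ≡ h + c → h ≤ k * l →
    (x * suc E) ^ h * N ^ c ≤ R * pred N ^ I → x ≢ 0 → 2 ^ j ≤ R * 2 ^ l
  hits-bound x k l j E I h c {R} 2k≤ Nj≤I I≡ h≤ le x≢0 =
    *-cancelʳ-≤ _ _ (P ^ I * x ^ K) ⦃ m*n≢0 (P ^ I) (x ^ K) ⦃ m^n≢0 P I ⦃ P≢0 ⦄ ⦄ ⦃ m^n≢0 x K ⦃ ≢-nonZero x≢0 ⦄ ⦄ ⦄ (begin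
    2 ^ j * (P ^ I * x ^ K)                ≡⟨ *-assoc (2 ^ j) (P ^ I) (x ^ K) ⟨
    2 ^ j * P ^ I * x ^ K                  ≤⟨ *-monoˡ-≤ (x ^ K) step₁ ⟩
    N ^ I * x ^ K                          ≤⟨ step₂ ⟩
    (x * suc E) ^ h * N ^ c * suc x ^ K    ≤⟨ *-mono-≤ le (^≤*pred^ x k l 2k≤) ⟩
    R * P ^ I * (2 ^ l * x ^ K)            ≡⟨ lem R (P ^ I) (2 ^ l) (x ^ K) ⟩
    R * 2 ^ l * (P ^ I * x ^ K)            ∎)
    where
    open ≤-Reasoning
    K = k * l
    N = suc x * suc E
    P = pred N
    P≢0 : NonZero P
    P≢0 = ≢-nonZero (λ eq → x≢0 (m*n≡0⇒m≡0 x (suc E) (m+n≡0⇒n≡0 E eq)))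
    lem : ∀ a b c d → a * b * (c * d) ≡ a * c * (b * d)
    lem = solve-∀
    -- (1 - 1/N)^N ≤ 1/2 is used `j` times; each of the remaining `I ∸ N * j` factors is at most 1.
    step₁ : 2 ^ j * P ^ I ≤ N ^ I
    step₁ = begin
      2 ^ j * P ^ I                              ≡⟨ cong (λ z → 2 ^ j * P ^ z) (sym I=) ⟩
      2 ^ j * P ^ (N * j + (I ∸ N * j))          ≡⟨ cong (2 ^ j *_) (^-distribˡ-+-* P (N * j) _) ⟩
      2 ^ j * (P ^ (N * j) * P ^ (I ∸ N * j))    ≡⟨ *-assoc (2 ^ j) _ _ ⟨
      2 ^ j * P ^ (N * j) * P ^ (I ∸ N * j)      ≤⟨ *-mono-≤ (*^-mono 2 N j (2*pred^≤ P)) (^-monoˡ-≤ (I ∸ N * j) (n≤1+n P)) ⟩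
      N ^ (N * j) * N ^ (I ∸ N * j)              ≡⟨ ^-distribˡ-+-* N (N * j) _ ⟨
      N ^ (N * j + (I ∸ N * j))                  ≡⟨ cong (N ^_) I= ⟩
      N ^ I                                      ∎
      where
      I= : N * j + (I ∸ N * j) ≡ I
      I= = m+[n∸m]≡n Nj≤I
    -- Comparison with exactly `K` hits: every hit beyond `h` would multiply the weight by
    -- `x / suc x`, which is below 1.
    step₂ : N ^ I * x ^ K ≤ (x * suc E) ^ h * N ^ c * suc x ^ K
    step₂ = begin
      N ^ I * x ^ K                                    ≡⟨ cong₂ _*_ (trans (cong (N ^_) I≡) (^-distribˡ-+-* N h c)) (K= x) ⟩
      N ^ h * N ^ c * (x ^ h * x ^ (K ∸ h))            ≡⟨ cong (λ z → z * N ^ c * (x ^ h * x ^ (K ∸ h))) (^-distribʳ-* h (suc x) (suc E)) ⟩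
      suc x ^ h * suc E ^ h * N ^ c * (x ^ h * x ^ (K ∸ h)) ≡⟨ lem₂ (suc x ^ h) (suc E ^ h) (N ^ c) (x ^ h) (x ^ (K ∸ h)) ⟩
      x ^ h * suc E ^ h * N ^ c * (suc x ^ h * x ^ (K ∸ h)) ≡⟨ cong (λ z → z * N ^ c * (suc x ^ h * x ^ (K ∸ h))) (sym (^-distribʳ-* h x (suc E))) ⟩
      (x * suc E) ^ h * N ^ c * (suc x ^ h * x ^ (K ∸ h)) ≤⟨ *-monoʳ-≤ ((x * suc E) ^ h * N ^ c) (*-monoʳ-≤ (suc x ^ h) (^-monoˡ-≤ (K ∸ h) (n≤1+n x))) ⟩
      (x * suc E) ^ h * N ^ c * (suc x ^ h * suc x ^ (K ∸ h)) ≡⟨ cong ((x * suc E) ^ h * N ^ c *_) (sym (K= (suc x))) ⟩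
      (x * suc E) ^ h * N ^ c * suc x ^ K              ∎
      where
      K= : ∀ z → z ^ K ≡ z ^ h * z ^ (K ∸ h)
      K= z = trans (cong (z ^_) (sym (m+[n∸m]≡n h≤))) (^-distribˡ-+-* z h (K ∸ h))
      lem₂ : ∀ a b c d e → a * b * c * (d * e) ≡ d * b * c * (a * e)
      lem₂ = solve-∀

  -- Expected weights under one random choice

  -- Weights of one chain: B before a choice, Z an upper bound after it, Y one after a good choice.
  -- With η = e / N this says B ≥ (1 - η) Z and Y (1 + 2bη) ≤ Z.
  record Bounds (N b B : ℕ) : Set where
    constructor bounds
    field
      e Z Y : ℕ
      B≤Z   : B ≤ Z
      loss  : N * Z ≤ N * B + e * Z
      gain  : Y * (N + 2 * b * e) ≤ N * Z

  -- (1 - η)(1 - η′) ≥ 1 - (η + η′) and (1 + 2bη)(1 + 2bη′) ≥ 1 + 2b(η + η′), so the deficits of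
  -- chains with a common vertex add up. The more obvious bound Y ≤ (1 - 2bη)Z would not survive
  -- multiplication.
  bounds-* : ∀ {N b B B′} .{{_ : NonZero N}} (β : Bounds N b B) (β′ : Bounds N b B′) →
    Σ (Bounds N b (B * B′)) λ γ → Bounds.e γ ≡ Bounds.e β + Bounds.e β′ ×
      Bounds.Z γ ≡ Bounds.Z β * Bounds.Z β′ × Bounds.Y γ ≡ Bounds.Y β * Bounds.Y β′
  bounds-* {N} {b} {B} {B′} (bounds e Z Y B≤Z loss gain) (bounds e′ Z′ Y′ B′≤Z′ loss′ gain′) =
    bounds (e + e′) (Z * Z′) (Y * Y′) (*-mono-≤ B≤Z B′≤Z′) l g , refl , refl , refl
    where
    open ≤-Reasoning
    l : N * (Z * Z′) ≤ N * (B * B′) + (e + e′) * (Z * Z′)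
    l = begin
      N * (Z * Z′)                                   ≡⟨ *-assoc N Z Z′ ⟨
      N * Z * Z′                                     ≤⟨ *-monoˡ-≤ Z′ loss ⟩
      (N * B + e * Z) * Z′                           ≡⟨ a₁ N B e Z Z′ ⟩
      B * (N * Z′) + e * (Z * Z′)                    ≤⟨ +-monoˡ-≤ (e * (Z * Z′)) (*-monoʳ-≤ B loss′) ⟩
      B * (N * B′ + e′ * Z′) + e * (Z * Z′)          ≡⟨ a₂ B N B′ e′ Z′ (e * (Z * Z′)) ⟩
      N * (B * B′) + e′ * (B * Z′) + e * (Z * Z′)    ≤⟨ +-monoˡ-≤ (e * (Z * Z′)) (+-monoʳ-≤ (N * (B * B′)) (*-monoʳ-≤ e′ (*-monoˡ-≤ Z′ B≤Z))) ⟩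
      N * (B * B′) + e′ * (Z * Z′) + e * (Z * Z′)    ≡⟨ a₃ (N * (B * B′)) e e′ (Z * Z′) ⟩
      N * (B * B′) + (e + e′) * (Z * Z′)             ∎
      where
      a₁ : ∀ N B e Z Z′ → (N * B + e * Z) * Z′ ≡ B * (N * Z′) + e * (Z * Z′)
      a₁ = solve-∀
      a₂ : ∀ B N B′ e′ Z′ c → B * (N * B′ + e′ * Z′) + c ≡ N * (B * B′) + e′ * (B * Z′) + c
      a₂ = solve-∀
      a₃ : ∀ a e e′ z → a + e′ * z + e * z ≡ a + (e + e′) * z
      a₃ = solve-∀
    g : Y * Y′ * (N + 2 * b * (e + e′)) ≤ N * (Z * Z′)
    g = *-cancelˡ-≤ N (begin
      N * (Y * Y′ * (N + 2 * b * (e + e′)))                                ≤⟨ m≤m+n _ (Y * Y′ * (2 * b * e * (2 * b * e′))) ⟩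
      N * (Y * Y′ * (N + 2 * b * (e + e′))) + Y * Y′ * (2 * b * e * (2 * b * e′)) ≡⟨ a₁ N Y Y′ b e e′ ⟩
      (Y * (N + 2 * b * e)) * (Y′ * (N + 2 * b * e′))                      ≤⟨ *-mono-≤ gain gain′ ⟩
      N * Z * (N * Z′)                                                     ≡⟨ a₂ N Z Z′ ⟩
      N * (N * (Z * Z′))                                                   ∎)
      where
      a₁ : ∀ N Y Y′ b e e′ → N * (Y * Y′ * (N + 2 * b * (e + e′))) + Y * Y′ * (2 * b * e * (2 * b * e′))
                             ≡ (Y * (N + 2 * b * e)) * (Y′ * (N + 2 * b * e′))
      a₁ = solve-∀
      a₂ : ∀ N Z Z′ → N * Z * (N * Z′) ≡ N * (N * (Z * Z′))
      a₂ = solve-∀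

  Y≤Z : ∀ {N b B} .{{_ : NonZero N}} (β : Bounds N b B) → Bounds.Y β ≤ Bounds.Z β
  Y≤Z {N} {b} (bounds e Z Y _ _ gain) = *-cancelˡ-≤ N (begin
    N * Y               ≡⟨ *-comm N Y ⟩
    Y * N               ≤⟨ *-monoʳ-≤ Y (m≤m+n N _) ⟩
    Y * (N + 2 * b * e) ≤⟨ gain ⟩
    N * Z               ∎)
    where open ≤-Reasoning

  -- (b-1) Z + Y ≤ b B: a choice that is good with probability at least 1/b does not raise the expected weight.
  bounds-average : ∀ {N b B} .{{_ : NonZero N}} (β : Bounds N b B) → 2 * b * Bounds.e β ≤ N →
    b * Bounds.Z β + Bounds.Y β ≤ b * B + Bounds.Z β
  bounds-average {N} {b} {B} β@(bounds e Z Y B≤Z loss gain) small =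
    *-cancelˡ-≤ (2 * N) ⦃ m*n≢0 2 N ⦄ (begin
      2 * N * (b * Z + Y)                         ≡⟨ a₁ N b Z Y ⟩
      2 * b * (N * Z) + 2 * N * Y                 ≤⟨ +-monoˡ-≤ (2 * N * Y) (*-monoʳ-≤ (2 * b) loss) ⟩
      2 * b * (N * B + e * Z) + 2 * N * Y         ≡⟨ a₂ b N B e Z Y ⟩
      2 * N * (b * B) + (s * Z + N * Y + N * Y)   ≤⟨ +-monoʳ-≤ (2 * N * (b * B)) final ⟩
      2 * N * (b * B) + 2 * N * Z                 ≡⟨ a₃ N b B Z ⟩
      2 * N * (b * B + Z)                         ∎)
    where
    open ≤-Reasoning
    s = 2 * b * e
    a₁ : ∀ N b Z Y → 2 * N * (b * Z + Y) ≡ 2 * b * (N * Z) + 2 * N * Y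
    a₁ = solve-∀
    a₂ : ∀ b N B e Z Y → 2 * b * (N * B + e * Z) + 2 * N * Y ≡ 2 * N * (b * B) + (2 * b * e * Z + N * Y + N * Y)
    a₂ = solve-∀
    a₃ : ∀ N b B Z → 2 * N * (b * B) + 2 * N * Z ≡ 2 * N * (b * B + Z)
    a₃ = solve-∀
    -- This is (Z - Y)(N - s) ≥ 0, and here the deficit has to be small.
    cross : s * Z + N * Y ≤ N * Z + s * Y
    cross = begin
      s * Z + N * Y                            ≡⟨ cong₂ (λ z n → s * z + n * Y) (m+[n∸m]≡n (Y≤Z β)) (m+[n∸m]≡n small) ⟨
      s * (Y + d) + (s + r) * Y                ≤⟨ m≤m+n _ (r * d) ⟩
      s * (Y + d) + (s + r) * Y + r * d        ≡⟨ c₁ s Y d r ⟩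
      (s + r) * (Y + d) + s * Y                ≡⟨ cong₂ (λ z n → n * z + s * Y) (m+[n∸m]≡n (Y≤Z β)) (m+[n∸m]≡n small) ⟩
      N * Z + s * Y                            ∎
      where
      d = Z ∸ Y
      r = N ∸ s
      c₁ : ∀ s Y d r → s * (Y + d) + (s + r) * Y + r * d ≡ (s + r) * (Y + d) + s * Y
      c₁ = solve-∀
    final : s * Z + N * Y + N * Y ≤ 2 * N * Z
    final = begin
      s * Z + N * Y + N * Y        ≤⟨ +-monoˡ-≤ (N * Y) cross ⟩
      N * Z + s * Y + N * Y        ≡⟨ c₂ (N * Z) s Y N ⟩
      N * Z + Y * (N + s)          ≤⟨ +-monoʳ-≤ (N * Z) gain ⟩
      N * Z + N * Z                ≡⟨ c₃ N Z ⟩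
      2 * N * Z                    ∎
      where
      c₂ : ∀ a s Y N → a + s * Y + N * Y ≡ a + Y * (N + s)
      c₂ = solve-∀
      c₃ : ∀ N Z → N * Z + N * Z ≡ 2 * N * Z
      c₃ = solve-∀

  bounds-const : ∀ N b B → Bounds N b B
  bounds-const N b B = bounds 0 B B ≤-refl (m≤m+n (N * B) 0) (≤-reflexive (eq N b B))
    where
    eq : ∀ N b B → B * (N + 2 * b * 0) ≡ N * B
    eq = solve-∀

  -- The case of one chain whose next vertex is placed: a bad choice gives `N`, a good one
  -- `N - 2be`. The gain is (N - s)(N + s) ≤ N².
  bounds-step : ∀ {N b e} → 2 * b * e ≤ N → e ≤ N → Bounds N b (N ∸ e)
  bounds-step {N} {b} {e} s≤N e≤N = bounds e N (N ∸ s) (m∸n≤m N e) l g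
    where
    open ≤-Reasoning
    s = 2 * b * e
    l : N * N ≤ N * (N ∸ e) + e * N
    l = ≤-reflexive (trans (cong (N *_) (sym (m∸n+n≡m e≤N))) (trans (*-distribˡ-+ N (N ∸ e) e) (cong (N * (N ∸ e) +_) (*-comm N e))))
    g : (N ∸ s) * (N + s) ≤ N * N
    g = begin
      (N ∸ s) * (N + s)                 ≡⟨ cong (λ z → (N ∸ s) * (z + s)) (m∸n+n≡m s≤N) ⟨
      d * ((d + s) + s)                 ≤⟨ m≤m+n _ (s * s) ⟩
      d * ((d + s) + s) + s * s         ≡⟨ c d s ⟩
      (d + s) * (d + s)                 ≡⟨ cong (λ z → z * z) (m∸n+n≡m s≤N) ⟩
      N * N                             ∎
      where
      d = N ∸ s
      c : ∀ d s → d * ((d + s) + s) + s * s ≡ (d + s) * (d + s)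
      c = solve-∀

  -- Lists, finite sets and averages

  length-⊆ : ∀ {xs ys : List A} → Unique xs → (∀ {x} → x ∈ xs → x ∈ ys) → length xs ≤ length ys
  length-⊆ {xs = []}     _         _  = z≤n
  length-⊆ {xs = x ∷ xs} (x∉ ∷ u) sub with ∈-∃++ (sub (here refl))
  ... | ls , rs , refl = begin
    suc (length xs)             ≤⟨ s≤s (length-⊆ u sub′) ⟩
    suc (length (ls ++ rs))     ≡⟨ cong suc (length-++ ls) ⟩
    suc (length ls + length rs) ≡⟨ +-suc (length ls) (length rs) ⟨
    length ls + suc (length rs) ≡⟨ length-++ ls ⟨
    length (ls ++ x ∷ rs)       ∎
    where
    open ≤-Reasoning
    sub′ : ∀ {y} → y ∈ xs → y ∈ ls ++ rs
    sub′ {y} y∈ with ∈-++⁻ ls (sub (there y∈))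
    ... | inj₁ y∈ls          = ∈-++⁺ˡ y∈ls
    ... | inj₂ (here refl)   = ⊥-elim (All.lookup x∉ y∈ refl)
    ... | inj₂ (there y∈rs) = ∈-++⁺ʳ ls y∈rs

  module _ {P : A → Bool} where
    ∈-filterᵇ⁺ : ∀ {x xs} → x ∈ xs → T (P x) → x ∈ filterᵇ P xs
    ∈-filterᵇ⁺ = ∈-filter⁺ (T? ∘ P)

    ∈-filterᵇ⁻ : ∀ {x} xs → x ∈ filterᵇ P xs → x ∈ xs × T (P x)
    ∈-filterᵇ⁻ xs = ∈-filter⁻ (T? ∘ P) {xs = xs}

  count≡length : ∀ {n} (P : Fin n → Bool) → count P ≡ length (filterᵇ P (allFin n))
  count≡length P = go P id
    where
    go : ∀ {n} {A : Set} (P : A → Bool) (f : Fin n → A) → count (P ∘ f) ≡ length (filterᵇ P (tabulate f))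
    go {zero}  P f = refl
    go {suc n} P f with P (f zero)
    ... | true  = cong suc (go P (f ∘ suc))
    ... | false = go P (f ∘ suc)

  length-filterᵇ-∧ : ∀ (P Q : A → Bool) xs →
    length (filterᵇ P xs) + length (filterᵇ Q xs) ≤ length xs + length (filterᵇ (λ x → P x ∧ Q x) xs)
  length-filterᵇ-∧ P Q []       = z≤n
  length-filterᵇ-∧ P Q (x ∷ xs) with P x | Q x | length-filterᵇ-∧ P Q xs
  ... | true  | true  | ih = s≤s (begin
    p + suc q     ≡⟨ +-suc p q ⟩
    suc (p + q)   ≤⟨ s≤s ih ⟩
    suc (length xs + r) ≡⟨ +-suc (length xs) r ⟨
    length xs + suc r   ∎)
    where
    open ≤-Reasoning
    p = length (filterᵇ P xs)
    q = length (filterᵇ Q xs)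
    r = length (filterᵇ (λ x → P x ∧ Q x) xs)
  ... | true  | false | ih = s≤s ih
  ... | false | true  | ih = ≤-trans (≤-reflexive (+-suc (length (filterᵇ P xs)) _)) (s≤s ih)
  ... | false | false | ih = ≤-trans ih (n≤1+n _)

  length-filterᵇ-true : ∀ (P : A → Bool) xs → (∀ x → T (P x)) → length (filterᵇ P xs) ≡ length xs
  length-filterᵇ-true P []       h = refl
  length-filterᵇ-true P (x ∷ xs) h with P x | h x
  ... | true | _ = cong suc (length-filterᵇ-true P xs h)

  module _ {n : ℕ} where

    unused : List (Fin n) → Fin n → Bool
    unused xs v = not ⌊ v ∈? xs ⌋

    unused⇒∉ : ∀ {xs v} → T (unused xs v) → v ∉ xs
    unused⇒∉ {xs} {v} u v∈ with v ∈? xs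
    ... | no v∉ = v∉ v∈

    ∉⇒unused : ∀ {xs v} → v ∉ xs → T (unused xs v)
    ∉⇒unused {xs} {v} v∉ with v ∈? xs
    ... | no _   = tt
    ... | yes v∈ = v∉ v∈

    length-filterᵇ-unused : ∀ (P : Fin n → Bool) {ys} → Unique ys → ∀ xs →
      length (filterᵇ P ys) ≤ length xs + length (filterᵇ (λ v → unused xs v ∧ P v) ys)
    length-filterᵇ-unused P {ys} u xs = begin
      length (filterᵇ P ys) ≤⟨ length-⊆ (filter⁺ (T? ∘ P) u) sub ⟩
      length (xs ++ rest)   ≡⟨ length-++ xs ⟩
      length xs + length rest ∎
      where
      open ≤-Reasoning
      rest = filterᵇ (λ v → unused xs v ∧ P v) ys
      sub : ∀ {v} → v ∈ filterᵇ P ys → v ∈ xs ++ rest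
      sub {v} v∈ with v ∈? xs
      ... | yes v∈xs = ∈-++⁺ˡ v∈xs
      ... | no  v∉xs with ∈-filterᵇ⁻ ys v∈
      ... | v∈ys , Pv = ∈-++⁺ʳ xs (∈-filterᵇ⁺ v∈ys (Equivalence.from T-∧ (∉⇒unused v∉xs , Pv)))

    fromList : List (Fin n) → Subset n
    fromList []       = ⊥
    fromList (x ∷ xs) = fromList xs [ x ]≔ inside

    ∈-fromList⁺ : ∀ {x xs} → x ∈ xs → x ∈ₛ fromList xs
    ∈-fromList⁺ {x} {y ∷ xs} x∈ with x ≟ y
    ... | yes refl = lookup⇒[]= x _ (lookup∘update x (fromList xs) inside)
    ... | no  x≢y with x∈
    ... | here x≡y = ⊥-elim (x≢y x≡y)
    ... | there x∈xs = lookup⇒[]= x _ (trans (lookup∘update′ x≢y (fromList xs) inside) ([]=⇒lookup (∈-fromList⁺ x∈xs)))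

    ∈-fromList⁻ : ∀ {x xs} → x ∈ₛ fromList xs → x ∈ xs
    ∈-fromList⁻ {x} {[]}     x∈ = ⊥-elim (∉⊥ x∈)
    ∈-fromList⁻ {x} {y ∷ xs} x∈ with x ≟ y
    ... | yes refl = here refl
    ... | no  x≢y  = there (∈-fromList⁻ (lookup⇒[]= x _ (trans (sym (lookup∘update′ x≢y (fromList xs) inside)) ([]=⇒lookup x∈))))

  insert-size : ∀ {n} (p : Subset n) x → lookup p x ≡ outside → ∣ p [ x ]≔ inside ∣ ≡ suc ∣ p ∣
  insert-size (outside ∷ p) zero    refl = refl
  insert-size (inside  ∷ p) (suc x) eq   = cong suc (insert-size p x eq)
  insert-size (outside ∷ p) (suc x) eq   = insert-size p x eq

  insert-size-≤ : ∀ {n} (p : Subset n) x → ∣ p [ x ]≔ inside ∣ ≤ suc ∣ p ∣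
  insert-size-≤ (outside ∷ p) zero    = ≤-refl
  insert-size-≤ (inside ∷ p)  zero    = n≤1+n _
  insert-size-≤ (inside  ∷ p) (suc x) = s≤s (insert-size-≤ p x)
  insert-size-≤ (outside ∷ p) (suc x) = insert-size-≤ p x

  module _ {n : ℕ} where

    fromList-size : ∀ {xs : List (Fin n)} → Unique xs → ∣ fromList xs ∣ ≡ length xs
    fromList-size {[]}     _        = ∣⊥∣≡0 n
    fromList-size {x ∷ xs} (x∉ ∷ u) = trans (insert-size (fromList xs) x out) (cong suc (fromList-size u))
      where
      out : lookup (fromList xs) x ≡ outside
      out with lookup (fromList xs) x in eq
      ... | outside = refl
      ... | inside  = ⊥-elim (All.lookup x∉ (∈-fromList⁻ (lookup⇒[]= x _ eq)) refl)

    fromList-size-≤ : ∀ (xs : List (Fin n)) → ∣ fromList xs ∣ ≤ length xs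
    fromList-size-≤ []       = ≤-reflexive (∣⊥∣≡0 n)
    fromList-size-≤ (x ∷ xs) = ≤-trans (insert-size-≤ (fromList xs) x) (s≤s (fromList-size-≤ xs))

    size-≤-cover : ∀ {p : Subset n} {xs : List (Fin n)} → (∀ {v} → v ∈ₛ p → v ∈ xs) → ∣ p ∣ ≤ length xs
    size-≤-cover {xs = xs} cover = ≤-trans (p⊆q⇒∣p∣≤∣q∣ (λ v∈ → ∈-fromList⁺ (cover v∈))) (fromList-size-≤ xs)

  length-partition : ∀ (P : A → Bool) xs → length xs ≡ length (filterᵇ P xs) + length (filterᵇ (not ∘ P) xs)
  length-partition P []       = refl
  length-partition P (x ∷ xs) with P x
  ... | true  = cong suc (length-partition P xs)
  ... | false = trans (cong suc (length-partition P xs)) (sym (+-suc (length (filterᵇ P xs)) _))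

  module _ (good : A → Bool) {W : A → ℕ} {Y Z : ℕ} where

    -- Each good entry saves `Z - Y` against the trivial bound `length xs * Z`; the terms are
    -- arranged so that no subtraction occurs.
    sum-two-valued : ∀ xs → (∀ x → x ∈ xs → W x ≤ Z) → (∀ x → x ∈ xs → T (good x) → W x ≤ Y) →
      sum (map W xs) + length (filterᵇ good xs) * Z ≤ length xs * Z + length (filterᵇ good xs) * Y
    sum-two-valued []       _ _ = z≤n
    sum-two-valued (x ∷ xs) hZ hY with good x | hY x (here refl)
        | sum-two-valued xs (λ y → hZ y ∘ there) (λ y → hY y ∘ there)
    ... | true  | h | ih = begin
      W x + S + (Z + G * Z)     ≡⟨ a₁ (W x) S Z (G * Z) ⟩
      W x + Z + (S + G * Z)     ≤⟨ +-mono-≤ (+-monoˡ-≤ Z (h tt)) ih ⟩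
      Y + Z + (L + G * Y)       ≡⟨ a₂ Y Z L (G * Y) ⟩
      Z + L + (Y + G * Y)       ∎
      where
      open ≤-Reasoning
      S = sum (map W xs)
      G = length (filterᵇ good xs)
      L = length xs * Z
      a₁ : ∀ w s z g → w + s + (z + g) ≡ w + z + (s + g)
      a₁ = solve-∀
      a₂ : ∀ y z l g → y + z + (l + g) ≡ z + l + (y + g)
      a₂ = solve-∀
    ... | false | _ | ih = begin
      W x + S + G * Z     ≡⟨ +-assoc (W x) S (G * Z) ⟩
      W x + (S + G * Z)   ≤⟨ +-mono-≤ (hZ x (here refl)) ih ⟩
      Z + (L + G * Y)     ≡⟨ +-assoc Z L (G * Y) ⟨
      Z + L + G * Y       ∎
      where
      open ≤-Reasoning
      S = sum (map W xs)
      G = length (filterᵇ good xs)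
      L = length xs * Z

    -- If exactly a fraction 1/b of the entries were good, the average would be at most ((b-1)Z +
    -- Y)/b ≤ B. More good entries can only lower this bound, because Y ≤ Z.
    sum-average : ∀ {b B} .{{_ : NonZero b}} xs → (∀ x → x ∈ xs → W x ≤ Z) → (∀ x → x ∈ xs → T (good x) → W x ≤ Y) →
      Y ≤ Z → length xs ≤ b * length (filterᵇ good xs) → b * Z + Y ≤ b * B + Z →
      sum (map W xs) ≤ length xs * B
    sum-average {b} {B} xs hZ hY Y≤Z many avg =
      *-cancelˡ-≤ b (+-cancelʳ-≤ (b * (g * Z) + o * Y) _ _ (begin
        b * S + (b * (g * Z) + o * Y)             ≡⟨ a₁ b S (g * Z) (o * Y) ⟩
        b * (S + g * Z) + o * Y                   ≤⟨ +-monoˡ-≤ (o * Y) (*-monoʳ-≤ b (sum-two-valued xs hZ hY)) ⟩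
        b * (o * Z + g * Y) + o * Y               ≡⟨ a₂ b o Z g Y ⟩
        o * (b * Z + Y) + b * g * Y               ≤⟨ +-monoˡ-≤ (b * g * Y) (*-monoʳ-≤ o avg) ⟩
        o * (b * B + Z) + b * g * Y               ≡⟨ a₃ o b B Z (b * g * Y) ⟩
        b * (o * B) + (o * Z + b * g * Y)         ≤⟨ +-monoʳ-≤ (b * (o * B)) cross ⟩
        b * (o * B) + (b * g * Z + o * Y)         ≡⟨ cong (λ z → b * (o * B) + (z + o * Y)) (*-assoc b g Z) ⟩
        b * (o * B) + (b * (g * Z) + o * Y)       ∎))
      where
      open ≤-Reasoning
      S = sum (map W xs)
      o = length xs
      g = length (filterᵇ good xs)
      a₁ : ∀ b S x y → b * S + (b * x + y) ≡ b * (S + x) + y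
      a₁ = solve-∀
      a₂ : ∀ b o Z g Y → b * (o * Z + g * Y) + o * Y ≡ o * (b * Z + Y) + b * g * Y
      a₂ = solve-∀
      a₃ : ∀ o b B Z x → o * (b * B + Z) + x ≡ b * (o * B) + (o * Z + x)
      a₃ = solve-∀
      cross : o * Z + b * g * Y ≤ b * g * Z + o * Y
      cross = begin
        o * Z + b * g * Y                ≡⟨ cong₂ (λ z x → o * z + x * Y) (m+[n∸m]≡n Y≤Z) (m+[n∸m]≡n many) ⟨
        o * (Y + d) + (o + r) * Y        ≤⟨ m≤m+n _ (r * d) ⟩
        o * (Y + d) + (o + r) * Y + r * d ≡⟨ c o Y d r ⟩
        (o + r) * (Y + d) + o * Y        ≡⟨ cong₂ (λ z x → x * z + o * Y) (m+[n∸m]≡n Y≤Z) (m+[n∸m]≡n many) ⟩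
        b * g * Z + o * Y                ∎
        where
        d = Z ∸ Y
        r = b * g ∸ o
        c : ∀ o Y d r → o * (Y + d) + (o + r) * Y + r * d ≡ (o + r) * (Y + d) + o * Y
        c = solve-∀

  sum-map-+ : ∀ (f g : A → ℕ) xs → sum (map (λ x → f x + g x) xs) ≡ sum (map f xs) + sum (map g xs)
  sum-map-+ f g []       = refl
  sum-map-+ f g (x ∷ xs) = trans (cong (f x + g x +_) (sum-map-+ f g xs)) (lem (f x) (g x) _ _)
    where
    lem : ∀ a b c d → a + b + (c + d) ≡ a + c + (b + d)
    lem = solve-∀

  sum-map-0 : ∀ (xs : List A) → sum (map (λ _ → 0) xs) ≡ 0
  sum-map-0 []       = refl
  sum-map-0 (x ∷ xs) = sum-map-0 xs

  sum-swap : ∀ {C : Set} (f : A → C → ℕ) xs ys →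
    sum (map (λ x → sum (map (f x) ys)) xs) ≡ sum (map (λ y → sum (map (λ x → f x y) xs)) ys)
  sum-swap f []       ys = sym (sum-map-0 ys)
  sum-swap f (x ∷ xs) ys = trans (cong (sum (map (f x) ys) +_) (sum-swap f xs ys)) (sym (sum-map-+ (f x) _ ys))

  sum-map-≤ : ∀ {f g : A → ℕ} xs → (∀ x → f x ≤ g x) → sum (map f xs) ≤ sum (map g xs)
  sum-map-≤ []       h = z≤n
  sum-map-≤ (x ∷ xs) h = +-mono-≤ (h x) (sum-map-≤ xs h)

  sum-map-* : ∀ c (f : A → ℕ) xs → sum (map (λ x → c * f x) xs) ≡ c * sum (map f xs)
  sum-map-* c f []       = sym (*-zeroʳ c)
  sum-map-* c f (x ∷ xs) = trans (cong (c * f x +_) (sum-map-* c f xs)) (sym (*-distribˡ-+ c (f x) _))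

  sum-map-const : ∀ c (xs : List A) → sum (map (λ _ → c) xs) ≡ length xs * c
  sum-map-const c []       = refl
  sum-map-const c (x ∷ xs) = cong (c +_) (sum-map-const c xs)

  ∈⇒≤sum : ∀ (f : A → ℕ) {x xs} → x ∈ xs → f x ≤ sum (map f xs)
  ∈⇒≤sum f (here refl) = m≤m+n _ _
  ∈⇒≤sum f {xs = y ∷ _} (there x∈)  = ≤-trans (∈⇒≤sum f x∈) (m≤n+m _ (f y))

  exists-≤-average : ∀ (Φ : A → ℕ) {B} xs → 0 < length xs → sum (map Φ xs) ≤ length xs * B →
    ∃ λ x → x ∈ xs × Φ x ≤ B
  exists-≤-average Φ {B} (x ∷ xs) _ le with Φ x ≤? B
  ... | yes h = x , here refl , h
  ... | no ¬h with xs
  ...   | [] = ⊥-elim (¬h (≤-trans (m≤m+n _ 0) (≤-trans le (≤-reflexive (+-identityʳ B)))))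
  ...   | y ∷ ys with exists-≤-average Φ (y ∷ ys) (s≤s z≤n)
                        (+-cancelˡ-≤ B _ _ (≤-trans (+-monoˡ-≤ _ (<⇒≤ (≰⇒> ¬h))) le))
  ...     | z , z∈ , h = z , there z∈ , h

  -- Neighbourhood constraints in the host digraph

  adjS : Digraph n → Bool → Fin n → Fin n → Bool
  adjS D true  y v = arc D y v
  adjS D false y v = arc D v y

  -- A pair `(s , y)` confines a vertex to the out-neighbourhood of `y` if `s` is `true` and to the
  -- in-neighbourhood if it is `false`.
  Constraint : ℕ → Set
  Constraint n = Bool × Fin n

  sat : Digraph n → List (Constraint n) → Fin n → Bool
  sat D []             v = true
  sat D ((s , y) ∷ cs) v = adjS D s y v ∧ sat D cs v

  sat-++ : ∀ (D : Digraph n) cs {cs′ v} → T (sat D (cs ++ cs′) v) → T (sat D cs v) × T (sat D cs′ v)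
  sat-++ D []             h = tt , h
  sat-++ D ((s , y) ∷ cs) h with Equivalence.to T-∧ h
  ... | h₁ , h₂ with sat-++ D cs h₂
  ...   | h₃ , h₄ = Equivalence.from T-∧ (h₁ , h₃) , h₄

  sat⇒adjS : ∀ (D : Digraph n) {cs s y v} → T (sat D cs v) → (s , y) ∈ cs → T (adjS D s y v)
  sat⇒adjS D h (here refl) = proj₁ (Equivalence.to T-∧ h)
  sat⇒adjS D {c ∷ cs} h (there c∈) = sat⇒adjS D {cs} (proj₂ (Equivalence.to T-∧ h)) c∈

  -- The factor 2 leaves room for the partial embedding: if `a * m ≤ n`, it occupies at most n/a of
  -- the 2n/a suitable vertices.
  Rich : ℕ → Digraph n → Set
  Rich {n} a D = ∀ cs → length cs ≤ 2 → 2 * n ≤ a * length (filterᵇ (sat D cs) (allFin n))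

  update : (Fin m → Fin n) → Fin m → Fin n → Fin m → Fin n
  update f w v y = if ⌊ y ≟ w ⌋ then v else f y

  update-≡ : ∀ (f : Fin m → Fin n) w v → update f w v w ≡ v
  update-≡ f w v with w ≟ w
  ... | yes _  = refl
  ... | no w≢w = ⊥-elim (w≢w refl)

  update-≢ : ∀ (f : Fin m → Fin n) {w} v {y} → y ≢ w → update f w v y ≡ f y
  update-≢ f {w} v {y} y≢w with y ≟ w
  ... | yes y≡w = ⊥-elim (y≢w y≡w)
  ... | no _    = refl

  -- Weights of chains while vertices are placed

  -- B is the weight before a vertex is placed, W v the weight after it is placed at v.
  Step : (N b B : ℕ) (W : Fin n → ℕ) (good : Fin n → Bool) (s : ℕ) → Set
  Step N b B W good s = Σ (Bounds N b B) λ β → 2 * b * Bounds.e β ≤ s ×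
    (∀ v → W v ≤ Bounds.Z β) × (∀ v → T (good v) → W v ≤ Bounds.Y β)

  step-cong : ∀ {N b B B′ s} {W W′ : Fin n → ℕ} {good} → B ≡ B′ → (∀ v → W v ≡ W′ v) → Step N b B W good s → Step N b B′ W′ good s
  step-cong refl W≡ (β , s , hz , hy) =
    β , s , (λ v → ≤-trans (≤-reflexive (sym (W≡ v))) (hz v)) , (λ v k → ≤-trans (≤-reflexive (sym (W≡ v))) (hy v k))

  step-const : ∀ {N b B s} {W : Fin n → ℕ} {good} → (∀ v → W v ≡ B) → Step N b B W good s
  step-const {N = N} {b} {B} W≡ = bounds-const N b B , ≤-trans (≤-reflexive (*-zeroʳ (2 * b))) z≤n ,
    (λ v → ≤-reflexive (W≡ v)) , (λ v _ → ≤-reflexive (W≡ v))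

  step-* : ∀ {N b B B′ s s′} .{{_ : NonZero N}} {W W′ : Fin n → ℕ} {good} →
    Step N b B W good s → Step N b B′ W′ good s′ → Step N b (B * B′) (λ v → W v * W′ v) good (s + s′)
  step-* {b = b} (β , s , hz , hy) (β′ , s′ , hz′ , hy′) with bounds-* β β′
  ... | γ , refl , refl , refl = γ ,
    ≤-trans (≤-reflexive (*-distribˡ-+ (2 * b) (Bounds.e β) (Bounds.e β′))) (+-mono-≤ s s′) ,
    (λ v → *-mono-≤ (hz v) (hz′ v)) , (λ v k → *-mono-≤ (hy v k) (hy′ v k))

  step-relax : ∀ {N b B s s′} {W : Fin n → ℕ} {good} → s ≤ s′ → Step N b B W good s → Step N b B W good s′
  step-relax s≤s′ (β , s , h) = β , ≤-trans s s≤s′ , h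

  -- Chains have to be placed in their order, because `wt` stops at the first unplaced vertex and
  -- would ignore choices already made further down.
  data Prefix {m} (ds : List (Fin m)) : List (Fin m) → Set where
    unplaced : ∀ {ch} → All (_∉ ds) ch → Prefix ds ch
    placed   : ∀ {y ch} → y ∈ ds → Prefix ds ch → Prefix ds (y ∷ ch)

  -- Finally a chain has weight N - E if every y in it is mapped to a vertex satisfying ok y, and N otherwise.
  -- When the vertices in ds are placed, wt bounds the conditional expectation of this weight if each remaining
  -- choice is good with probability at least 1/b: a good choice may turn N - e into N - be, and the extra
  -- factor 2 pays for products of up to N/E chains that share their next vertex.
  wt : (N b : ℕ) → (Fin m → Fin n → Bool) → List (Fin m) → (Fin m → Fin n) → ℕ → List (Fin m) → ℕ
  wt N b ok ds f e []       = N ∸ e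
  wt N b ok ds f e (y ∷ ch) =
    if ⌊ y ∈? ds ⌋ then (if ok y (f y) then wt N b ok ds f (2 * b * e) ch else N) else N ∸ e

  allᵇ : ∀ {A : Set} → (A → Bool) → List A → Bool
  allᵇ p []       = true
  allᵇ p (x ∷ xs) = p x ∧ allᵇ p xs

  allᵇ⁻ : ∀ {A : Set} (p : A → Bool) {x xs} → T (allᵇ p xs) → x ∈ xs → T (p x)
  allᵇ⁻ p h (here refl) = proj₁ (Equivalence.to T-∧ h)
  allᵇ⁻ p {xs = y ∷ _} h (there x∈)  = allᵇ⁻ p (proj₂ (Equivalence.to (T-∧ {p y}) h)) x∈

  module _ (N b : ℕ) (ok : Fin m → Fin n → Bool) where

    wt≤N : ∀ ds f e ch → wt N b ok ds f e ch ≤ N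
    wt≤N ds f e []       = m∸n≤m N e
    wt≤N ds f e (y ∷ ch) with y ∈? ds
    ... | no _  = m∸n≤m N e
    ... | yes _ with ok y (f y)
    ...   | true  = wt≤N ds f (2 * b * e) ch
    ...   | false = ≤-refl

    wt-unplaced : ∀ ds f e {ch} → All (_∉ ds) ch → wt N b ok ds f e ch ≡ N ∸ e
    wt-unplaced ds f e [] = refl
    wt-unplaced ds f e {y ∷ ch} (y∉ ∷ _) with y ∈? ds
    ... | yes y∈ = ⊥-elim (y∉ y∈)
    ... | no _   = refl

    wt-∷-placed : ∀ ds f e {y} ch → y ∈ ds →
      wt N b ok ds f e (y ∷ ch) ≡ (if ok y (f y) then wt N b ok ds f (2 * b * e) ch else N)
    wt-∷-placed ds f e {y} ch y∈ with y ∈? ds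
    ... | yes _  = refl
    ... | no  y∉ = ⊥-elim (y∉ y∈)

    wt-placed : ∀ ds f e ch → (∀ y → y ∈ ds) →
      wt N b ok ds f e ch ≡ (if allᵇ (λ y → ok y (f y)) ch then N ∸ (2 * b) ^ length ch * e else N)
    wt-placed ds f e []       all = cong (N ∸_) (sym (+-identityʳ e))
    wt-placed ds f e (y ∷ ch) all with y ∈? ds
    ... | no y∉ = ⊥-elim (y∉ (all y))
    ... | yes _ with ok y (f y)
    ...   | false = refl
    ...   | true  = trans (wt-placed ds f (2 * b * e) ch all)
                          (cong (λ z → if allᵇ (λ y → ok y (f y)) ch then N ∸ z else N) (lem (2 * b) ((2 * b) ^ length ch) e))
      where
      lem : ∀ x y e → y * (x * e) ≡ x * y * e
      lem = solve-∀

    wt-update-∉ : ∀ ds f e w v ch → w ∉ ds → w ∉ ch → wt N b ok (w ∷ ds) (update f w v) e ch ≡ wt N b ok ds f e ch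
    wt-update-∉ ds f e w v []       _   _   = refl
    wt-update-∉ ds f e w v (y ∷ ch) w∉ds w∉ with y ∈? ds | y ∈? (w ∷ ds)
    ... | yes y∈ | no y∉′        = ⊥-elim (y∉′ (there y∈))
    ... | no _   | no _          = refl
    ... | no y∉  | yes (there y∈) = ⊥-elim (y∉ y∈)
    ... | no _   | yes (here eq) = ⊥-elim (w∉ (here (sym eq)))
    ... | yes y∈ | yes _ rewrite update-≢ f {w} v {y} (λ eq → w∉ (here (sym eq))) with ok y (f y)
    ...   | true  = wt-update-∉ ds f (2 * b * e) w v ch w∉ds (w∉ ∘ there)
    ...   | false = refl

    module _ .{{_ : NonZero b}} {E} (E≤N : E ≤ N) (ds : List (Fin m)) (f : Fin m → Fin n)
             (w : Fin m) (w∉ds : w ∉ ds) where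

      WtStep : ℕ → List (Fin m) → ℕ → Set
      WtStep e ch = Step N b (wt N b ok ds f e ch) (λ v → wt N b ok (w ∷ ds) (update f w v) e ch) (ok w)

      wt-step-∉ : ∀ e ch {E′} → w ∉ ch → WtStep e ch E′
      wt-step-∉ e ch w∉ = step-const (λ v → wt-update-∉ ds f e w v ch w∉ds w∉)

      -- The weight changes only if `w` is the first unplaced vertex of the chain. The bound on
      -- `(2 * b) ^ length ch * e` is invariant under a good choice, which trades one remaining
      -- vertex for a factor `2 * b` in the deficit, and so the deficit never exceeds `E`.
      wt-step : ∀ e ch → Unique ch → Prefix ds ch → (2 * b) ^ length ch * e ≤ E → WtStep e ch E
      wt-step e [] _ _ _ = wt-step-∉ e [] (λ ())
      wt-step e (y ∷ ch) (y# ∷ u) p le = go (y ≟ w) p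
        where
        here-placed : y ≡ w → All (_∉ ds) (y ∷ ch) → WtStep e (y ∷ ch) E
        here-placed refl un@(_ ∷ ch∉) = step-cong (sym (wt-unplaced ds f e un)) (λ _ → refl)
          (bounds-step s≤N e≤N , s≤E , (λ v → wt≤N (y ∷ ds) (update f y v) e (y ∷ ch)) , good)
          where
          s≤E : 2 * b * e ≤ E
          s≤E = begin
            2 * b * e                   ≤⟨ *-monoˡ-≤ e (m≤m*n (2 * b) ((2 * b) ^ length ch) ⦃ m^n≢0 (2 * b) (length ch) ⦃ m*n≢0 2 b ⦄ ⦄) ⟩
            2 * b * (2 * b) ^ length ch * e ≤⟨ le ⟩
            E                           ∎
            where open ≤-Reasoning
          s≤N : 2 * b * e ≤ N
          s≤N = ≤-trans s≤E E≤N
          e≤N : e ≤ N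
          e≤N = ≤-trans (m≤n*m e (2 * b) ⦃ m*n≢0 2 b ⦄) s≤N
          ch∉′ : All (_∉ y ∷ ds) ch
          ch∉′ = All.zipWith (λ { (y≢z , z∉) (here eq) → y≢z (sym eq) ; (y≢z , z∉) (there z∈) → z∉ z∈ }) (y# , ch∉)
          good : ∀ v → T (ok y v) → wt N b ok (y ∷ ds) (update f y v) e (y ∷ ch) ≤ N ∸ 2 * b * e
          good v okv with ok y (update f y v y) in eq | wt-∷-placed (y ∷ ds) (update f y v) e ch (here refl)
          ... | true  | wt≡ = ≤-reflexive (trans wt≡ (wt-unplaced (y ∷ ds) (update f y v) (2 * b * e) ch∉′))
          ... | false | _   = ⊥-elim (subst T (trans (cong (ok y) (sym (update-≡ f y v))) eq) okv)

        elsewhere : y ≢ w → y ∈ ds → Prefix ds ch → WtStep e (y ∷ ch) E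
        elsewhere y≢w y∈ p = step-cong (sym (wt-∷-placed ds f e ch y∈))
          (λ v → sym (trans (wt-∷-placed (w ∷ ds) (update f w v) e ch (there y∈))
            (cong (λ z → if ok y z then wt N b ok (w ∷ ds) (update f w v) (2 * b * e) ch else N) (update-≢ f v y≢w)))) after
          where
          lem : ∀ x y e → x * (y * e) ≡ y * x * e
          lem = solve-∀
          after : Step N b (if ok y (f y) then wt N b ok ds f (2 * b * e) ch else N)
            (λ v → if ok y (f y) then wt N b ok (w ∷ ds) (update f w v) (2 * b * e) ch else N) (ok w) E
          after with ok y (f y)
          ... | false = step-const (λ _ → refl)
          ... | true  = wt-step (2 * b * e) ch u p (≤-trans (≤-reflexive (lem ((2 * b) ^ length ch) (2 * b) e)) le)

        go : Dec (y ≡ w) → Prefix ds (y ∷ ch) → WtStep e (y ∷ ch) E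
        go (yes refl) (placed y∈ _)   = ⊥-elim (w∉ds y∈)
        go (yes y≡w)  (unplaced un)   = here-placed y≡w un
        go (no y≢w)   (placed y∈ p)   = elsewhere y≢w y∈ p
        go (no y≢w)   (unplaced un@(y∉ ∷ _)) = step-cong (sym (wt-unplaced ds f e un)) (λ _ → refl)
          (step-const (λ v → wt-unplaced′ v))
          where
          wt-unplaced′ : ∀ v → wt N b ok (w ∷ ds) (update f w v) e (y ∷ ch) ≡ N ∸ e
          wt-unplaced′ v with y ∈? (w ∷ ds)
          ... | no _           = refl
          ... | yes (here y≡w) = ⊥-elim (y≢w y≡w)
          ... | yes (there y∈) = ⊥-elim (y∉ y∈)

  -- Placement by conditional expectations

  edgeConstraints : OrientedTree m → List (Fin m) → (Fin m → Fin n) → Fin m → List (Constraint n)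
  edgeConstraints Tr ds f w = map (λ y → arc (digraph Tr) y w , f y) (filterᵇ (adj (digraph Tr) w) ds)

  record Embeds (Tr : OrientedTree m) (D : Digraph n) (ds : List (Fin m)) (f : Fin m → Fin n) : Set where
    field
      injective : ∀ {y z} → y ∈ ds → z ∈ ds → f y ≡ f z → y ≡ z
      arcs      : ∀ {y z} → y ∈ ds → z ∈ ds → T (arc (digraph Tr) y z) → T (arc D (f y) (f z))

  embeds-update : ∀ (Tr : OrientedTree m) (D : Digraph n) {ds f w v} → w ∉ ds → (∀ {y} → y ∈ ds → f y ≢ v) →
    (∀ {y} → y ∈ ds → T (adj (digraph Tr) w y) → T (adjS D (arc (digraph Tr) y w) (f y) v)) →
    Embeds Tr D ds f → Embeds Tr D (w ∷ ds) (update f w v)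
  embeds-update Tr D {ds} {f} {w} {v} w∉ fresh new emb = record { injective = inj ; arcs = hom }
    where
    open Embeds emb
    G = digraph Tr
    old : ∀ {y} → y ∈ ds → update f w v y ≡ f y
    old y∈ = update-≢ f v (λ { refl → w∉ y∈ })
    inj : ∀ {y z} → y ∈ w ∷ ds → z ∈ w ∷ ds → update f w v y ≡ update f w v z → y ≡ z
    inj (here refl) (here refl) _  = refl
    inj (here refl) (there z∈)  eq = ⊥-elim (fresh z∈ (trans (sym (old z∈)) (trans (sym eq) (update-≡ f w v))))
    inj (there y∈)  (here refl) eq = ⊥-elim (fresh y∈ (trans (sym (old y∈)) (trans eq (update-≡ f w v))))
    inj (there y∈)  (there z∈)  eq = injective y∈ z∈ (trans (sym (old y∈)) (trans eq (old z∈)))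
    hom : ∀ {y z} → y ∈ w ∷ ds → z ∈ w ∷ ds → T (arc G y z) → T (arc D (update f w v y) (update f w v z))
    hom (here refl) (here refl) a = ⊥-elim (subst T (noLoops G w) a)
    hom {z = z} (here refl) (there z∈) a rewrite update-≡ f w v | old z∈ =
      subst (λ s → T (adjS D s (f z) v)) (oriented Tr w z a) (new z∈ (Equivalence.from T-∨ (inj₁ a)))
    hom {y} (there y∈) (here refl) a rewrite update-≡ f w v | old y∈ =
      subst (λ s → T (adjS D s (f y) v)) (Equivalence.to T-≡ a) (new y∈ (Equivalence.from T-∨ (inj₂ a)))
    hom (there y∈)  (there z∈)  a rewrite old y∈ | old z∈ = arcs y∈ z∈ a

  product-if : ∀ {A : Set} (p : A → Bool) a c i J →
    (if p i then a else c) * (a ^ length (filterᵇ p J) * c ^ length (filterᵇ (not ∘ p) J))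
    ≡ a ^ length (filterᵇ p (i ∷ J)) * c ^ length (filterᵇ (not ∘ p) (i ∷ J))
  product-if p a c i J with p i
  ... | true  = sym (*-assoc a _ _)
  ... | false = lem c (a ^ length (filterᵇ p J)) _
    where
    lem : ∀ a b c → a * (b * c) ≡ b * (a * c)
    lem = solve-∀

  module Placement {m n : ℕ} {R : Set} (Tr : OrientedTree m) (D : Digraph n)
    (b S x E′ : ℕ) (I : List (Fin m)) (ch : Fin m → List (Fin m))
    (pc : R → Fin m → List (Constraint n)) (rs : List R) where

    G : Digraph m
    G = digraph Tr

    E N : ℕ
    E = suc E′
    N = suc x * E

    ok : R → Fin m → Fin n → Bool
    ok r w = sat D (pc r w)

    hit : R → (Fin m → Fin n) → Fin m → Bool
    hit r f i = allᵇ (λ y → ok r y (f y)) (ch i)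

    weight : R → List (Fin m) → (Fin m → Fin n) → ℕ
    weight r ds f = product (map (λ i → wt N b (ok r) ds f 1 (ch i)) I)

    potential : List (Fin m) → (Fin m → Fin n) → ℕ
    potential ds f = sum (map (λ r → weight r ds f) rs)

    -- The list has the vertex placed last at its head.
    data Order : List (Fin m) → Set where
      []    : Order []
      place : ∀ {w ds} → Order ds → w ∉ ds →
              (∀ r → length (filterᵇ (adj G w) ds) + length (pc r w) ≤ 2) →
              (∀ {i} → i ∈ I → Prefix (w ∷ ds) (ch i)) → Order (w ∷ ds)

    Order⇒Unique : ∀ {ds} → Order ds → Unique ds
    Order⇒Unique []               = []
    Order⇒Unique (place o w∉ _ _) = All.tabulate (λ { y∈ refl → w∉ y∈ }) ∷ Order⇒Unique o

    Order⇒Prefix : ∀ {ds i} → Order ds → i ∈ I → Prefix ds (ch i)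
    Order⇒Prefix []              _  = unplaced (All.tabulate (λ _ ()))
    Order⇒Prefix (place _ _ _ p) i∈ = p i∈

    module _ .{{_ : NonZero b}} (E≡ : (2 * b) ^ S ≡ E)
      (ch-length : ∀ {i} → i ∈ I → length (ch i) ≡ S)
      (ch-unique : ∀ {i} → i ∈ I → Unique (ch i)) where

      -- Every chain through `w` adds `E` to the budget. At most `suc x` chains contain `w`, so the
      -- total is at most `N`, as `bounds-average` demands.
      weight-step : ∀ r ds f w → w ∉ ds → (∀ {i} → i ∈ I → Prefix ds (ch i)) →
        Step N b (weight r ds f) (λ v → weight r (w ∷ ds) (update f w v)) (ok r w)
          (E * length (filterᵇ (λ i → ⌊ w ∈? ch i ⌋) I))
      weight-step r ds f w w∉ = go I id
        where
        E≤N : E ≤ N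
        E≤N = m≤m+n E _
        go : ∀ J → (∀ {i} → i ∈ J → i ∈ I) → (∀ {i} → i ∈ I → Prefix ds (ch i)) →
          Step N b (product (map (λ i → wt N b (ok r) ds f 1 (ch i)) J))
            (λ v → product (map (λ i → wt N b (ok r) (w ∷ ds) (update f w v) 1 (ch i)) J)) (ok r w)
            (E * length (filterᵇ (λ i → ⌊ w ∈? ch i ⌋) J))
        go []      _   p = step-const (λ _ → refl)
        go (i ∷ J) sub p with w ∈? ch i
        ... | yes _    = step-relax (≤-reflexive (sym (*-suc E _))) (step-* (wt-step N b (ok r) E≤N ds f w w∉ 1 (ch i) (ch-unique i∈) (p i∈)
                           (≤-reflexive (trans (*-identityʳ _) (trans (cong ((2 * b) ^_) (ch-length i∈)) E≡)))) (go J (sub ∘ there) p))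
          where
          i∈ : i ∈ I
          i∈ = sub (here refl)
        ... | no w∉ch = step-* (wt-step-∉ N b (ok r) E≤N ds f w w∉ 1 (ch i) {0} w∉ch) (go J (sub ∘ there) p)

      module _ (rich : Rich b D) (bm≤n : b * m ≤ n) (0<n : 0 < n)
        (group : ∀ w → length (filterᵇ (λ i → ⌊ w ∈? ch i ⌋) I) ≤ suc x) (r₀ : R) where

        free : List (Fin m) → (Fin m → Fin n) → Fin m → Fin n → Bool
        free ds f w v = unused (map f ds) v ∧ sat D (edgeConstraints Tr ds f w) v

        options : List (Fin m) → (Fin m → Fin n) → Fin m → List (Fin n)
        options ds f w = filterᵇ (free ds f w) (allFin n)

        -- Richness applies to the tree edges and the requirement together, and the used vertices
        -- cost at most half of what it provides. As there are at most `n` options in all, a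
        -- fraction 1/b of them is good, for every requirement separately.
        options-good : ∀ {ds} f w → Unique ds → ∀ r → length (filterᵇ (adj G w) ds) + length (pc r w) ≤ 2 →
          n ≤ b * length (filterᵇ (ok r w) (options ds f w))
        options-good {ds} f w u r few = +-cancelˡ-≤ n _ _ (begin
          n + n                                      ≡⟨ cong (n +_) (+-identityʳ n) ⟨
          2 * n                                      ≤⟨ rich cs few′ ⟩
          b * length (filterᵇ (sat D cs) (allFin n)) ≤⟨ *-monoʳ-≤ b (length-filterᵇ-unused (sat D cs) (allFin⁺ n) (map f ds)) ⟩
          b * (length (map f ds) + length X)         ≡⟨ *-distribˡ-+ b (length (map f ds)) (length X) ⟩
          b * length (map f ds) + b * length X       ≤⟨ +-mono-≤ used≤n (*-monoʳ-≤ b (length-⊆ (filter⁺ (T? ∘ _) (allFin⁺ n)) X⊆)) ⟩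
          n + b * length (filterᵇ (ok r w) (options ds f w)) ∎)
          where
          open ≤-Reasoning
          ec = edgeConstraints Tr ds f w
          cs = ec ++ pc r w
          X = filterᵇ (λ v → unused (map f ds) v ∧ sat D cs v) (allFin n)
          few′ : length cs ≤ 2
          few′ = ≤-trans (≤-reflexive (trans (length-++ ec) (cong (_+ length (pc r w)) (length-map _ (filterᵇ (adj G w) ds))))) few
          used≤n : b * length (map f ds) ≤ n
          used≤n = ≤-trans (*-monoʳ-≤ b (≤-trans (≤-reflexive (length-map f ds))
            (≤-trans (length-⊆ u (λ _ → ∈-allFin _)) (≤-reflexive (length-tabulate {n = m} id))))) bm≤n
          X⊆ : ∀ {v} → v ∈ X → v ∈ filterᵇ (ok r w) (options ds f w)
          X⊆ {v} v∈ with ∈-filterᵇ⁻ (allFin n) v∈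
          ... | v∈F , h with Equivalence.to (T-∧ {unused (map f ds) v}) h
          ... | un , s with sat-++ D ec s
          ... | s₁ , s₂ = ∈-filterᵇ⁺ (∈-filterᵇ⁺ v∈F (Equivalence.from T-∧ (un , s₁))) s₂

        embeds-place : ∀ {ds f w v} → w ∉ ds → T (free ds f w v) → Embeds Tr D ds f → Embeds Tr D (w ∷ ds) (update f w v)
        embeds-place {ds} {f} {w} {v} w∉ h = embeds-update Tr D w∉ (λ { y∈ refl → unused⇒∉ (proj₁ free⁻) (∈-map⁺ f y∈) })
          (λ y∈ a → sat⇒adjS D (proj₂ free⁻) (∈-map⁺ _ (∈-filterᵇ⁺ y∈ a)))
          where
          free⁻ = Equivalence.to (T-∧ {unused (map f ds) v}) h

        module _ {ds w} (o : Order ds) (w∉ : w ∉ ds) (few : ∀ r → length (filterᵇ (adj G w) ds) + length (pc r w) ≤ 2)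
                 (f : Fin m → Fin n) where

          os : List (Fin n)
          os = options ds f w

          options-nonempty : 0 < length os
          options-nonempty = ≰⇒> λ h → <⇒≱ 0<n (begin
            n                                   ≤⟨ options-good f w (Order⇒Unique o) r₀ (few r₀) ⟩
            b * length (filterᵇ (ok r₀ w) os)   ≤⟨ *-monoʳ-≤ b (≤-trans (length-filter (T? ∘ ok r₀ w) os) h) ⟩
            b * 0                               ≡⟨ *-zeroʳ b ⟩
            0                                   ∎)
            where open ≤-Reasoning

          weight-average : ∀ r → sum (map (λ v → weight r (w ∷ ds) (update f w v)) os) ≤ length os * weight r ds f
          weight-average r = average (weight-step r ds f w w∉ (Order⇒Prefix o))
            where
            average : Step N b (weight r ds f) (λ v → weight r (w ∷ ds) (update f w v)) (ok r w)
                        (E * length (filterᵇ (λ i → ⌊ w ∈? ch i ⌋) I)) →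
                      sum (map (λ v → weight r (w ∷ ds) (update f w v)) os) ≤ length os * weight r ds f
            average (β , s , hz , hy) = sum-average (ok r w) {b = b} os (λ v _ → hz v) (λ v _ → hy v) (Y≤Z β)
              (≤-trans (≤-trans (length-filter (T? ∘ free ds f w) (allFin n)) (≤-reflexive (length-tabulate {n = n} id)))
                       (options-good f w (Order⇒Unique o) r (few r)))
              (bounds-average β (≤-trans s (≤-trans (*-monoʳ-≤ E (group w)) (≤-reflexive (*-comm E (suc x))))))

          potential-average : sum (map (λ v → potential (w ∷ ds) (update f w v)) os) ≤ length os * potential ds f
          potential-average = begin
            sum (map (λ v → potential (w ∷ ds) (update f w v)) os)
              ≡⟨ sum-swap (λ v r → weight r (w ∷ ds) (update f w v)) os rs ⟩
            sum (map (λ r → sum (map (λ v → weight r (w ∷ ds) (update f w v)) os)) rs)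
              ≤⟨ sum-map-≤ rs weight-average ⟩
            sum (map (λ r → length os * weight r ds f) rs)
              ≡⟨ sum-map-* (length os) (λ r → weight r ds f) rs ⟩
            length os * potential ds f ∎
            where open ≤-Reasoning

        -- One choice has to serve all requirements. The options are the same for each of them, so
        -- the averages add up and some option does not raise the total.
        embed : ∀ {ds} → Order ds → (f₀ : Fin m → Fin n) → ∃ λ f → Embeds Tr D ds f × potential ds f ≤ potential [] f₀
        embed [] f₀ = f₀ , record { injective = λ () ; arcs = λ () } , ≤-refl
        embed (place {w} {ds} o w∉ few _) f₀ =
          let f , emb , le  = embed o f₀
              v , v∈ , le′  = exists-≤-average (λ v → potential (w ∷ ds) (update f w v)) (os o w∉ few f)
                                (options-nonempty o w∉ few f) (potential-average o w∉ few f)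
          in update f w v , embeds-place w∉ (proj₂ (∈-filterᵇ⁻ (allFin n) v∈)) emb , ≤-trans le′ le

      potential-[] : ∀ f₀ → potential [] f₀ ≡ length rs * pred N ^ length I
      potential-[] f₀ = trans (cong sum (map-cong (λ r → go r I) rs)) (sum-map-const _ rs)
        where
        go : ∀ r J → product (map (λ i → wt N b (ok r) [] f₀ 1 (ch i)) J) ≡ pred N ^ length J
        go r []      = refl
        go r (i ∷ J) = cong₂ _*_ (wt-unplaced N b (ok r) [] f₀ 1 {ch i} (All.tabulate (λ _ ()))) (go r J)

      weight-placed : ∀ r {ds} f → (∀ w → w ∈ ds) →
        weight r ds f ≡ (x * E) ^ length (filterᵇ (hit r f) I) * N ^ length (filterᵇ (not ∘ hit r f) I)
      weight-placed r {ds} f all = go I id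
        where
        final : ∀ {i} → i ∈ I → wt N b (ok r) ds f 1 (ch i) ≡ (if hit r f i then x * E else N)
        final {i} i∈ = trans (wt-placed N b (ok r) ds f 1 (ch i) all) (cong (λ z → if hit r f i then z else N)
          (trans (cong (N ∸_) (trans (*-identityʳ _) (trans (cong ((2 * b) ^_) (ch-length i∈)) E≡))) (m+n∸m≡n E (x * E))))
        go : ∀ J → (∀ {i} → i ∈ J → i ∈ I) → product (map (λ i → wt N b (ok r) ds f 1 (ch i)) J)
          ≡ (x * E) ^ length (filterᵇ (hit r f) J) * N ^ length (filterᵇ (not ∘ hit r f) J)
        go []      _   = refl
        go (i ∷ J) sub = trans (cong₂ _*_ (final (sub (here refl))) (go J (sub ∘ there))) (product-if (hit r f) (x * E) N i J)

      -- A requirement with too few hits would by itself outweigh the initial potential, which the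
      -- placement has not increased.
      many-hits : ∀ {ds f} f₀ k l j → (∀ w → w ∈ ds) → potential ds f ≤ potential [] f₀ → x ≢ 0 → k + k ≤ suc x →
        N * j ≤ length I → length rs * 2 ^ l < 2 ^ j → ∀ {r} → r ∈ rs → k * l ≤ length (filterᵇ (hit r f) I)
      many-hits {ds} {f} f₀ k l j all le x≢0 2k≤ Nj≤ j> {r} r∈ =
        ≮⇒≥ (λ h< → <⇒≱ j> (hits-bound x k l j E′ (length I) (length (filterᵇ (hit r f) I)) (length (filterᵇ (not ∘ hit r f) I))
              {length rs} 2k≤ Nj≤ (length-partition (hit r f) I) (<⇒≤ h<) bound x≢0))
        where
        open ≤-Reasoning
        bound : (x * E) ^ length (filterᵇ (hit r f) I) * N ^ length (filterᵇ (not ∘ hit r f) I) ≤ length rs * pred N ^ length I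
        bound = begin
          (x * E) ^ length (filterᵇ (hit r f) I) * N ^ length (filterᵇ (not ∘ hit r f) I) ≡⟨ weight-placed r f all ⟨
          weight r ds f                 ≤⟨ ∈⇒≤sum (λ r → weight r ds f) r∈ ⟩
          potential ds f                ≤⟨ le ⟩
          potential [] f₀               ≡⟨ potential-[] f₀ ⟩
          length rs * pred N ^ length I ∎

  -- Absorbing structures in a tree

  nbrs : Digraph m → Fin m → List (Fin m)
  nbrs G v = filterᵇ (adj G v) (allFin _)

  adj-sym : ∀ (G : Digraph m) {u v} → T (adj G u v) → T (adj G v u)
  adj-sym G {u} {v} h with Equivalence.to (T-∨ {arc G u v}) h
  ... | inj₁ a = Equivalence.from (T-∨ {arc G v u}) (inj₂ a)
  ... | inj₂ a = Equivalence.from (T-∨ {arc G v u}) (inj₁ a)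

  adjS-flip : ∀ (Tr : OrientedTree m) (D : Digraph n) {u v x y} → T (adj (digraph Tr) u v) →
    T (adjS D (arc (digraph Tr) u v) x y) → T (adjS D (arc (digraph Tr) v u) y x)
  adjS-flip Tr D {u} {v} a h with arc (digraph Tr) u v in eq | arc (digraph Tr) v u in eq′
  ... | true  | false = h
  ... | false | true  = h
  ... | true  | true  = ⊥-elim (subst T (trans (sym eq) (oriented Tr v u (subst T (sym eq′) tt))) tt)

  -- One neighbour in `I` is enough to state the constraint from `x`, since by `consistent` all
  -- neighbours of `w` in `I` yield the same one. This keeps a parent of many leaves within the
  -- budget.
  anchors : Digraph m → List (Fin m) → Fin m → List (Fin m)
  anchors G I w = take 1 (filterᵇ (adj G w) I)

  -- How much of the budget of two a requirement takes at `w`.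
  slots : Digraph m → ℕ → List (Fin m) → Fin m → ℕ
  slots G κ I w = if ⌊ w ∈? I ⌋ then κ else length (anchors G I w)

  -- The list has the vertex placed last at its head.
  data Schedule {m} (G : Digraph m) (κ : ℕ) (I : List (Fin m)) (ch : Fin m → List (Fin m)) : List (Fin m) → Set where
    []    : Schedule G κ I ch []
    place : ∀ {w ds} → Schedule G κ I ch ds → w ∉ ds → length (filterᵇ (adj G w) ds) + slots G κ I w ≤ 2 →
            (∀ {i} → i ∈ I → Prefix (w ∷ ds) (ch i)) → Schedule G κ I ch (w ∷ ds)

  -- The vertices in I can be moved to arbitrary vertices of B, which frees their images for the vertices in L.
  record Absorber {m} (Tr : OrientedTree m) (κ : ℕ) (t : Fin m) : Set where
    private G = digraph Tr
    field
      I L         : List (Fin m)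
      -- The vertices whose images decide whether `i` can be exchanged, in the order in which they
      -- are placed.
      ch          : Fin m → List (Fin m)
      I-unique    : Unique I
      L-unique    : Unique L
      disjoint    : ∀ {v} → v ∈ I → v ∉ L
      t∉I         : t ∉ I
      t∉L         : t ∉ L
      independent : ∀ {u v} → u ∈ I ⊎ u ∈ L → v ∈ I ⊎ v ∈ L → ¬ T (adj G u v)
      ch-⊆        : ∀ {i y} → i ∈ I → y ∈ ch i → y ≡ i ⊎ T (adj G y i)
      ch-self     : ∀ {i} → i ∈ I → i ∈ ch i
      ch-nbr      : ∀ {i y} → i ∈ I → T (adj G y i) → y ∈ ch i
      ch-length   : ∀ {i} → i ∈ I → length (ch i) ≡ suc κ
      ch-unique   : ∀ {i} → i ∈ I → Unique (ch i)
      L-degree    : ∀ {ℓ} → ℓ ∈ L → length (nbrs G ℓ) ≡ κ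
      consistent  : ∀ {w i j} → i ∈ I → j ∈ I → T (adj G w i) → T (adj G w j) → arc G i w ≡ arc G j w
      order       : List (Fin m)
      order-all   : ∀ w → w ∈ order
      schedule    : Schedule G κ I ch order

  vectors : ∀ {A : Set} → List A → ∀ k → List (Vec.Vec A k)
  vectors xs zero    = Vec.[] ∷ []
  vectors xs (suc k) = cartesianProductWith Vec._∷_ xs (vectors xs k)

  length-cartesianProductWith : ∀ {A B C : Set} (f : A → B → C) xs ys → length (cartesianProductWith f xs ys) ≡ length xs * length ys
  length-cartesianProductWith f []       ys = refl
  length-cartesianProductWith f (x ∷ xs) ys = trans (length-++ (map (f x) ys)) (cong₂ _+_ (length-map (f x) ys) (length-cartesianProductWith f xs ys))

  length-vectors : ∀ {A : Set} (xs : List A) k → length (vectors xs k) ≡ length xs ^ k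
  length-vectors xs zero    = refl
  length-vectors xs (suc k) = trans (length-cartesianProductWith Vec._∷_ xs (vectors xs k)) (cong (length xs *_) (length-vectors xs k))

  ∈-vectors : ∀ {A : Set} {xs : List A} → (∀ x → x ∈ xs) → ∀ {k} (v : Vec.Vec A k) → v ∈ vectors xs k
  ∈-vectors all Vec.[]      = here refl
  ∈-vectors all (x Vec.∷ v) = ∈-cartesianProductWith⁺ Vec._∷_ (all x) (∈-vectors all v)

  uncovered : ∀ {n} (p : Subset n) xs → length xs < ∣ p ∣ → ∃ λ v → v ∈ₛ p × v ∉ xs
  uncovered p xs lt with Finₚ.any? (λ v → (v Subsetₚ.∈? p) ×-dec ¬? (v ∈? xs))
  ... | yes h = h
  ... | no ¬h = ⊥-elim (<⇒≱ lt (size-≤-cover {p = p} {xs} λ {v} v∈ → decidable-stable (v ∈? xs) (λ v∉ → ¬h (v , v∈ , v∉))))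

  exists-∉ : ∀ {n} {xs : List (Fin n)} ys → Unique xs → length ys < length xs → ∃ λ x → x ∈ xs × x ∉ ys
  exists-∉ {xs = xs} ys u lt with Any.any? (λ x → ¬? (x ∈? ys)) xs
  ... | yes h = find h
  ... | no ¬h = ⊥-elim (<⇒≱ lt (length-⊆ u λ {x} x∈ → decidable-stable (x ∈? ys) (λ x∉ → ¬h (lose x∈ x∉))))

  others : List (Fin m) → List (Fin m)
  others L = filterᵇ (unused L) (allFin _)

  ∈-others : ∀ {L : List (Fin m)} {w} → w ∉ L → w ∈ others L
  ∈-others w∉ = ∈-filterᵇ⁺ (∈-allFin _) (∉⇒unused w∉)

  others-∉ : ∀ {L : List (Fin m)} {w} → w ∈ others L → w ∉ L
  others-∉ w∈ = unused⇒∉ (proj₂ (∈-filterᵇ⁻ (allFin _) w∈))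

  length-others : ∀ {L : List (Fin m)} → Unique L → length (others L) + length L ≡ m
  length-others {m} {L} u = ≤-antisym (begin
      length (others L) + length L ≡⟨ length-++ (others L) ⟨
      length (others L ++ L)       ≤⟨ length-⊆ (++⁺ (filter⁺ _ (allFin⁺ m)) u (λ (w∈ , w∈L) → others-∉ w∈ w∈L)) (λ _ → ∈-allFin _) ⟩
      length (allFin m)            ≡⟨ length-tabulate {n = m} id ⟩
      m                            ∎) (begin
      m                            ≡⟨ length-tabulate {n = m} id ⟨
      length (allFin m)            ≤⟨ length-⊆ (allFin⁺ m) (λ {w} _ → split w) ⟩
      length (others L ++ L)       ≡⟨ length-++ (others L) ⟩
      length (others L) + length L ∎)
    where
    open ≤-Reasoning
    split : ∀ w → w ∈ others L ++ L
    split w with w ∈? L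
    ... | yes w∈ = ∈-++⁺ʳ (others L) w∈
    ... | no  w∉ = ∈-++⁺ˡ (∈-others w∉)

  -- In a complete embedding any vertex may be regarded as the one placed last, so this is an
  -- instance of `embeds-update`.
  embeds-change : ∀ (Tr : OrientedTree m) (D : Digraph n) {f : Fin m → Fin n} {w v} →
    (∀ {y} → y ≢ w → f y ≢ v) →
    (∀ {y} → T (adj (digraph Tr) w y) → T (adjS D (arc (digraph Tr) y w) (f y) v)) →
    Embeds Tr D (allFin m) f → Embeds Tr D (allFin m) (update f w v)
  embeds-change Tr D {f} {w} {v} fresh new emb = record
    { injective = λ {y} {z} _ _ → Embeds.injective emb′ (everything y) (everything z)
    ; arcs      = λ {y} {z} _ _ → Embeds.arcs emb′ (everything y) (everything z) }
    where
    ds = others (w ∷ [])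
    emb′ : Embeds Tr D (w ∷ ds) (update f w v)
    emb′ = embeds-update Tr D (λ w∈ → others-∉ w∈ (here refl)) (λ y∈ → fresh (λ { refl → others-∉ y∈ (here refl) })) (λ _ → new)
      (record { injective = λ _ _ → Embeds.injective emb (∈-allFin _) (∈-allFin _)
              ; arcs      = λ _ _ → Embeds.arcs emb (∈-allFin _) (∈-allFin _) })
    everything : ∀ y → y ∈ w ∷ ds
    everything y with y ≟ w
    ... | yes refl = here refl
    ... | no  y≢w  = there (∈-others (λ { (here eq) → y≢w eq }))

  -- Repairing an embedding by exchanges

  module Absorption {m n : ℕ} {κ : ℕ} {t : Fin m} (Tr : OrientedTree m) (D : Digraph n) (𝒜 : Absorber Tr κ t) where
    open Absorber 𝒜

    G : Digraph m
    G = digraph Tr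

    -- A pair (x , C) asks for a vertex i ∈ I that can be moved to x and whose image satisfies C.
    Requirement : Set
    Requirement = Fin n × Vec.Vec (Constraint n) κ

    -- A vertex of `I` gives up its image to a vertex of `L`, so `C` restricts that image. A
    -- neighbour of a vertex of `I` has to be joined to `x` instead, in the direction of the tree
    -- edge.
    required : Requirement → Fin m → List (Constraint n)
    required (x , C) w = if ⌊ w ∈? I ⌋ then Vec.toList C else map (λ i → arc G i w , x) (anchors G I w)

    length-required : ∀ r w → length (required r w) ≡ slots G κ I w
    length-required (x , C) w with w ∈? I
    ... | yes _ = Vecₚ.length-toList C
    ... | no _  = length-map (λ i → arc G i w , x) (anchors G I w)

    hits : Requirement → (Fin m → Fin n) → Fin m → Bool
    hits r f i = allᵇ (λ y → sat D (required r y) (f y)) (ch i)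

    hit-self : ∀ {x C f i} → i ∈ I → T (hits (x , C) f i) → T (sat D (Vec.toList C) (f i))
    hit-self {x} {C} {f} {i} i∈ h with allᵇ⁻ (λ y → sat D (required (x , C) y) (f y)) h (ch-self i∈)
    ... | s with i ∈? I
    ...   | yes _ = s
    ...   | no i∉ = ⊥-elim (i∉ i∈)

    hit-nbr : ∀ {x C f i y} → i ∈ I → T (adj G y i) → T (hits (x , C) f i) → T (adjS D (arc G i y) x (f y))
    hit-nbr {x} {C} {f} {i} {y} i∈ a h with allᵇ⁻ (λ y → sat D (required (x , C) y) (f y)) h (ch-nbr i∈ a)
    ... | s with y ∈? I
    ...   | yes y∈ = ⊥-elim (independent (inj₁ y∈) (inj₁ i∈) a)
    ...   | no _ = anchored (filterᵇ (adj G y) I) (∈-filterᵇ⁺ i∈ a) (∈-filterᵇ⁻ I) s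
      where
      -- The constraint was stated for the first neighbour `j` of `y` in `I`; `consistent` carries
      -- it over to `i`.
      anchored : ∀ js → i ∈ js → (∀ {j} → j ∈ js → j ∈ I × T (adj G y j)) →
        T (sat D (map (λ i → arc G i y , x) (take 1 js)) (f y)) → T (adjS D (arc G i y) x (f y))
      anchored (j ∷ js) _ js⁻ s with js⁻ (here refl)
      ... | j∈ , aj = subst (λ z → T (adjS D z x (f y))) (consistent j∈ i∈ aj a) (proj₁ (Equivalence.to T-∧ s))

    module _ {f₀ : Fin m → Fin n} (f₀-embeds : Embeds Tr D (allFin m) f₀)
      (many : ∀ r → length L ≤ length (filterᵇ (hits r f₀) I))
      (B : Subset n) (∣B∣≥m : m ≤ ∣ B ∣) (f₀∈B : ∀ {w} → w ∉ L → f₀ w ∈ₛ B) where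

      record Partial (todo : List (Fin m)) : Set where
        field
          f        : Fin m → Fin n
          embeds   : Embeds Tr D (allFin m) f
          moved    : List (Fin m)
          moved⊆I  : ∀ {i} → i ∈ moved → i ∈ I
          agrees   : ∀ {w} → w ∉ L → w ∉ moved → f w ≡ f₀ w
          inside-B : ∀ {w} → w ∉ todo → f w ∈ₛ B
          few      : length moved + length todo ≤ length L

      step-absorb : ∀ {ℓ todo} → ℓ ∈ L → Partial (ℓ ∷ todo) → Partial todo
      step-absorb {ℓ} {todo} ℓ∈ p with Partial.f p ℓ Subsetₚ.∈? B
      ... | yes fℓ∈B = record
        { f = f ; embeds = embeds ; moved = moved ; moved⊆I = moved⊆I ; agrees = agrees
        ; inside-B = λ {w} w∉ → [ (λ { refl → fℓ∈B }) , (λ w≢ℓ → inside-B (λ { (here eq) → w≢ℓ eq ; (there w∈) → w∉ w∈ })) ]′ (dec w)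
        ; few = ≤-trans (+-monoʳ-≤ (length moved) (n≤1+n _)) few }
        where
        open Partial p
        dec : ∀ w → w ≡ ℓ ⊎ w ≢ ℓ
        dec w with w ≟ ℓ
        ... | yes h = inj₁ h
        ... | no h  = inj₂ h
      -- At most `m - 1` vertices of `B` are images, because the image of `ℓ` lies outside, so `B`
      -- contains a free vertex.
      ... | no fℓ∉B = exchange (uncovered B (map f (others (ℓ ∷ []))) fewer) unmoved
        where
        open Partial p
        fewer : length (map f (others (ℓ ∷ []))) < ∣ B ∣
        fewer = begin-strict
          length (map f (others (ℓ ∷ []))) ≡⟨ length-map f (others (ℓ ∷ [])) ⟩
          length (others (ℓ ∷ []))         <⟨ n<1+n _ ⟩
          suc (length (others (ℓ ∷ [])))   ≡⟨ +-comm 1 _ ⟩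
          length (others (ℓ ∷ [])) + 1     ≡⟨ length-others ([] ∷ []) ⟩
          m                                ≤⟨ ∣B∣≥m ⟩
          ∣ B ∣                            ∎
          where open ≤-Reasoning
        C : Vec.Vec (Constraint n) (length (edgeConstraints Tr (allFin m) f₀ ℓ))
        C = Vec.fromList (edgeConstraints Tr (allFin m) f₀ ℓ)
        length-C : length (edgeConstraints Tr (allFin m) f₀ ℓ) ≡ κ
        length-C = trans (length-map _ (nbrs G ℓ)) (L-degree ℓ∈)
        toList-C : ∀ {k} (eq : length (edgeConstraints Tr (allFin m) f₀ ℓ) ≡ k) → Vec.toList (subst (Vec.Vec (Constraint n)) eq C) ≡ edgeConstraints Tr (allFin m) f₀ ℓ
        toList-C refl = Vecₚ.toList∘fromList _
        -- The neighbourhoods that any new image of `ℓ` must lie in; the number of neighbours equals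
        -- `κ` only propositionally, hence the transport.
        C′ : Vec.Vec (Constraint n) κ
        C′ = subst (Vec.Vec (Constraint n)) length-C C
        unmoved : ∀ x → ∃ λ i → i ∈ filterᵇ (hits (x , C′) f₀) I × i ∉ moved
        unmoved x = exists-∉ moved (filter⁺ _ I-unique) (begin-strict
          length moved                              <⟨ m<m+n (length moved) (s≤s z≤n) ⟩
          length moved + suc (length todo)          ≤⟨ few ⟩
          length L                                  ≤⟨ many (x , C′) ⟩
          length (filterᵇ (hits (x , C′) f₀) I)     ∎)
          where open ≤-Reasoning
        exchange : (∃ λ x → x ∈ₛ B × x ∉ map f (others (ℓ ∷ []))) →
          (∀ x → ∃ λ i → i ∈ filterᵇ (hits (x , C′) f₀) I × i ∉ moved) → Partial todo
        exchange (x , x∈B , x∉) pick with pick x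
        ... | i , i∈′ , i∉moved with ∈-filterᵇ⁻ I i∈′
        ...   | i∈ , hit = record
          { f        = f₂
          ; embeds   = emb₂
          ; moved    = i ∷ moved
          ; moved⊆I  = λ { (here refl) → i∈ ; (there j∈) → moved⊆I j∈ }
          ; agrees   = λ {w} w∉L w∉ → trans (trans (f₂-≢ (λ { refl → w∉L ℓ∈ })) (f₁-≢ (w∉ ∘ here))) (agrees w∉L (w∉ ∘ there))
          ; inside-B = λ {w} w∉todo → in-B w w∉todo
          ; few      = ≤-trans (≤-reflexive (sym (+-suc (length moved) (length todo)))) few }
          where
          f₁ f₂ : Fin m → Fin n
          f₁ = update f i x
          f₂ = update f₁ ℓ (f i)
          f₁-≢ : ∀ {w} → w ≢ i → f₁ w ≡ f w
          f₁-≢ = update-≢ f x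
          f₂-≢ : ∀ {w} → w ≢ ℓ → f₂ w ≡ f₁ w
          f₂-≢ = update-≢ f₁ (f i)
          fi≡ : f i ≡ f₀ i
          fi≡ = agrees (disjoint i∈) i∉moved
          x∉image : ∀ y → f y ≢ x
          x∉image y eq with y ≟ ℓ
          ... | yes refl = fℓ∉B (subst (_∈ₛ B) (sym eq) x∈B)
          ... | no  y≢ℓ  = x∉ (subst (_∈ map f (others (ℓ ∷ []))) eq (∈-map⁺ f (∈-others (λ { (here h) → y≢ℓ h }))))
          nbr-fixed : ∀ {w y} → w ∈ I ⊎ w ∈ L → T (adj G w y) → f y ≡ f₀ y × y ≢ i
          nbr-fixed w∈ a = agrees (λ y∈L → independent w∈ (inj₂ y∈L) a) (λ y∈ → independent w∈ (inj₁ (moved⊆I y∈)) a) ,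
                           (λ { refl → independent w∈ (inj₁ i∈) a })
          emb₁ : Embeds Tr D (allFin m) f₁
          emb₁ = embeds-change Tr D (λ {y} _ → x∉image y)
            (λ {y} a → adjS-flip Tr D a (subst (λ z → T (adjS D (arc G i y) x z)) (sym (proj₁ (nbr-fixed (inj₁ i∈) a)))
                        (hit-nbr i∈ (adj-sym G a) hit))) embeds
          fi∉ : ∀ {y} → y ≢ ℓ → f₁ y ≢ f i
          fi∉ {y} _ eq with y ≟ i
          ... | yes refl = x∉image i (sym eq)
          ... | no  y≢i  = y≢i (Embeds.injective embeds (∈-allFin y) (∈-allFin i) eq)
          emb₂ : Embeds Tr D (allFin m) f₂
          emb₂ = embeds-change Tr D fi∉ new emb₁
            where
            new : ∀ {y} → T (adj G ℓ y) → T (adjS D (arc G y ℓ) (f₁ y) (f i))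
            new {y} a rewrite f₁-≢ (proj₂ (nbr-fixed (inj₂ ℓ∈) a)) | proj₁ (nbr-fixed (inj₂ ℓ∈) a) | fi≡ =
              sat⇒adjS D (subst (λ cs → T (sat D cs (f₀ i))) (toList-C length-C) (hit-self i∈ hit)) (∈-map⁺ _ (∈-filterᵇ⁺ (∈-allFin y) a))
          in-B : ∀ w → w ∉ todo → f₂ w ∈ₛ B
          in-B w w∉ with w ≟ ℓ
          ... | yes refl = subst (_∈ₛ B) (sym fi≡) (f₀∈B (disjoint i∈))
          ... | no w≢ℓ with w ≟ i
          ...   | yes refl = x∈B
          ...   | no  w≢i  = inside-B (λ { (here eq) → w≢ℓ eq ; (there w∈) → w∉ w∈ })

      absorb-all : ∀ todo → (∀ {ℓ} → ℓ ∈ todo → ℓ ∈ L) → Partial todo → Partial []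
      absorb-all []         _   p = p
      absorb-all (ℓ ∷ todo) sub p = absorb-all todo (sub ∘ there) (step-absorb (sub (here refl)) p)

      copy-in : CopyIn Tr D B t (f₀ t)
      copy-in = f , (λ _ _ → Embeds.injective embeds (∈-allFin _) (∈-allFin _)) , (λ _ _ → Embeds.arcs embeds (∈-allFin _) (∈-allFin _)) ,
        (λ _ → inside-B (λ ())) , agrees t∉L (t∉I ∘ moved⊆I)
        where
        start : Partial L
        start = record { f = f₀ ; embeds = f₀-embeds ; moved = [] ; moved⊆I = λ () ; agrees = λ _ _ → refl
                       ; inside-B = f₀∈B ; few = ≤-refl }
        open Partial (absorb-all L id start)

  -- From an absorber to the set A

  module Robust {m n κ : ℕ} {t : Fin m} (Tr : OrientedTree m) (D : Digraph n) (𝒜 : Absorber Tr κ t)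
    (b δ : ℕ) .{{_ : NonZero b}} where
    open Absorber 𝒜
    open Absorption Tr D 𝒜

    -- `suc x` is twice the degree bound `suc δ`. It is at least `suc δ + 1`, the most chains
    -- through one vertex, and `suc δ` hits lower a weight at most by half. `suc E′` is the deficit
    -- after `suc κ` good choices, starting from 1.
    x E′ : ℕ
    x  = δ + suc δ
    E′ = pred ((2 * b) ^ suc κ)

    signs : List Bool
    signs = true ∷ false ∷ []

    -- All lists of `κ` constraints are included, because the neighbourhoods that will matter depend
    -- on an embedding not yet chosen when the weights are set up.
    requirements : List Requirement
    requirements = cartesianProduct (allFin n) (vectors (cartesianProduct signs (allFin n)) κ)

    length-requirements : length requirements ≡ n * (2 * n) ^ κ
    length-requirements = trans (length-cartesianProductWith _,_ (allFin n) _)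
      (cong₂ _*_ (length-tabulate {n = n} id) (trans (length-vectors _ κ)
        (cong (_^ κ) (trans (length-cartesianProductWith _,_ signs (allFin n)) (cong (2 *_) (length-tabulate {n = n} id))))))

    ∈-requirements : ∀ r → r ∈ requirements
    ∈-requirements (x , C) = ∈-cartesianProduct⁺ (∈-allFin x) (∈-vectors (λ { (s , y) → ∈-cartesianProduct⁺ (∈-signs s) (∈-allFin y) }) C)
      where
      ∈-signs : ∀ s → s ∈ signs
      ∈-signs true  = here refl
      ∈-signs false = there (here refl)

    open Placement {R = Requirement} Tr D b (suc κ) x E′ I ch required requirements using (Order; []; place; N; embed; many-hits)

    Schedule⇒Order : ∀ {ds} → Schedule G κ I ch ds → Order ds
    Schedule⇒Order []                  = []
    Schedule⇒Order (place {w} {ds} s w∉ few pr) = place (Schedule⇒Order s) w∉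
      (λ r → ≤-trans (≤-reflexive (cong (length (filterᵇ (adj G w) ds) +_) (length-required r w))) few) pr

    group-size : (∀ w → length (nbrs G w) ≤ suc δ) → ∀ w → length (filterᵇ (λ i → ⌊ w ∈? ch i ⌋) I) ≤ suc x
    group-size deg≤ w = begin
      length (filterᵇ (λ i → ⌊ w ∈? ch i ⌋) I) ≤⟨ length-⊆ (filter⁺ _ I-unique) sub ⟩
      suc (length (nbrs G w))                  ≤⟨ s≤s (≤-trans (deg≤ w) (m≤n+m (suc δ) δ)) ⟩
      suc x                                    ∎
      where
      open ≤-Reasoning
      sub : ∀ {i} → i ∈ filterᵇ (λ i → ⌊ w ∈? ch i ⌋) I → i ∈ w ∷ nbrs G w
      sub {i} i∈′ with ∈-filterᵇ⁻ I i∈′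
      ... | i∈ , h with ch-⊆ i∈ (toWitness h)
      ...   | inj₁ refl = here refl
      ...   | inj₂ a    = there (∈-filterᵇ⁺ (∈-allFin i) a)

    E≡ : (2 * b) ^ suc κ ≡ suc E′
    E≡ = sym (suc-pred _ ⦃ m^n≢0 (2 * b) (suc κ) ⦃ m*n≢0 2 b ⦄ ⦄)

    -- `l` makes `suc δ * l` hits enough for all of `L`, and `j` measures how small the initial
    -- potential is; their difference has to beat the logarithm of the number of requirements.
    robust-copy : ∀ l j → Rich b D → b * m ≤ n → 0 < n → (∀ w → length (nbrs G w) ≤ suc δ) →
      (suc δ + suc δ) * (2 * b) ^ suc κ * j ≤ length I → n * (2 * n) ^ κ * 2 ^ l < 2 ^ j → length L ≤ suc δ * l →
      Σ (Subset n) λ A → Σ (Fin n) λ v → ∣ A ∣ + length L ≡ m × v ∈ₛ A ×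
        (∀ B → A ⊆ₛ B → m ≤ ∣ B ∣ → CopyIn Tr D B t v)
    robust-copy l j rich bm≤n 0<n deg≤ Nj≤I j> L≤ = from-embedding
      (embed E≡ ch-length ch-unique rich bm≤n 0<n (group-size deg≤) (v₀ , Vec.replicate κ (true , v₀)) (Schedule⇒Order schedule) (λ _ → v₀))
      where
      v₀ : Fin n
      v₀ = Fin.fromℕ< 0<n
      from-embedding : _ → _
      from-embedding (f , emb , le) = fromList (map f (others L)) , f t , size ,
        ∈-fromList⁺ (∈-map⁺ f (∈-others t∉L)) ,
        (λ B A⊆B m≤B → copy-in emb′ many B m≤B (λ w∉ → A⊆B (∈-fromList⁺ (∈-map⁺ f (∈-others w∉)))))
        where
        emb′ : Embeds Tr D (allFin m) f
        emb′ = record { injective = λ _ _ → Embeds.injective emb (order-all _) (order-all _)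
                      ; arcs      = λ _ _ → Embeds.arcs emb (order-all _) (order-all _) }
        size : ∣ fromList (map f (others L)) ∣ + length L ≡ m
        size = trans (cong (_+ length L) (trans (fromList-size (map⁺ (λ {y} {z} → Embeds.injective emb′ (∈-allFin y) (∈-allFin z))
                 (filter⁺ _ (allFin⁺ m)))) (length-map f (others L)))) (length-others L-unique)
        many : ∀ r → length L ≤ length (filterᵇ (hits r f) I)
        many r = ≤-trans L≤ (many-hits E≡ ch-length ch-unique (λ _ → v₀) (suc δ) l j order-all le (m+1+n≢0 δ) ≤-refl
          (≤-trans (≤-reflexive (cong (λ z → (suc δ + suc δ) * z * j) (sym E≡))) Nj≤I)
          (≤-trans (≤-reflexive (cong (λ z → suc (z * 2 ^ l)) length-requirements)) j>) (∈-requirements r))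

  -- Rooted orders, degrees and distances in trees

  length-concatMap : ∀ {A B : Set} (f : A → List B) (c : A → ℕ) xs → (∀ {x} → x ∈ xs → length (f x) ≤ c x) →
    length (concatMap f xs) ≤ sum (map c xs)
  length-concatMap f c []       h = z≤n
  length-concatMap f c (x ∷ xs) h = ≤-trans (≤-reflexive (length-++ (f x)))
    (+-mono-≤ (h (here refl)) (length-concatMap f c xs (h ∘ there)))

  length-concatMap-const : ∀ {A B : Set} (f : A → List B) c xs → (∀ {x} → x ∈ xs → length (f x) ≤ c) →
    length (concatMap f xs) ≤ length xs * c
  length-concatMap-const f c xs h = ≤-trans (length-concatMap f (λ _ → c) xs h) (≤-reflexive (sum-map-const c xs))

  AllPairs-trichotomy : ∀ {A : Set} {R : A → A → Set} {xs x y} → AllPairs R xs → x ∈ xs → y ∈ xs → x ≡ y ⊎ R x y ⊎ R y x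
  AllPairs-trichotomy (rs ∷ _) (here refl) (here refl) = inj₁ refl
  AllPairs-trichotomy (rs ∷ _) (here refl) (there y∈)  = inj₂ (inj₁ (All.lookup rs y∈))
  AllPairs-trichotomy (rs ∷ _) (there x∈)  (here refl) = inj₂ (inj₂ (All.lookup rs x∈))
  AllPairs-trichotomy (_ ∷ p)  (there x∈)  (there y∈)  = AllPairs-trichotomy p x∈ y∈

  -- A maximal subfamily of pairwise far elements.
  select : ∀ {m} (near : Fin m → List (Fin m)) → (∀ x → x ∈ near x) → ∀ xs → ∃ λ ys →
    (∀ {y} → y ∈ ys → y ∈ xs) × AllPairs (λ x y → x ∉ near y) ys × (∀ {x} → x ∈ xs → x ∈ concatMap near ys)
  select near self []       = [] , (λ ()) , [] , (λ ())
  select near self (x ∷ xs) with select near self xs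
  ... | ys , sub , far , cover with x ∈? concatMap near ys
  ...   | yes x∈ = ys , there ∘ sub , far , λ { (here refl) → x∈ ; (there y∈) → cover y∈ }
  ...   | no  x∉ = x ∷ ys , (λ { (here refl) → here refl ; (there y∈) → there (sub y∈) }) ,
    All.tabulate (λ y∈ x∈near → x∉ (∈-concatMap⁺ near (lose y∈ x∈near))) ∷ far ,
    λ { (here refl) → ∈-++⁺ˡ (self x) ; (there y∈) → ∈-++⁺ʳ (near x) (cover y∈) }

  module Tree {m : ℕ} (Tr : OrientedTree m) where
    G : Digraph m
    G = digraph Tr

    -- The list has the vertex added last at its head.
    data Grown (t : Fin m) : List (Fin m) → Set where
      root : Grown t (t ∷ [])
      grow : ∀ {w ds} → Grown t ds → w ∉ ds → length (filterᵇ (adj G w) ds) ≡ 1 → Grown t (w ∷ ds)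

    adj-irrefl : ∀ {u} → ¬ T (adj G u u)
    adj-irrefl {u} a = subst T (cong₂ Data.Bool._∨_ (noLoops G u) (noLoops G u)) a

    record SimplePath (ds : List (Fin m)) (a b : Fin m) : Set where
      field
        steps  : List (Fin m)
        path   : Path G (a ∷ steps)
        end    : last a steps ≡ b
        unique : Unique (a ∷ steps)
        within : ∀ {v} → v ∈ a ∷ steps → v ∈ ds

    Path-∷ʳ : ∀ {a} vs {w} → Path G (a ∷ vs) → T (adj G (last a vs) w) → Path G (a ∷ vs ++ w ∷ [])
    Path-∷ʳ []       p          e = cons e single
    Path-∷ʳ (v ∷ vs) (cons a p) e = cons a (Path-∷ʳ vs p e)

    last-∷ʳ : ∀ (a : Fin m) vs {w} → last a (vs ++ w ∷ []) ≡ w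
    last-∷ʳ a []       = refl
    last-∷ʳ a (v ∷ vs) = last-∷ʳ v vs

    path-∷ : ∀ {ds w c b} → w ∉ ds → T (adj G w c) → SimplePath ds c b → SimplePath (w ∷ ds) w b
    path-∷ {ds} {w} {c} w∉ a p = record
      { steps = c ∷ steps ; path = cons a path ; end = end
      ; unique = All.tabulate (λ { v∈ refl → w∉ (within v∈) }) ∷ unique
      ; within = λ { (here refl) → here refl ; (there v∈) → there (within v∈) } }
      where open SimplePath p

    path-∷ʳ : ∀ {ds w a c} → w ∉ ds → T (adj G w c) → SimplePath ds a c → SimplePath (w ∷ ds) a w
    path-∷ʳ {ds} {w} {a} w∉ e p = record
      { steps = steps ++ w ∷ [] ; path = Path-∷ʳ steps path (subst (λ z → T (adj G z w)) (sym end) (adj-sym G e))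
      ; end = last-∷ʳ a steps
      ; unique = ++⁺ unique ([] ∷ []) (λ { (v∈ , here refl) → w∉ (within v∈) })
      ; within = λ {v} v∈ → in′ (∈-++⁻ (a ∷ steps) v∈) }
      where
      open SimplePath p
      in′ : ∀ {v} → v ∈ a ∷ steps ⊎ v ∈ w ∷ [] → v ∈ w ∷ ds
      in′ (inj₁ v∈)          = there (within v∈)
      in′ (inj₂ (here refl)) = here refl

    path-weaken : ∀ {ds w a b} → SimplePath ds a b → SimplePath (w ∷ ds) a b
    path-weaken p = record { steps = steps ; path = path ; end = end ; unique = unique ; within = there ∘ within }
      where open SimplePath p

    path-here : ∀ {ds a} → a ∈ ds → SimplePath ds a a
    path-here a∈ = record { steps = [] ; path = single ; end = refl ; unique = [] ∷ [] ; within = λ { (here refl) → a∈ } }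

    earlier-nbr : ∀ {w ds} → length (filterᵇ (adj G w) ds) ≡ 1 → ∃ λ c → c ∈ ds × T (adj G w c)
    earlier-nbr {w} {ds} eq = go (filterᵇ (adj G w) ds) eq (∈-filterᵇ⁻ ds)
      where
      go : ∀ xs → length xs ≡ 1 → (∀ {c} → c ∈ xs → c ∈ ds × T (adj G w c)) → ∃ λ c → c ∈ ds × T (adj G w c)
      go (c ∷ []) _ h = c , h (here refl)

    paths : ∀ {t ds a b} → Grown t ds → a ∈ ds → b ∈ ds → SimplePath ds a b
    paths root (here refl) (here refl) = path-here (here refl)
    paths (grow g w∉ one) (here refl) (here refl) = path-here (here refl)
    paths (grow g w∉ one) (there a∈)  (there b∈)  = path-weaken (paths g a∈ b∈)
    paths (grow {w} {ds} g w∉ one) (here refl) (there b∈) = let c , c∈ , e = earlier-nbr {w} {ds} one in path-∷ w∉ e (paths g c∈ b∈)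
    paths (grow {w} {ds} g w∉ one) (there a∈) (here refl) = let c , c∈ , e = earlier-nbr {w} {ds} one in path-∷ʳ w∉ e (paths g a∈ c∈)

    -- The path from `a` to `b` among the earlier vertices would close a cycle through `w`.
    unique-nbr : ∀ {t ds w a b} → Grown t ds → w ∉ ds → a ∈ ds → b ∈ ds → T (adj G w a) → T (adj G w b) → a ≡ b
    unique-nbr {ds = ds} {w} {a} {b} g w∉ a∈ b∈ ea eb = close (paths g a∈ b∈)
      where
      close : SimplePath ds a b → a ≡ b
      close record { steps = [] ; end = end } = end
      close p@record { steps = v ∷ vs ; path = path ; end = end } = ⊥-elim (acyclic Tr (w ∷ a ∷ v ∷ vs)
        (s≤s (s≤s (s≤s z≤n)) , SimplePath.unique (path-∷ w∉ ea p) , cons ea path , subst (λ z → T (adj G z w)) (sym end) (adj-sym G eb)))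

    Grown⇒Unique : ∀ {t ds} → Grown t ds → Unique ds
    Grown⇒Unique root          = [] ∷ []
    Grown⇒Unique (grow g w∉ _) = All.tabulate (λ { y∈ refl → w∉ y∈ }) ∷ Grown⇒Unique g

    root-∈ : ∀ {t ds} → Grown t ds → t ∈ ds
    root-∈ root         = here refl
    root-∈ (grow g _ _) = there (root-∈ g)

    crossing : ∀ {ds u w} → Reach G u w → u ∈ ds → w ∉ ds → ∃ λ a → ∃ λ v → a ∈ ds × v ∉ ds × T (adj G a v)
    crossing here u∈ w∉ = ⊥-elim (w∉ u∈)
    crossing {ds} {u} (step {v = v} e r) u∈ w∉ with v ∈? ds
    ... | yes v∈ = crossing r v∈ w∉
    ... | no  v∉ = u , v , u∈ , v∉ , e

    length-one : ∀ {xs : List (Fin m)} {a} → Unique xs → a ∈ xs → (∀ {b} → b ∈ xs → b ≡ a) → length xs ≡ 1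
    length-one {a = a} u a∈ all = ≤-antisym (length-⊆ {ys = a ∷ []} u (λ b∈ → here (all b∈))) (∈-length a∈)

    -- `k` is fuel, bounding the number of missing vertices. By connectedness some edge leaves the
    -- current set, and by acyclicity its outer end has no second neighbour inside.
    grow-all : ∀ {t} k {ds} → Grown t ds → m ≤ k + length ds → ∃ λ ds → Grown t ds × (∀ w → w ∈ ds)
    grow-all {t} k {ds} g le with Finₚ.any? (λ w → ¬? (w ∈? ds))
    ... | no all = ds , g , λ w → decidable-stable (w ∈? ds) (λ w∉ → all (w , w∉))
    ... | yes (w , w∉) with k
    ...   | zero = ⊥-elim (1+n≰n (begin
      suc (length ds)   ≤⟨ length-⊆ {xs = w ∷ ds} (All.tabulate (λ { y∈ refl → w∉ y∈ }) ∷ Grown⇒Unique g) (λ _ → ∈-allFin _) ⟩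
      length (allFin m) ≡⟨ length-tabulate {n = m} id ⟩
      m                 ≤⟨ le ⟩
      length ds         ∎))
      where open ≤-Reasoning
    ...   | suc k′ with crossing (connected Tr t w) (root-∈ g) w∉
    ...     | a , v , a∈ , v∉ , e = grow-all k′ (grow g v∉
        (length-one (filter⁺ _ (Grown⇒Unique g)) (∈-filterᵇ⁺ a∈ (adj-sym G e))
          (λ b∈ → let b∈ds , eb = ∈-filterᵇ⁻ ds b∈ in unique-nbr g v∉ b∈ds a∈ eb (adj-sym G e))))
        (≤-trans le (≤-reflexive (sym (+-suc k′ (length ds)))))

    rooted-order : ∀ t → ∃ λ ds → Grown t ds × (∀ w → w ∈ ds)
    rooted-order t = grow-all m root (m≤m+n m 1)

    parent-placed : ∀ {t ds w} → Grown t ds → w ∈ ds → w ≢ t → ∃ λ y → y ∈ ds × T (adj G w y)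
    parent-placed root (here refl) w≢t = ⊥-elim (w≢t refl)
    parent-placed (grow {w} {ds} g w∉ one) (here refl) _ = let y , y∈ , e = earlier-nbr {w} {ds} one in y , there y∈ , e
    parent-placed (grow g _ _) (there w∈) w≢t = let y , y∈ , e = parent-placed g w∈ w≢t in y , there y∈ , e

    d : Fin m → ℕ
    d v = length (nbrs G v)

    private
      bit : Bool → ℕ
      bit b = if b then 1 else 0

      length-filterᵇ-∷ : ∀ (p : Fin m → Bool) w ds → length (filterᵇ p (w ∷ ds)) ≡ bit (p w) + length (filterᵇ p ds)
      length-filterᵇ-∷ p w ds with p w
      ... | true  = refl
      ... | false = refl

      length-filterᵇ-sum : ∀ (p : Fin m → Bool) ds → length (filterᵇ p ds) ≡ sum (map (bit ∘ p) ds)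
      length-filterᵇ-sum p []       = refl
      length-filterᵇ-sum p (w ∷ ds) = trans (length-filterᵇ-∷ p w ds) (cong (bit (p w) +_) (length-filterᵇ-sum p ds))

      ∨-comm′ : ∀ u v → adj G u v ≡ adj G v u
      ∨-comm′ u v = ∨-comm (arc G u v) (arc G v u)

    -- Each new vertex brings exactly one edge, which raises the degree sum by 2.
    degree-sum : ∀ {t ds} → Grown t ds → sum (map (λ v → length (filterᵇ (adj G v) ds)) ds) + 2 ≡ 2 * length ds
    degree-sum {t} root = cong (λ b → length b + 0 + 2) (none (adj G t t) refl)
      where
      none : ∀ b → adj G t t ≡ b → filterᵇ (adj G t) (t ∷ []) ≡ []
      none _ _ with adj G t t in eq
      ... | true  = ⊥-elim (adj-irrefl {t} (subst T (sym eq) tt))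
      ... | false = refl
    degree-sum (grow {w} {ds} g w∉ one) = begin
      length (filterᵇ (adj G w) (w ∷ ds)) + sum (map (λ v → length (filterᵇ (adj G v) (w ∷ ds))) ds) + 2
        ≡⟨ cong₂ (λ x y → x + y + 2) (trans (length-filterᵇ-∷ (adj G w) w ds) (cong₂ _+_ loop one))
                 (cong sum (map-cong (λ v → length-filterᵇ-∷ (adj G v) w ds) ds)) ⟩
      1 + sum (map (λ v → bit (adj G v w) + length (filterᵇ (adj G v) ds)) ds) + 2
        ≡⟨ cong (λ z → 1 + z + 2) (sum-map-+ (λ v → bit (adj G v w)) _ ds) ⟩
      1 + (sum (map (λ v → bit (adj G v w)) ds) + S) + 2
        ≡⟨ cong (λ z → 1 + (z + S) + 2) (trans (cong sum (map-cong (λ v → cong bit (∨-comm′ v w)) ds))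
              (trans (sym (length-filterᵇ-sum (adj G w) ds)) one)) ⟩
      1 + (1 + S) + 2          ≡⟨⟩
      2 + (S + 2)              ≡⟨ cong (2 +_) (degree-sum g) ⟩
      2 + 2 * length ds        ≡⟨ *-suc 2 (length ds) ⟨
      2 * length (w ∷ ds)      ∎
      where
      open ≡-Reasoning
      S = sum (map (λ v → length (filterᵇ (adj G v) ds)) ds)
      loop : bit (adj G w w) ≡ 0
      loop with adj G w w in eq
      ... | true  = ⊥-elim (adj-irrefl {w} (subst T (sym eq) tt))
      ... | false = refl

    module _ {t ds} (g : Grown t ds) (all : ∀ w → w ∈ ds) where

      length-order : length ds ≡ m
      length-order = ≤-antisym
        (≤-trans (length-⊆ (Grown⇒Unique g) (λ _ → ∈-allFin _)) (≤-reflexive (length-tabulate {n = m} id)))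
        (≤-trans (≤-reflexive (sym (length-tabulate {n = m} id))) (length-⊆ (allFin⁺ m) (λ _ → all _)))

      d-order : ∀ v → length (filterᵇ (adj G v) ds) ≡ d v
      d-order v = ≤-antisym (length-⊆ (filter⁺ _ (Grown⇒Unique g)) (λ {y} → to y)) (length-⊆ (filter⁺ _ (allFin⁺ m)) (λ {y} → from y))
        where
        to : ∀ y → y ∈ filterᵇ (adj G v) ds → y ∈ nbrs G v
        to y y∈ = ∈-filterᵇ⁺ (∈-allFin y) (proj₂ (∈-filterᵇ⁻ ds y∈))
        from : ∀ y → y ∈ nbrs G v → y ∈ filterᵇ (adj G v) ds
        from y y∈ = ∈-filterᵇ⁺ (all y) (proj₂ (∈-filterᵇ⁻ (allFin m) y∈))

      handshake : sum (map d ds) + 2 ≡ 2 * m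
      handshake = trans (cong (λ z → sum z + 2) (map-cong (λ v → sym (d-order v)) ds))
        (trans (degree-sum g) (cong (2 *_) length-order))

      d-positive : 2 ≤ m → ∀ v → 1 ≤ d v
      d-positive 2≤m v with exists-∉ (v ∷ []) (allFin⁺ m) (≤-trans 2≤m (≤-reflexive (sym (length-tabulate {n = m} id))))
      ... | w , _ , w∉ with connected Tr v w
      ...   | here = ⊥-elim (w∉ (here refl))
      ...   | step {v = y} e _ = ∈-length (∈-filterᵇ⁺ (∈-allFin y) e)

      leaves branching : List (Fin m)
      leaves    = filterᵇ (λ v → d v ≡ᵇ 1) ds
      branching = filterᵇ (λ v → 3 ≤ᵇ d v) ds

      -- The handshake identity makes the sum of d - 2 negative. A leaf contributes -1, and a degree
      -- k ≥ 3 is at most 3(k - 2). Adding 6 per vertex avoids subtraction.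
      branching-degrees : 2 ≤ m → sum (map d branching) ≤ 3 * length leaves
      branching-degrees 2≤m = +-cancelʳ-≤ (6 * length ds) _ _ (begin
        sum (map d branching) + 6 * length ds          ≤⟨ go ds ⟩
        3 * sum (map d ds) + 3 * length leaves         ≤⟨ +-monoˡ-≤ (3 * length leaves) (*-monoʳ-≤ 3 (m≤m+n (sum (map d ds)) 2)) ⟩
        3 * (sum (map d ds) + 2) + 3 * length leaves   ≡⟨ cong (λ z → 3 * z + 3 * length leaves) (trans handshake (cong (2 *_) (sym length-order))) ⟩
        3 * (2 * length ds) + 3 * length leaves        ≡⟨ lem (length ds) (length leaves) ⟩
        3 * length leaves + 6 * length ds              ∎)
        where
        open ≤-Reasoning
        lem : ∀ x y → 3 * (2 * x) + 3 * y ≡ 3 * y + 6 * x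
        lem = solve-∀
        lem₁ : ∀ D S L b l → b + L + (6 + S) ≡ (b + 6) + (L + S)
        lem₁ = solve-∀
        br : ℕ → ℕ
        br k = if 3 ≤ᵇ k then k else 0
        lf : ℕ → ℕ
        lf k = bit (k ≡ᵇ 1)
        each : ∀ k → 1 ≤ k → br k + 6 ≤ 3 * k + 3 * lf k
        each 1 _ = ≤-refl
        each 2 _ = ≤-refl
        each (suc (suc (suc k))) _ = ≤-trans (m≤m+n _ (2 * k)) (≤-reflexive (lem₂ k))
          where
          lem₂ : ∀ k → 3 + k + 6 + 2 * k ≡ 3 * (3 + k) + 3 * 0
          lem₂ = solve-∀
        sum-br : ∀ v xs → sum (map d (filterᵇ (λ v → 3 ≤ᵇ d v) (v ∷ xs))) ≡ br (d v) + sum (map d (filterᵇ (λ v → 3 ≤ᵇ d v) xs))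
        sum-br v xs with 3 ≤ᵇ d v
        ... | true  = refl
        ... | false = refl
        go : ∀ xs → sum (map d (filterᵇ (λ v → 3 ≤ᵇ d v) xs)) + 6 * length xs ≤ 3 * sum (map d xs) + 3 * length (filterᵇ (λ v → d v ≡ᵇ 1) xs)
        go []       = z≤n
        go (v ∷ xs) = begin
          sum (map d (filterᵇ (λ v → 3 ≤ᵇ d v) (v ∷ xs))) + 6 * suc (length xs)
            ≡⟨ cong₂ _+_ (sum-br v xs) (*-suc 6 (length xs)) ⟩
          br (d v) + B + (6 + 6 * length xs)      ≡⟨ lem₃ (br (d v)) B (6 * length xs) ⟩
          br (d v) + 6 + (B + 6 * length xs)      ≤⟨ +-mono-≤ (each (d v) (d-positive 2≤m v)) (go xs) ⟩
          3 * d v + 3 * lf (d v) + (3 * sum (map d xs) + 3 * Λ) ≡⟨ lem₄ (d v) (lf (d v)) (sum (map d xs)) Λ ⟩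
          3 * (d v + sum (map d xs)) + 3 * (lf (d v) + Λ)
            ≡⟨ cong (λ z → 3 * (d v + sum (map d xs)) + 3 * z) (length-filterᵇ-∷ (λ v → d v ≡ᵇ 1) v xs) ⟨
          3 * sum (map d (v ∷ xs)) + 3 * length (filterᵇ (λ v → d v ≡ᵇ 1) (v ∷ xs)) ∎
          where
          B = sum (map d (filterᵇ (λ v → 3 ≤ᵇ d v) xs))
          Λ = length (filterᵇ (λ v → d v ≡ᵇ 1) xs)
          lem₃ : ∀ a b c → a + b + (6 + c) ≡ a + 6 + (b + c)
          lem₃ = solve-∀
          lem₄ : ∀ a b c e → 3 * a + 3 * b + (3 * c + 3 * e) ≡ 3 * (a + c) + 3 * (b + e)
          lem₄ = solve-∀

      thinNbrs : Fin m → List (Fin m)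
      thinNbrs z = filterᵇ (λ y → d y ≤ᵇ 2) (nbrs G z)

      -- Passing only through vertices of degree at most 2 keeps the list linear in `d z`. A middle
      -- vertex of higher degree is branching itself and already excludes its neighbours.
      beyondThin : Fin m → List (Fin m)
      beyondThin z = concatMap (nbrs G) (thinNbrs z)

      bad : List (Fin m)
      bad = leaves ++ branching ++ concatMap (nbrs G) branching ++ concatMap beyondThin branching

      -- With S the degree sum of the branching vertices, the three lists around them have length at
      -- most S, S and 2S, and S is at most three times the number of leaves: 13 = 1 + 4 * 3.
      length-bad : 2 ≤ m → length bad ≤ 13 * length leaves
      length-bad 2≤m = begin
        length bad                                      ≡⟨ length-++ leaves ⟩
        Λ + length (branching ++ P ++ Q)                ≡⟨ cong (Λ +_) (length-++ branching) ⟩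
        Λ + (length branching + length (P ++ Q)) ≡⟨ cong (λ z → Λ + (length branching + z)) (length-++ P) ⟩
        Λ + (length branching + (length P + length Q)) ≤⟨ +-monoʳ-≤ Λ (+-mono-≤ few (+-mono-≤ (length-concatMap (nbrs G) d branching (λ _ → ≤-refl)) thin≤)) ⟩
        Λ + (S + (S + 2 * S))                           ≡⟨ lem Λ S ⟩
        Λ + 4 * S                                       ≤⟨ +-monoʳ-≤ Λ (*-monoʳ-≤ 4 (branching-degrees 2≤m)) ⟩
        Λ + 4 * (3 * Λ)                                 ≡⟨ lem′ Λ ⟩
        13 * Λ                                          ∎
        where
        open ≤-Reasoning
        Λ = length leaves
        S = sum (map d branching)
        P = concatMap (nbrs G) branching
        Q = concatMap beyondThin branching
        lem : ∀ Λ S → Λ + (S + (S + 2 * S)) ≡ Λ + 4 * S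
        lem = solve-∀
        lem′ : ∀ Λ → Λ + 4 * (3 * Λ) ≡ 13 * Λ
        lem′ = solve-∀
        few : length branching ≤ S
        few = ≤-trans (≤-reflexive (sym (trans (sum-map-const 1 branching) (*-identityʳ _)))) (sum-map-≤ branching (d-positive 2≤m))
        thin≤ : length (concatMap beyondThin branching) ≤ 2 * S
        thin≤ = ≤-trans (length-concatMap beyondThin (λ z → 2 * d z) branching (λ {z} _ → begin
            length (beyondThin z)
              ≤⟨ length-concatMap-const (nbrs G) 2 (thinNbrs z) (λ {y} y∈ → ≤ᵇ⇒≤ (d y) 2 (proj₂ (∈-filterᵇ⁻ (nbrs G z) y∈))) ⟩
            length (thinNbrs z) * 2  ≤⟨ *-monoˡ-≤ 2 (length-filter _ (nbrs G z)) ⟩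
            d z * 2                                           ≡⟨ *-comm (d z) 2 ⟩
            2 * d z                                           ∎))
          (≤-reflexive (sum-map-* 2 d branching))

      good : List (Fin m)
      good = others (t ∷ bad)

      length-good : m ≤ length good + suc (length bad)
      length-good = begin
        m                          ≡⟨ length-tabulate {n = m} id ⟨
        length (allFin m)          ≤⟨ length-⊆ (allFin⁺ m) (λ {w} _ → split w) ⟩
        length (good ++ t ∷ bad)   ≡⟨ length-++ good ⟩
        length good + suc (length bad) ∎
        where
        open ≤-Reasoning
        split : ∀ w → w ∈ good ++ t ∷ bad
        split w with w ∈? (t ∷ bad)
        ... | yes w∈ = ∈-++⁺ʳ good w∈
        ... | no  w∉ = ∈-++⁺ˡ (∈-others w∉)

      record Good (i : Fin m) : Set where
        field
          not-root   : i ≢ t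
          degree     : d i ≡ 2
          nbr-degree : ∀ {y} → T (adj G i y) → d y ≤ 2
          nbr²-degree : ∀ {y z} → T (adj G i y) → T (adj G y z) → d z ≤ 2

      ∈-nbrs : ∀ {u v} → T (adj G u v) → v ∈ nbrs G u
      ∈-nbrs {v = v} a = ∈-filterᵇ⁺ (∈-allFin v) a

      nbrs-adj : ∀ {u v} → v ∈ nbrs G u → T (adj G u v)
      nbrs-adj v∈ = proj₂ (∈-filterᵇ⁻ (allFin m) v∈)

      ∈-branching : ∀ {z} → ¬ d z ≤ 2 → z ∈ branching
      ∈-branching d> = ∈-filterᵇ⁺ (all _) (≤⇒≤ᵇ (≰⇒> d>))

      good⇒Good : 2 ≤ m → ∀ {i} → i ∈ good → Good i
      good⇒Good 2≤m {i} i∈ = record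
        { not-root   = λ { refl → i∉ (here refl) }
        ; degree     = two (d i) refl
        ; nbr-degree = nbr
        ; nbr²-degree = λ {y} {z} a a′ → ≮⇒≥ (λ d> → ∉₄ (∈-concatMap⁺ beyondThin (lose (∈-branching (<⇒≱ d>))
                          (∈-concatMap⁺ (nbrs G) (lose (∈-filterᵇ⁺ (∈-nbrs (adj-sym G a′)) (≤⇒≤ᵇ (nbr a))) (∈-nbrs (adj-sym G a))))))) }
        where
        i∉ : i ∉ t ∷ bad
        i∉ = others-∉ i∈
        ∉₁ : i ∉ leaves
        ∉₁ h = i∉ (there (∈-++⁺ˡ h))
        ∉₂ : i ∉ branching
        ∉₂ h = i∉ (there (∈-++⁺ʳ leaves (∈-++⁺ˡ h)))
        ∉₃ : i ∉ concatMap (nbrs G) branching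
        ∉₃ h = i∉ (there (∈-++⁺ʳ leaves (∈-++⁺ʳ branching (∈-++⁺ˡ h))))
        ∉₄ : i ∉ concatMap beyondThin branching
        ∉₄ h = i∉ (there (∈-++⁺ʳ leaves (∈-++⁺ʳ branching (∈-++⁺ʳ (concatMap (nbrs G) branching) h))))
        nbr : ∀ {y} → T (adj G i y) → d y ≤ 2
        nbr a = ≮⇒≥ (λ d> → ∉₃ (∈-concatMap⁺ (nbrs G) (lose (∈-branching (<⇒≱ d>)) (∈-nbrs (adj-sym G a)))))
        two : ∀ k → d i ≡ k → k ≡ 2
        two 0 eq = ⊥-elim (<⇒≱ (d-positive 2≤m i) (≤-reflexive eq))
        two 1 eq = ⊥-elim (∉₁ (∈-filterᵇ⁺ (all i) (≡⇒≡ᵇ (d i) 1 eq)))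
        two 2 eq = refl
        two (suc (suc (suc k))) eq = ⊥-elim (∉₂ (∈-branching (λ h → <⇒≱ (s≤s (s≤s (s≤s z≤n))) (≤-trans (≤-reflexive (sym eq)) h))))

      closed : Fin m → List (Fin m)
      closed v = v ∷ nbrs G v

      grow-ball : List (Fin m) → List (Fin m)
      grow-ball = concatMap closed

      -- Radius 3 is what it takes to keep closed neighbourhoods of chosen vertices disjoint and
      -- unjoined.
      ball : Fin m → List (Fin m)
      ball i = grow-ball (grow-ball (closed i))

      stay : ∀ {v vs} → v ∈ vs → v ∈ grow-ball vs
      stay v∈ = ∈-concatMap⁺ closed (lose v∈ (here refl))

      move : ∀ {u v vs} → u ∈ vs → T (adj G u v) → v ∈ grow-ball vs
      move u∈ a = ∈-concatMap⁺ closed (lose u∈ (there (∈-nbrs a)))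

      ∈-ball : ∀ i → i ∈ ball i
      ∈-ball i = stay {i} {grow-ball (closed i)} (stay {i} {closed i} (here refl))

      -- Vertices within distance 2 have degree at most 2, so each of three expansions at most
      -- triples the list.
      length-ball : ∀ {i} → Good i → length (ball i) ≤ 27
      length-ball {i} good = ≤-trans (length-concatMap-const closed 3 (grow-ball (closed i)) (λ {v} v∈ → s≤s (second {v} v∈)))
        (*-monoˡ-≤ 3 (≤-trans (length-concatMap-const closed 3 (closed i) (λ {v} v∈ → s≤s (first {v} v∈))) (*-monoˡ-≤ 3 (s≤s (≤-reflexive degree)))))
        where
        open Good good
        first : ∀ {v} → v ∈ closed i → d v ≤ 2
        first (here refl) = ≤-reflexive degree
        first (there v∈)  = nbr-degree (nbrs-adj v∈)
        second : ∀ {v} → v ∈ grow-ball (closed i) → d v ≤ 2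
        second v∈ with find (∈-concatMap⁻ closed {xs = closed i} v∈)
        ... | u , u∈ , here refl = first u∈
        ... | u , here refl , there v∈′ = nbr-degree (nbrs-adj v∈′)
        ... | u , there u∈  , there v∈′ = nbr²-degree (nbrs-adj u∈) (nbrs-adj v∈′)

      -- Pairwise distance at least 4, phrased by closed neighbourhoods as the triples need it.
      Far : List (Fin m) → Set
      Far J = ∀ {i j u v} → i ∈ J → j ∈ J → u ≡ i ⊎ T (adj G u i) → v ≡ j ⊎ T (adj G v j) → u ≡ v ⊎ T (adj G u v) → i ≡ j

      -- The balls around a maximal far subfamily cover all good vertices, and each has at most 27
      -- entries.
      far-subset : 2 ≤ m → ∃ λ J → Unique J × Far J × (∀ {i} → i ∈ J → Good i) × m ≤ length J * 27 + suc (length bad)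
      far-subset 2≤m with select ball ∈-ball good
      ... | J , sub , apart , cover = J , AllPairs.map (λ { x∉ refl → x∉ (∈-ball _) }) apart , far , good⇒Good 2≤m ∘ sub ,
        ≤-trans length-good (+-monoˡ-≤ _ (≤-trans (length-⊆ (filter⁺ _ (allFin⁺ m)) cover)
          (length-concatMap-const ball 27 J (λ i∈ → length-ball (good⇒Good 2≤m (sub i∈))))))
        where
        near : ∀ {i j u v} → u ≡ i ⊎ T (adj G u i) → v ≡ j ⊎ T (adj G v j) → u ≡ v ⊎ T (adj G u v) → j ∈ ball i
        near {i} {j} {u} {v} hu hv huv = third (second (first hu) huv) hv
          where
          first : u ≡ i ⊎ T (adj G u i) → u ∈ closed i
          first (inj₁ refl) = here refl
          first (inj₂ a)    = there (∈-nbrs (adj-sym G a))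
          second : u ∈ closed i → u ≡ v ⊎ T (adj G u v) → v ∈ grow-ball (closed i)
          second u∈ (inj₁ refl) = stay {u} {closed i} u∈
          second u∈ (inj₂ a)    = move {u} {v} {closed i} u∈ a
          third : v ∈ grow-ball (closed i) → v ≡ j ⊎ T (adj G v j) → j ∈ ball i
          third v∈ (inj₁ refl) = stay {v} {grow-ball (closed i)} v∈
          third v∈ (inj₂ a)    = move {v} {j} {grow-ball (closed i)} v∈ a
        far : Far J
        far i∈ j∈ hu hv huv with AllPairs-trichotomy apart i∈ j∈
        ... | inj₁ eq        = eq
        ... | inj₂ (inj₁ i∉) = ⊥-elim (i∉ (near hv hu (flip huv)))
          where
          flip : ∀ {u v} → u ≡ v ⊎ T (adj G u v) → v ≡ u ⊎ T (adj G v u)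
          flip (inj₁ eq) = inj₁ (sym eq)
          flip (inj₂ a)  = inj₂ (adj-sym G a)
        ... | inj₂ (inj₂ j∉) = ⊥-elim (j∉ (near hu hv huv))

  -- Absorbers made of leaves

  module Split {m} (J : List (Fin m)) (u : Unique J) (k : ℕ) where
    take-∈ : ∀ {v} → v ∈ take k J → v ∈ J
    take-∈ v∈ = subst (_ ∈_) (take++drop≡id k J) (∈-++⁺ˡ v∈)

    drop-∈ : ∀ {v} → v ∈ drop k J → v ∈ J
    drop-∈ v∈ = subst (_ ∈_) (take++drop≡id k J) (∈-++⁺ʳ (take k J) v∈)

    Unique-++-disjoint : ∀ {xs ys : List (Fin m)} {v} → Unique (xs ++ ys) → v ∈ xs → v ∉ ys
    Unique-++-disjoint {x ∷ xs} (x# ∷ _) (here refl) v∈ = All.lookup x# (∈-++⁺ʳ xs v∈) refl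
    Unique-++-disjoint {x ∷ xs} (_ ∷ u)  (there v∈)     = Unique-++-disjoint u v∈

    drop-take-disjoint : ∀ {v} → v ∈ drop k J → v ∉ take k J
    drop-take-disjoint v∈ v∈′ = Unique-++-disjoint (subst Unique (sym (take++drop≡id k J)) u) v∈′ v∈

  prefix-all : ∀ {ds ch : List (Fin m)} → (∀ {y} → y ∈ ch → y ∈ ds) → Prefix ds ch
  prefix-all {ch = []}     h = unplaced []
  prefix-all {ch = y ∷ ch} h = placed (h (here refl)) (prefix-all (h ∘ there))

  prefix-none : ∀ {ds ch : List (Fin m)} → (∀ {y} → y ∈ ch → y ∉ ds) → Prefix ds ch
  prefix-none h = unplaced (All.tabulate h)

  module Leaves {m} (Tr : OrientedTree m) where
    open Tree Tr

    -- The default is reached only at a vertex without neighbours.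
    headOr : Fin m → List (Fin m) → Fin m
    headOr i []      = i
    headOr i (y ∷ _) = y

    parent : Fin m → Fin m
    parent i = headOr i (nbrs G i)

    sgn : Fin m → Bool
    sgn i = arc G (parent i) i

    nbrs-leaf : ∀ {i} → d i ≡ 1 → nbrs G i ≡ parent i ∷ []
    nbrs-leaf {i} eq = go (nbrs G i) eq
      where
      go : ∀ ys → length ys ≡ 1 → ys ≡ headOr i ys ∷ []
      go (y ∷ []) _ = refl

    parent-unique : ∀ {i y} → d i ≡ 1 → T (adj G i y) → y ≡ parent i
    parent-unique {i} {y} eq a with subst (y ∈_) (nbrs-leaf eq) (∈-filterᵇ⁺ (∈-allFin y) a)
    ... | here h = h

    parent-adj : ∀ {i} → d i ≡ 1 → T (adj G i (parent i))
    parent-adj {i} eq = proj₂ (∈-filterᵇ⁻ (allFin m) (subst (parent i ∈_) (sym (nbrs-leaf eq)) (here refl)))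

    -- Neither leaf can be the first of the two to enter the growing tree, since its earlier
    -- neighbour would have to be the other one, and neither is the root.
    leaves-nonadjacent : ∀ {t ds u v} → Grown t ds → d u ≡ 1 → d v ≡ 1 → u ≢ t → v ≢ t → T (adj G u v) → u ∉ ds × v ∉ ds
    leaves-nonadjacent root du dv u≢t v≢t a = (λ { (here refl) → u≢t refl }) , (λ { (here refl) → v≢t refl })
    leaves-nonadjacent {t} {_} {u} {v} (grow {w} {ds} g w∉ one) du dv u≢t v≢t a =
      out du dv v≢t a (proj₁ ih) (proj₂ ih) , out dv du u≢t (adj-sym G a) (proj₂ ih) (proj₁ ih)
      where
      ih : u ∉ ds × v ∉ ds
      ih = leaves-nonadjacent g du dv u≢t v≢t a
      out : ∀ {u v} → d u ≡ 1 → d v ≡ 1 → v ≢ t → T (adj G u v) → u ∉ ds → v ∉ ds → u ∉ w ∷ ds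
      out du dv v≢t a u∉ v∉ (there u∈)  = u∉ u∈
      out {u} {v} du dv v≢t a u∉ v∉ (here refl) = let c , c∈ , e = earlier-nbr {w} {ds} one in
        v∉ (subst (_∈ ds) (trans (parent-unique du e) (sym (parent-unique du a))) c∈)

    module _ {t ds} (g : Grown t ds) (all : ∀ w → w ∈ ds) {J : List (Fin m)} (u : Unique J) (s : Bool)
      (J-leaf : ∀ {i} → i ∈ J → i ≢ t × d i ≡ 1 × sgn i ≡ s) (k : ℕ) where
      open Split J u k

      I L : List (Fin m)
      L = take k J
      I = drop k J

      chain : Fin m → List (Fin m)
      chain i = parent i ∷ i ∷ []

      in-J : ∀ {v} → v ∈ I ⊎ v ∈ L → v ∈ J
      in-J (inj₁ v∈) = drop-∈ v∈
      in-J (inj₂ v∈) = take-∈ v∈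

      leaf-degree : ∀ {i} → i ∈ J → d i ≡ 1
      leaf-degree i∈ = proj₁ (proj₂ (J-leaf i∈))

      -- A placed leaf other than the root has an earlier neighbour, and its parent is the only
      -- candidate.
      chain-prefix : ∀ {ds i} → Grown t ds → i ∈ J → Prefix ds (chain i)
      chain-prefix {ds} {i} g i∈ with i ∈? ds | parent i ∈? ds
      ... | no i∉  | no p∉  = unplaced (p∉ ∷ i∉ ∷ [])
      ... | no i∉  | yes p∈ = placed p∈ (unplaced (i∉ ∷ []))
      ... | yes i∈ds | yes p∈ = placed p∈ (placed i∈ds (unplaced []))
      ... | yes i∈ds | no p∉ with parent-placed g i∈ds (proj₁ (J-leaf i∈))
      ...   | y , y∈ , a = ⊥-elim (p∉ (subst (_∈ ds) (parent-unique (leaf-degree i∈) a) y∈))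

      slots≤1 : ∀ w → slots G 1 I w ≤ 1
      slots≤1 w with w ∈? I
      ... | yes _ = ≤-refl
      ... | no _  = ≤-trans (≤-reflexive (length-take 1 (filterᵇ (adj G w) I))) (m⊓n≤m 1 _)

      leaf-schedule : ∀ {ds} → Grown t ds → Schedule G 1 I chain ds
      leaf-schedule root = place [] (λ ()) (≤-trans (slots≤1 t) (s≤s z≤n)) (λ i∈ → chain-prefix root (drop-∈ i∈))
      leaf-schedule (grow {w} {ds} g w∉ one) = place (leaf-schedule g) w∉
        (+-mono-≤ (≤-reflexive one) (slots≤1 w)) (λ i∈ → chain-prefix (grow g w∉ one) (drop-∈ i∈))

      leaf-absorber : Absorber Tr 1 t
      leaf-absorber = record
        { I = I ; L = L ; ch = chain
        ; I-unique = drop⁺ k u ; L-unique = take⁺ k u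
        ; disjoint = drop-take-disjoint
        ; t∉I = λ t∈ → proj₁ (J-leaf (drop-∈ t∈)) refl
        ; t∉L = λ t∈ → proj₁ (J-leaf (take-∈ t∈)) refl
        ; independent = λ {x} {y} x∈ y∈ a → proj₁ (leaves-nonadjacent g (leaf-degree (in-J x∈)) (leaf-degree (in-J y∈))
                          (proj₁ (J-leaf (in-J x∈))) (proj₁ (J-leaf (in-J y∈))) a) (all x)
        ; ch-⊆ = λ { i∈ (here refl) → inj₂ (adj-sym G (parent-adj (leaf-degree (drop-∈ i∈)))) ; _ (there (here refl)) → inj₁ refl }
        ; ch-self = λ _ → there (here refl)
        ; ch-nbr = λ i∈ a → here (parent-unique (leaf-degree (drop-∈ i∈)) (adj-sym G a))
        ; ch-length = λ _ → refl
        ; ch-unique = λ {i} i∈ → ((λ eq → adj-irrefl {i} (subst (λ z → T (adj G i z)) eq (parent-adj (leaf-degree (drop-∈ i∈))))) ∷ []) ∷ [] ∷ []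
        ; L-degree = λ ℓ∈ → leaf-degree (take-∈ ℓ∈)
        ; consistent = λ {w} i∈ j∈ a a′ → trans (outward i∈ a) (sym (outward j∈ a′))
        ; order = ds ; order-all = all
        ; schedule = leaf-schedule g }
        where
        opposite : ∀ {u v} → T (adj G u v) → arc G u v ≡ Bool.not (arc G v u)
        opposite {u} {v} a with arc G u v in eq | arc G v u in eq′
        ... | true  | false = refl
        ... | false | true  = refl
        ... | true  | true  = ⊥-elim (subst T (trans (sym eq) (oriented Tr v u (subst T (sym eq′) tt))) tt)
        outward : ∀ {w i} → i ∈ I → T (adj G w i) → arc G i w ≡ Bool.not s
        outward {w} {i} i∈ a with J-leaf (drop-∈ i∈)
        ... | _ , di , si = trans (opposite (adj-sym G a)) (cong Bool.not (trans (cong (λ z → arc G z i) (parent-unique di (adj-sym G a))) si))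

  -- Absorbers made of far apart vertices of degree 2

  length-filterᵇ-≤ : ∀ {A : Set} (p : A → Bool) x xs → length (filterᵇ p (x ∷ xs)) ≤ suc (length (filterᵇ p xs))
  length-filterᵇ-≤ p x xs with p x
  ... | true  = ≤-refl
  ... | false = n≤1+n _

  length-filterᵇ-none : ∀ {A : Set} (p : A → Bool) xs → (∀ {x} → x ∈ xs → ¬ T (p x)) → length (filterᵇ p xs) ≡ 0
  length-filterᵇ-none p xs h = cong length (filter-none (T? ∘ p) (All.tabulate h))

  module FarPaths {m} (Tr : OrientedTree m) where
    open Tree Tr

    module _ {t hs} (g : Grown t hs) (all : ∀ w → w ∈ hs) {J : List (Fin m)} (u : Unique J)
      (far : Far g all J) (J-good : ∀ {i} → i ∈ J → Good g all i) (k : ℕ) where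
      open Split J u k

      I L : List (Fin m)
      L = take k J
      I = drop k J

      in-J : ∀ {v} → v ∈ I ⊎ v ∈ L → v ∈ J
      in-J (inj₁ v∈) = drop-∈ v∈
      in-J (inj₂ v∈) = take-∈ v∈

      segment : Fin m → List (Fin m)
      segment i = i ∷ nbrs G i

      segment-near : ∀ {i y} → y ∈ segment i → y ≡ i ⊎ T (adj G y i)
      segment-near (here refl)    = inj₁ refl
      segment-near {i} {y} (there y∈) = inj₂ (adj-sym G {i} {y} (proj₂ (∈-filterᵇ⁻ (allFin m) y∈)))

      near-segment : ∀ {i y} → T (adj G i y) → y ∈ segment i
      near-segment {y = y} a = there (∈-filterᵇ⁺ (∈-allFin y) a)

      two-nbrs : ∀ {i} → i ∈ J → ∃ λ p → ∃ λ q → nbrs G i ≡ p ∷ q ∷ []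
      two-nbrs {i} i∈ = go (nbrs G i) (Good.degree (J-good i∈))
        where
        go : ∀ ys → length ys ≡ 2 → ∃ λ p → ∃ λ q → ys ≡ p ∷ q ∷ []
        go (p ∷ q ∷ []) _ = p , q , refl

      independent : ∀ {x y} → x ∈ J → y ∈ J → ¬ T (adj G x y)
      independent {x} {y} x∈ y∈ a with far x∈ y∈ (inj₁ refl) (inj₁ refl) (inj₂ a)
      ... | refl = adj-irrefl {x} a

      segment-unique : ∀ i → Unique (segment i)
      segment-unique i = All.tabulate (λ { y∈ refl → adj-irrefl {i} (proj₂ (∈-filterᵇ⁻ (allFin m) y∈)) }) ∷ filter⁺ _ (allFin⁺ m)

      -- Segments are reversed because the head of a schedule is placed last, whereas `i` has to
      -- precede its neighbours.
      triples : List (Fin m) → List (Fin m)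
      triples = concatMap (reverse ∘ segment)

      ∈-triples⁻ : ∀ Is {y} → y ∈ triples Is → ∃ λ i → i ∈ Is × y ∈ segment i
      ∈-triples⁻ Is y∈ with find (∈-concatMap⁻ (reverse ∘ segment) {xs = Is} y∈)
      ... | i , i∈ , y∈′ = i , i∈ , Anyₚ.reverse⁻ y∈′

      ∈-triples⁺ : ∀ {Is i y} → i ∈ Is → y ∈ segment i → y ∈ triples Is
      ∈-triples⁺ i∈ y∈ = ∈-concatMap⁺ (reverse ∘ segment) (lose i∈ (Anyₚ.reverse⁺ y∈))

      slots-in : ∀ {w} → w ∈ I → slots G 2 I w ≡ 2
      slots-in {w} w∈ with w ∈? I
      ... | yes _ = refl
      ... | no w∉ = ⊥-elim (w∉ w∈)

      slots-out : ∀ {w} → w ∉ I → slots G 2 I w ≤ 1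
      slots-out {w} w∉ with w ∈? I
      ... | yes w∈ = ⊥-elim (w∉ w∈)
      ... | no _   = ≤-trans (≤-reflexive (length-take 1 (filterᵇ (adj G w) I))) (m⊓n≤m 1 _)

      slots-away : ∀ {w} → w ∉ I → (∀ {i} → i ∈ I → ¬ T (adj G w i)) → slots G 2 I w ≡ 0
      slots-away {w} w∉ away with w ∈? I
      ... | yes w∈ = ⊥-elim (w∉ w∈)
      ... | no _   = cong (length ∘ take 1) (filter-none (T? ∘ adj G w) (All.tabulate away))

      module _ (Is : List (Fin m)) {i} (Is⊆I : ∀ {j} → j ∈ Is → j ∈ I) (i∈I : i ∈ I) (i∉Is : i ∉ Is) where

        clash : ∀ {w y} → w ∈ segment i → y ∈ triples Is → ¬ (w ≡ y ⊎ T (adj G w y))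
        clash w∈ y∈ h with ∈-triples⁻ Is y∈
        ... | j , j∈ , y∈′ with far (drop-∈ i∈I) (drop-∈ (Is⊆I j∈)) (segment-near w∈) (segment-near y∈′) h
        ...   | refl = i∉Is j∈

        no-nbr : ∀ {w} → w ∈ segment i → length (filterᵇ (adj G w) (triples Is)) ≡ 0
        no-nbr {w} w∈ = length-filterᵇ-none (adj G w) (triples Is) (λ y∈ a → clash w∈ y∈ (inj₂ a))

        fresh : ∀ {w} → w ∈ segment i → w ∉ triples Is
        fresh w∈ w∈′ = clash w∈ w∈′ (inj₁ refl)

        prefixes : ∀ {ds} → (∀ {y} → y ∈ triples Is → y ∈ ds) → (∀ {y} → y ∈ ds → y ∈ segment i ⊎ y ∈ triples Is) →
          Prefix ds (segment i) → ∀ {j} → j ∈ I → Prefix ds (segment j)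
        prefixes {ds} ⊇ ⊆ pre {j} j∈ with j ≟ i | j ∈? Is
        ... | yes refl | _       = pre
        ... | no _     | yes j∈Is = prefix-all (λ y∈ → ⊇ (∈-triples⁺ j∈Is y∈))
        ... | no j≢i   | no j∉Is = prefix-none (λ y∈ y∈ds → [ (λ y∈i → j≢i (same y∈ y∈i i∈I)) , elsewhere y∈ ]′ (⊆ y∈ds))
          where
          same : ∀ {y j′} → y ∈ segment j → y ∈ segment j′ → j′ ∈ I → j ≡ j′
          same y∈ y∈′ j′∈ = far (drop-∈ j∈) (drop-∈ j′∈) (segment-near y∈) (segment-near y∈′) (inj₁ refl)
          elsewhere : ∀ {y} → y ∈ segment j → y ∉ triples Is
          elsewhere y∈ y∈′ with ∈-triples⁻ Is y∈′
          ... | j′ , j′∈ , y∈″ = j∉Is (subst (_∈ Is) (sym (same y∈ y∈″ (Is⊆I j′∈))) j′∈)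

        -- Distance keeps the triples unjoined. So `i` has no placed neighbour and two constraints,
        -- while `p` and `q` each have the edge to `i` and one constraint; an edge between `p` and
        -- `q` would form a triangle.
        add-triple : Schedule G 2 I segment (triples Is) → Schedule G 2 I segment (triples (i ∷ Is))
        add-triple s with two-nbrs (drop-∈ i∈I)
        ... | p , q , eq = subst (λ xs → Schedule G 2 I segment (xs ++ triples Is)) (sym (cong (λ xs → reverse (i ∷ xs)) eq))
          (place (place (place s (fresh i∈) (≤-reflexive (cong₂ _+_ (no-nbr i∈) (slots-in i∈I)))
              (prefixes there (λ { (here refl) → inj₁ i∈ ; (there y∈) → inj₂ y∈ }) pre₁))
            (λ { (here refl) → adj-irrefl {i} ai ; (there y∈) → fresh p∈ y∈ })
            (+-mono-≤ (≤-trans (length-filterᵇ-≤ (adj G p) i (triples Is)) (s≤s (≤-reflexive (no-nbr p∈)))) (slots-out (p∉I ai)))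
            (prefixes (there ∘ there) (λ { (here refl) → inj₁ p∈ ; (there (here refl)) → inj₁ i∈ ; (there (there y∈)) → inj₂ y∈ }) pre₂))
          (λ { (here refl) → p≢q refl ; (there (here refl)) → adj-irrefl {i} aq ; (there (there y∈)) → fresh q∈ y∈ })
          (+-mono-≤ q-nbrs (slots-out (p∉I aq)))
          (prefixes (there ∘ there ∘ there) (λ { (here refl) → inj₁ q∈ ; (there (here refl)) → inj₁ p∈ ; (there (there (here refl))) → inj₁ i∈
                                               ; (there (there (there y∈))) → inj₂ y∈ }) pre₃))
          where
          i∈ : i ∈ segment i
          i∈ = here refl
          p∈ : p ∈ segment i
          p∈ = there (subst (p ∈_) (sym eq) (here refl))
          q∈ : q ∈ segment i
          q∈ = there (subst (q ∈_) (sym eq) (there (here refl)))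
          segment-adj : ∀ {y} → y ∈ nbrs G i → T (adj G i y)
          segment-adj y∈ = proj₂ (∈-filterᵇ⁻ (allFin m) y∈)
          ai : T (adj G i p)
          ai = segment-adj (subst (p ∈_) (sym eq) (here refl))
          aq : T (adj G i q)
          aq = segment-adj (subst (q ∈_) (sym eq) (there (here refl)))
          uniq : Unique (i ∷ p ∷ q ∷ [])
          uniq = subst (λ xs → Unique (i ∷ xs)) eq (segment-unique i)
          p≢q : q ≢ p
          p≢q refl with uniq
          ... | _ ∷ (p≢ ∷ []) ∷ _ = p≢ refl
          i≢p : p ≢ i
          i≢p refl = adj-irrefl {i} ai
          i≢q : q ≢ i
          i≢q refl = adj-irrefl {i} aq
          p∉I : ∀ {y} → T (adj G i y) → y ∉ I
          p∉I a y∈ = independent (drop-∈ i∈I) (drop-∈ y∈) a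
          no-triangle : ¬ T (adj G q p)
          no-triangle a = acyclic Tr (i ∷ p ∷ q ∷ []) (s≤s (s≤s (s≤s z≤n)) , uniq , cons ai (cons (adj-sym G a) single) , adj-sym G aq)
          q-nbrs : length (filterᵇ (adj G q) (p ∷ i ∷ triples Is)) ≤ 1
          q-nbrs = ≤-trans (≤-reflexive (cong length (filter-reject (T? ∘ adj G q) {p} {i ∷ triples Is} no-triangle)))
            (≤-trans (length-filterᵇ-≤ (adj G q) i (triples Is)) (s≤s (≤-reflexive (no-nbr q∈))))
          pre₁ : Prefix (i ∷ triples Is) (segment i)
          pre₁ rewrite eq = placed (here refl) (unplaced
            ((λ { (here h) → i≢p h ; (there y∈) → fresh p∈′ y∈ }) ∷ (λ { (here h) → i≢q h ; (there y∈) → fresh q∈′ y∈ }) ∷ []))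
            where
            p∈′ : p ∈ segment i
            p∈′ = p∈
            q∈′ : q ∈ segment i
            q∈′ = q∈
          pre₂ : Prefix (p ∷ i ∷ triples Is) (segment i)
          pre₂ = subst (λ xs → Prefix (p ∷ i ∷ triples Is) (i ∷ xs)) (sym eq) (placed (there (here refl)) (placed (here refl) (unplaced
            ((λ { (here h) → p≢q h ; (there (here h)) → i≢q h ; (there (there y∈)) → fresh q∈ y∈ }) ∷ []))))
          pre₃ : Prefix (q ∷ p ∷ i ∷ triples Is) (segment i)
          pre₃ = subst (λ xs → Prefix (q ∷ p ∷ i ∷ triples Is) (i ∷ xs)) (sym eq)
            (placed (there (there (here refl))) (placed (there (here refl)) (placed (here refl) (unplaced []))))

      triples-schedule : ∀ Is → Unique Is → (∀ {j} → j ∈ Is → j ∈ I) → Schedule G 2 I segment (triples Is)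
      triples-schedule []       _        _   = []
      triples-schedule (i ∷ Is) (i# ∷ u) sub = add-triple Is (sub ∘ there) (sub (here refl)) (λ i∈ → All.lookup i# i∈ refl)
        (triples-schedule Is u (sub ∘ there))

      I-unique : Unique I
      I-unique = drop⁺ k u

      all-triples : List (Fin m)
      all-triples = triples I

      -- Sitting at the tail, the triples are placed first; the other vertices follow in the rooted
      -- order.
      extend : List (Fin m) → List (Fin m)
      extend ds = filterᵇ (unused all-triples) ds ++ all-triples

      Schedule⇒Unique : ∀ {κ ch ds} → Schedule G κ I ch ds → Unique ds
      Schedule⇒Unique []             = []
      Schedule⇒Unique (place s w∉ _ _) = All.tabulate (λ { y∈ refl → w∉ y∈ }) ∷ Schedule⇒Unique s

      extend-schedule : ∀ {ds} → Grown t ds → Schedule G 2 I segment (extend ds)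
      -- Placing the triples early may give `w` a second placed neighbour. If `w` is adjacent to a
      -- triple, it is at distance 2 from a vertex of `I` and has degree at most 2; otherwise only
      -- its earlier neighbours in the rooted order count.
      extend-one : ∀ {ds} w → w ∉ ds → length (filterᵇ (adj G w) ds) ≤ 1 → Schedule G 2 I segment (extend ds) →
        Schedule G 2 I segment (extend (w ∷ ds))
      extend-schedule root = extend-one t (λ ()) z≤n (triples-schedule I I-unique id)
      extend-schedule (grow {w} {ds} g w∉ one) = extend-one w w∉ (≤-reflexive one) (extend-schedule g)
      extend-one {ds} w w∉ few s with w ∈? all-triples
      ... | yes _     = s
      ... | no  w∉tri = place s w∉ext (≤-trans (≤-reflexive (trans (cong (length (filterᵇ (adj G w) (extend ds)) +_)
                          (slots-away (λ w∈I → w∉tri (∈-triples⁺ w∈I (here refl))) away)) (+-identityʳ _))) nbrs≤2)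
            (λ i∈ → prefix-all (λ y∈ → there (∈-++⁺ʳ (filterᵇ (unused all-triples) ds) (∈-triples⁺ i∈ y∈))))
        where
        away : ∀ {i} → i ∈ I → ¬ T (adj G w i)
        away i∈ a = w∉tri (∈-triples⁺ i∈ (near-segment (adj-sym G a)))
        w∉ext : w ∉ extend ds
        w∉ext w∈ with ∈-++⁻ (filterᵇ (unused all-triples) ds) w∈
        ... | inj₁ w∈′ = w∉ (proj₁ (∈-filterᵇ⁻ ds w∈′))
        ... | inj₂ w∈′ = w∉tri w∈′
        thin : ∀ {y} → y ∈ all-triples → T (adj G w y) → d w ≤ 2
        thin y∈ a with ∈-triples⁻ I y∈
        ... | i , i∈ , here refl = ⊥-elim (away i∈ a)
        ... | i , i∈ , there y∈′ = Good.nbr²-degree (J-good (drop-∈ i∈)) (proj₂ (∈-filterᵇ⁻ (allFin m) y∈′)) (adj-sym G a)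
        nbrs≤2 : length (filterᵇ (adj G w) (extend ds)) ≤ 2
        nbrs≤2 with filterᵇ (adj G w) all-triples in eq
        ... | [] = begin
          length (filterᵇ (adj G w) (extend ds))
            ≡⟨ cong length (trans (filter-++ (T? ∘ adj G w) (filterᵇ (unused all-triples) ds) all-triples) (cong (filterᵇ (adj G w) (filterᵇ (unused all-triples) ds) ++_) eq)) ⟩
          length (filterᵇ (adj G w) (filterᵇ (unused all-triples) ds) ++ [])
            ≡⟨ cong length (++-identityʳ (filterᵇ (adj G w) (filterᵇ (unused all-triples) ds))) ⟩
          length (filterᵇ (adj G w) (filterᵇ (unused all-triples) ds))
            ≤⟨ length-filterᵇ-filterᵇ ds ⟩
          length (filterᵇ (adj G w) ds) ≤⟨ few ⟩
          1                             ≤⟨ s≤s z≤n ⟩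
          2                             ∎
          where
          open ≤-Reasoning
          length-filterᵇ-filterᵇ : ∀ xs → length (filterᵇ (adj G w) (filterᵇ (unused all-triples) xs)) ≤ length (filterᵇ (adj G w) xs)
          length-filterᵇ-filterᵇ []       = z≤n
          length-filterᵇ-filterᵇ (x ∷ xs) with unused all-triples x
          ... | false = ≤-trans (length-filterᵇ-filterᵇ xs) (length-mono x xs)
            where
            length-mono : ∀ x xs → length (filterᵇ (adj G w) xs) ≤ length (filterᵇ (adj G w) (x ∷ xs))
            length-mono x xs with adj G w x
            ... | true  = n≤1+n _
            ... | false = ≤-refl
          ... | true with adj G w x
          ...   | true  = s≤s (length-filterᵇ-filterᵇ xs)
          ...   | false = length-filterᵇ-filterᵇ xs
        ... | y ∷ ys with ∈-filterᵇ⁻ {P = adj G w} all-triples (subst (y ∈_) (sym eq) (here refl))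
        ...   | y∈ , a = ≤-trans (length-⊆ {ys = nbrs G w} (filter⁺ _ (Schedule⇒Unique s))
                            (λ {z} z∈ → ∈-filterᵇ⁺ {P = adj G w} (∈-allFin z) (proj₂ (∈-filterᵇ⁻ (extend ds) z∈)))) (thin y∈ a)

      path-absorber : Absorber Tr 2 t
      path-absorber = record
        { I = I ; L = L ; ch = segment
        ; I-unique = I-unique ; L-unique = take⁺ k u
        ; disjoint = drop-take-disjoint
        ; t∉I = λ t∈ → Good.not-root (J-good (drop-∈ t∈)) refl
        ; t∉L = λ t∈ → Good.not-root (J-good (take-∈ t∈)) refl
        ; independent = λ x∈ y∈ → independent (in-J x∈) (in-J y∈)
        ; ch-⊆ = λ _ → segment-near
        ; ch-self = λ _ → here refl
        ; ch-nbr = λ {i} {y} _ a → near-segment (adj-sym G {y} {i} a)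
        ; ch-length = λ i∈ → cong suc (Good.degree (J-good (drop-∈ i∈)))
        ; ch-unique = λ {i} _ → segment-unique i
        ; L-degree = λ ℓ∈ → Good.degree (J-good (take-∈ ℓ∈))
        ; consistent = λ {w} i∈ j∈ a a′ → cong (λ z → arc G z w) (far (drop-∈ i∈) (drop-∈ j∈) (inj₂ a) (inj₂ a′) (inj₁ refl))
        ; order = extend hs ; order-all = covers
        ; schedule = extend-schedule g }
        where
        covers : ∀ w → w ∈ extend hs
        covers w with w ∈? all-triples
        ... | yes w∈ = ∈-++⁺ʳ (filterᵇ (unused all-triples) hs) w∈
        ... | no  w∉ = ∈-++⁺ˡ (∈-filterᵇ⁺ (all w) (∉⇒unused w∉))

  -- Sizes of absorbers and the statement for finite parameters

  n<2^suc-log : ∀ n → n < 2 ^ suc ⌊log₂ n ⌋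
  n<2^suc-log n = ≰⇒> λ h → 1+n≰n (≤-trans (≤-reflexive (sym (⌊log₂[2^n]⌋≡n (suc ⌊log₂ n ⌋)))) (⌊log₂⌋-mono-≤ h))

  1≤log : ∀ {n} → 2 ≤ n → 1 ≤ ⌊log₂ n ⌋
  1≤log h = ≤-trans (≤-reflexive (sym (⌊log₂[2^n]⌋≡n 1))) (⌊log₂⌋-mono-≤ h)

  split-lengths : ∀ {A : Set} k (xs : List A) → k ≤ length xs → length (take k xs) ≡ k × k + length (drop k xs) ≡ length xs
  split-lengths k xs k≤ = trans (length-take k xs) (m≤n⇒m⊓n≡m k≤) , trans (cong (k +_) (length-drop k xs)) (m+[n∸m]≡n k≤)

  -- Abstract, since conversion checking would otherwise unfold the multiplications by numerals.
  abstract
    twentySix fiftyFour : ℕ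
    twentySix = 26
    fiftyFour = 54

    fiftyFour≡ : fiftyFour ≡ 54
    fiftyFour≡ = refl

    fiftyFour-cancel : ∀ {k j} → fiftyFour * k + fiftyFour ≤ fiftyFour * j + fiftyFour → k ≤ j
    fiftyFour-cancel {k} {j} h = *-cancelˡ-≤ 54 (+-cancelʳ-≤ 54 (54 * k) (54 * j) h)

    leaf-bound : ∀ {m Λ x} → m ≤ twentySix * Λ → Λ ≤ 1 + 2 * x → m ≤ fiftyFour * x + fiftyFour
    leaf-bound {m} {Λ} {x} m≤ Λ≤ = begin
      m                                      ≤⟨ m≤ ⟩
      26 * Λ                                 ≤⟨ *-monoʳ-≤ 26 Λ≤ ⟩
      26 * (1 + 2 * x)                       ≤⟨ m≤m+n _ (2 * x + 28) ⟩
      26 * (1 + 2 * x) + (2 * x + 28)        ≡⟨ lem x ⟩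
      54 * x + 54                            ∎
      where
      open ≤-Reasoning
      lem : ∀ x → 26 * (1 + 2 * x) + (2 * x + 28) ≡ 54 * x + 54
      lem = solve-∀

    -- The at most `13 * Λ` bad vertices form at most half of the tree, so doubling removes them: 26
    -- = 2 * 13 and 54 = 2 * 27.
    path-bound : ∀ {m Λ x} → twentySix * Λ ≤ m → m ≤ x * 27 + suc (13 * Λ) → m ≤ fiftyFour * x + fiftyFour
    path-bound {m} {Λ} {x} 26Λ≤m m≤ = +-cancelʳ-≤ m _ _ (begin
      m + m                                                   ≤⟨ +-mono-≤ m≤ m≤ ⟩
      (x * 27 + suc (13 * Λ)) + (x * 27 + suc (13 * Λ))       ≡⟨ lem x Λ ⟩
      54 * x + 2 + 26 * Λ                                     ≤⟨ +-mono-≤ (+-monoʳ-≤ (54 * x) (m≤m+n 2 52)) 26Λ≤m ⟩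
      54 * x + 54 + m                                         ∎)
      where
      open ≤-Reasoning
      lem : ∀ x Λ → (x * 27 + suc (13 * Λ)) + (x * 27 + suc (13 * Λ)) ≡ 54 * x + 2 + 26 * Λ
      lem = solve-∀

  exists-absorber : ∀ (Tr : OrientedTree m) t k → 2 ≤ m → fiftyFour * k + fiftyFour ≤ m →
    ∃ λ κ → κ ≤ 2 × Σ (Absorber Tr κ t) λ 𝒜 → length (Absorber.L 𝒜) ≡ k × m ≤ fiftyFour * (k + length (Absorber.I 𝒜)) + fiftyFour
  exists-absorber {m} Tr t k 2≤m large with Tree.rooted-order Tr t
  ... | ds , g , all = cases (≤-total m (twentySix * length leaves′))
    where
    open Tree Tr
    open ≤-Reasoning
    leaves′ : List (Fin m)
    leaves′ = leaves g all

    enough : ∀ {j} → m ≤ fiftyFour * j + fiftyFour → k ≤ j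
    enough le = fiftyFour-cancel (≤-trans large le)

    module _ (m≤ : m ≤ twentySix * length leaves′) where
      candidates : List (Fin m)
      candidates = filterᵇ (unused (t ∷ [])) leaves′

      signed : Bool → List (Fin m)
      signed true  = filterᵇ (Leaves.sgn Tr) candidates
      signed false = filterᵇ (not ∘ Leaves.sgn Tr) candidates

      candidates-length : length leaves′ ≤ 1 + length candidates
      candidates-length = length-⊆ {ys = t ∷ candidates} (filter⁺ _ (Grown⇒Unique g)) split
        where
        split : ∀ {v} → v ∈ leaves′ → v ∈ t ∷ candidates
        split {v} v∈ with v ∈? (t ∷ [])
        ... | yes (here refl) = here refl
        ... | no  v∉          = there (∈-filterᵇ⁺ v∈ (∉⇒unused v∉))

      -- A common orientation towards the parents is what `consistent` demands; the larger class
      -- costs only a factor 2.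
      majority : ∃ λ s → length candidates ≤ 2 * length (signed s)
      majority with ≤-total (length (signed false)) (length (signed true))
      ... | inj₁ h = true , (begin
        length candidates                             ≡⟨ length-partition (Leaves.sgn Tr) candidates ⟩
        length (signed true) + length (signed false)  ≤⟨ +-monoʳ-≤ (length (signed true)) (≤-trans h (m≤m+n _ 0)) ⟩
        2 * length (signed true)                      ∎)
      ... | inj₂ h = false , (begin
        length candidates                             ≡⟨ length-partition (Leaves.sgn Tr) candidates ⟩
        length (signed true) + length (signed false)  ≤⟨ +-mono-≤ h (m≤m+n _ 0) ⟩
        2 * length (signed false)                     ∎)

      signed-leaf : ∀ s {i} → i ∈ signed s → i ∈ candidates × Leaves.sgn Tr i ≡ s
      signed-leaf true  i∈ with ∈-filterᵇ⁻ candidates i∈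
      ... | i∈′ , h = i∈′ , Equivalence.to T-≡ h
      signed-leaf false {i} i∈ with ∈-filterᵇ⁻ candidates i∈
      ... | i∈′ , h with Leaves.sgn Tr i
      ...   | false = i∈′ , refl

      candidate-leaf : ∀ {i} → i ∈ candidates → i ≢ t × d i ≡ 1
      candidate-leaf {i} i∈ with ∈-filterᵇ⁻ leaves′ i∈
      ... | i∈′ , h = (λ { refl → unused⇒∉ h (here refl) }) , ≡ᵇ⇒≡ (d i) 1 (proj₂ (∈-filterᵇ⁻ ds i∈′))

      signed-unique : ∀ s → Unique (signed s)
      signed-unique true  = filter⁺ _ (filter⁺ _ (filter⁺ _ (Grown⇒Unique g)))
      signed-unique false = filter⁺ _ (filter⁺ _ (filter⁺ _ (Grown⇒Unique g)))

      leaf-case : ∃ λ κ → κ ≤ 2 × Σ (Absorber Tr κ t) λ 𝒜 → length (Absorber.L 𝒜) ≡ k × m ≤ fiftyFour * (k + length (Absorber.I 𝒜)) + fiftyFour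
      leaf-case = let s , half = majority in build s half
        where
        build : ∀ s → length candidates ≤ 2 * length (signed s) → _
        build s half = 1 , s≤s z≤n ,
          Leaves.leaf-absorber Tr g all (signed-unique s) s (λ i∈ → let i∈′ , si = signed-leaf s i∈
                                                                        i≢t , di = candidate-leaf i∈′ in i≢t , di , si) k ,
          proj₁ lengths , ≤-trans bound (≤-reflexive (cong (λ z → fiftyFour * z + fiftyFour) (sym (proj₂ lengths))))
          where
          S = signed s
          bound : m ≤ fiftyFour * length S + fiftyFour
          bound = leaf-bound m≤ (≤-trans candidates-length (s≤s half))
          lengths = split-lengths k S (enough bound)

    path-case : twentySix * length leaves′ ≤ m → ∃ λ κ → κ ≤ 2 × Σ (Absorber Tr κ t) λ 𝒜 → length (Absorber.L 𝒜) ≡ k × m ≤ fiftyFour * (k + length (Absorber.I 𝒜)) + fiftyFour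
    path-case 26Λ≤m with far-subset g all 2≤m
    ... | J , u , far , J-good , m≤ = 2 , ≤-refl , FarPaths.path-absorber Tr g all u far J-good k ,
      proj₁ lengths , ≤-trans bound (≤-reflexive (cong (λ z → fiftyFour * z + fiftyFour) (sym (proj₂ lengths))))
      where
      m≤′ : m ≤ length J * 27 + suc (13 * length leaves′)
      m≤′ = ≤-trans m≤ (+-monoʳ-≤ (length J * 27) (s≤s (length-bad g all 2≤m)))
      bound : m ≤ fiftyFour * length J + fiftyFour
      bound = path-bound 26Λ≤m m≤′
      lengths = split-lengths k J (enough bound)

    cases : m ≤ twentySix * length leaves′ ⊎ twentySix * length leaves′ ≤ m → _
    cases (inj₁ h) = leaf-case h
    cases (inj₂ h) = path-case h

  -- With p the logarithm, n < 2^(p+1) and (2n)² ≤ 2^(2p+4).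
  requirements-bound : ∀ n κ l → 0 < n → κ ≤ 2 → n * (2 * n) ^ κ * 2 ^ l < 2 ^ (3 * ⌊log₂ n ⌋ + 5 + l)
  requirements-bound n@(suc _) κ l _ κ≤2 = begin-strict
    n * (2 * n) ^ κ * 2 ^ l        ≤⟨ *-monoˡ-≤ (2 ^ l) (*-monoʳ-≤ n (^-monoʳ-≤ (2 * n) κ≤2)) ⟩
    n * (2 * n) ^ 2 * 2 ^ l        <⟨ *-monoˡ-< (2 ^ l) ⦃ m^n≢0 2 l ⦄ (≤-trans (*-monoˡ-< ((2 * n) ^ 2) (n<2^suc-log n)) (*-monoʳ-≤ (2 ^ suc p) (^-monoˡ-≤ 2 (*-monoʳ-≤ 2 (<⇒≤ (n<2^suc-log n)))))) ⟩
    2 ^ suc p * (2 ^ suc (suc p)) ^ 2 * 2 ^ l ≡⟨ cong (λ z → 2 ^ suc p * z * 2 ^ l) (^-*-assoc 2 (suc (suc p)) 2) ⟩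
    2 ^ suc p * 2 ^ (suc (suc p) * 2) * 2 ^ l ≡⟨ cong (_* 2 ^ l) (^-distribˡ-+-* 2 (suc p) (suc (suc p) * 2)) ⟨
    2 ^ (suc p + suc (suc p) * 2) * 2 ^ l     ≡⟨ ^-distribˡ-+-* 2 (suc p + suc (suc p) * 2) l ⟨
    2 ^ (suc p + suc (suc p) * 2 + l)         ≡⟨ cong (λ z → 2 ^ (z + l)) (lem p) ⟩
    2 ^ (3 * p + 5 + l)                       ∎
    where
    open ≤-Reasoning
    p = ⌊log₂ n ⌋
    lem : ∀ p → suc p + suc (suc p) * 2 ≡ 3 * p + 5
    lem = solve-∀

  -- `P` stands for the allowed size of Δ log n. The last numerical hypothesis leaves at least
  -- `N * j` vertices for `I` after `k` have gone to `L`.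
  finite-copy : ∀ {m n} (Tr : OrientedTree m) (D : Digraph n) (t : Fin m) a δ P k .{{_ : NonZero a}} → Rich a D → a * m ≤ n →
    2 ≤ m → 2 ≤ n → (∀ w → length (nbrs (digraph Tr) w) ≤ suc δ) → suc δ * ⌊log₂ n ⌋ ≤ P →
    fiftyFour * (k + 2 * (2 * a) ^ 3 * (9 * P + k)) + fiftyFour ≤ m →
    Σ (Subset n) λ A → Σ (Fin n) λ v → ∣ A ∣ + k ≡ m × v ∈ₛ A × (∀ B → A ⊆ₛ B → m ≤ ∣ B ∣ → CopyIn Tr D B t v)
  finite-copy {m} {n} Tr D t a δ P k rich am≤n 2≤m 2≤n deg≤ ΔL≤P large
    with exists-absorber Tr t k 2≤m (≤-trans (+-monoˡ-≤ fiftyFour (*-monoʳ-≤ fiftyFour (m≤m+n k _))) large)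
  ... | κ , κ≤2 , 𝒜 , refl , m≤ = Robust.robust-copy Tr D 𝒜 a δ l j rich am≤n (≤-trans (s≤s z≤n) 2≤n) deg≤ I-large
          (requirements-bound n κ l (≤-trans (s≤s z≤n) 2≤n) κ≤2) k≤Δl
    where
    open ≤-Reasoning
    p = ⌊log₂ n ⌋
    Δ = suc δ
    -- Rounded up, so that Δ * l hits suffice for all `k` vertices of `L`.
    l = suc (k / Δ)
    j = 3 * p + 5 + l
    E = (2 * a) ^ 3
    1≤p : 1 ≤ p
    1≤p = 1≤log 2≤n
    k≤Δl : k ≤ Δ * l
    k≤Δl = begin
      k                     ≡⟨ m≡m%n+[m/n]*n k Δ ⟩
      k % Δ + (k / Δ) * Δ   ≤⟨ +-monoˡ-≤ ((k / Δ) * Δ) (<⇒≤ (m%n<n k Δ)) ⟩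
      Δ + (k / Δ) * Δ       ≡⟨ *-comm Δ l ⟨
      Δ * l                 ∎
    -- As log n ≥ 1, the additive constant 5 + 1 costs at most 6Δ log n.
    Δj≤ : Δ * j ≤ 9 * P + k
    Δj≤ = begin
      Δ * (3 * p + 5 + suc (k / Δ))            ≡⟨ lem₁ Δ p (k / Δ) ⟩
      3 * (Δ * p) + 6 * (Δ * 1) + (k / Δ) * Δ  ≤⟨ +-mono-≤ (+-monoʳ-≤ (3 * (Δ * p)) (*-monoʳ-≤ 6 (*-monoʳ-≤ Δ 1≤p))) (m/n*n≤m k Δ) ⟩
      3 * (Δ * p) + 6 * (Δ * p) + k            ≡⟨ cong (_+ k) (lem₂ (Δ * p)) ⟩
      9 * (Δ * p) + k                          ≤⟨ +-monoˡ-≤ k (*-monoʳ-≤ 9 ΔL≤P) ⟩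
      9 * P + k                                ∎
      where
      lem₁ : ∀ x p q → x * (3 * p + 5 + suc q) ≡ 3 * (x * p) + 6 * (x * 1) + q * x
      lem₁ = solve-∀
      lem₂ : ∀ x → 3 * x + 6 * x ≡ 9 * x
      lem₂ = solve-∀
    I-large : (Δ + Δ) * (2 * a) ^ suc κ * j ≤ length (Absorber.I 𝒜)
    I-large = fiftyFour-cancel (+-cancelˡ-≤ (fiftyFour * k) _ _ (begin
      fiftyFour * k + (fiftyFour * ((Δ + Δ) * (2 * a) ^ suc κ * j) + fiftyFour)
        ≤⟨ +-monoʳ-≤ (fiftyFour * k) (+-monoˡ-≤ fiftyFour (*-monoʳ-≤ fiftyFour (*-monoˡ-≤ j (*-monoʳ-≤ (Δ + Δ) (^-monoʳ-≤ (2 * a) ⦃ m*n≢0 2 a ⦄ (s≤s κ≤2)))))) ⟩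
      fiftyFour * k + (fiftyFour * ((Δ + Δ) * E * j) + fiftyFour)      ≡⟨ lem₃ fiftyFour k Δ E j ⟩
      fiftyFour * (k + 2 * E * (Δ * j)) + fiftyFour             ≤⟨ +-monoˡ-≤ fiftyFour (*-monoʳ-≤ fiftyFour (+-monoʳ-≤ k (*-monoʳ-≤ (2 * E) Δj≤))) ⟩
      fiftyFour * (k + 2 * E * (9 * P + k)) + fiftyFour         ≤⟨ large ⟩
      m                                           ≤⟨ m≤ ⟩
      fiftyFour * (k + length (Absorber.I 𝒜)) + fiftyFour      ≡⟨ lem₄ fiftyFour k (length (Absorber.I 𝒜)) ⟩
      fiftyFour * k + (fiftyFour * length (Absorber.I 𝒜) + fiftyFour) ∎))
      where
      lem₃ : ∀ c k x E j → c * k + (c * ((x + x) * E * j) + c) ≡ c * (k + 2 * E * (x * j)) + c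
      lem₃ = solve-∀
      lem₄ : ∀ c k i → c * (k + i) + c ≡ c * k + (c * i + c)
      lem₄ = solve-∀

  -- All semidegrees are at least (1/2 + 1/a)n, so two neighbourhoods share at least 2n/a vertices
  -- by inclusion and exclusion.
  finite-rich : ∀ {n} (D : Digraph n) a → 2 ≤ a → (∀ v → (a + 2) * n ≤ 2 * a * outdeg D v × (a + 2) * n ≤ 2 * a * indeg D v) → Rich a D
  finite-rich {n} D a 2≤a deg = rich
    where
    open ≤-Reasoning
    size : (Fin n → Bool) → ℕ
    size p = length (filterᵇ p (allFin n))
    deg′ : ∀ s y → (a + 2) * n ≤ 2 * a * size (adjS D s y)
    deg′ true  y = ≤-trans (proj₁ (deg y)) (≤-reflexive (cong (2 * a *_) (count≡length (λ w → arc D y w))))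
    deg′ false y = ≤-trans (proj₂ (deg y)) (≤-reflexive (cong (2 * a *_) (count≡length (λ w → arc D w y))))
    lem : ∀ a x → 2 * (a * x) ≡ 2 * a * x
    lem = solve-∀
    rich : Rich a D
    rich [] _ = ≤-trans (*-monoˡ-≤ n 2≤a) (*-monoʳ-≤ a (≤-reflexive (sym (trans
      (length-filterᵇ-true (sat D []) (allFin n) (λ _ → tt)) (length-tabulate {n = n} id)))))
    rich ((s , y) ∷ []) _ = *-cancelˡ-≤ 2 (begin
      2 * (2 * n)                ≤⟨ *-monoʳ-≤ 2 (m≤m+n (2 * n) 0) ⟩
      2 * (2 * n + 0)            ≡⟨ lem₁ n ⟩
      (2 + 2) * n                ≤⟨ *-monoˡ-≤ n (+-monoˡ-≤ 2 2≤a) ⟩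
      (a + 2) * n                ≤⟨ deg′ s y ⟩
      2 * a * size (adjS D s y)  ≡⟨ lem a _ ⟨
      2 * (a * size (adjS D s y)) ≤⟨ *-monoʳ-≤ 2 (*-monoʳ-≤ a (length-⊆ (filter⁺ _ (allFin⁺ n)) sub)) ⟩
      2 * (a * size (sat D ((s , y) ∷ []))) ∎)
      where
      lem₁ : ∀ n → 2 * (2 * n + 0) ≡ (2 + 2) * n
      lem₁ = solve-∀
      sub : ∀ {v} → v ∈ filterᵇ (adjS D s y) (allFin n) → v ∈ filterᵇ (sat D ((s , y) ∷ [])) (allFin n)
      sub {v} v∈ = ∈-filterᵇ⁺ (∈-allFin v) (Equivalence.from T-∧ (proj₂ (∈-filterᵇ⁻ (allFin n) v∈) , tt))
    rich ((s , y) ∷ (s′ , y′) ∷ []) _ = *-cancelˡ-≤ 2 (+-cancelˡ-≤ (2 * a * n) _ _ (begin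
      2 * a * n + 2 * (2 * n)                        ≡⟨ lem₂ a n ⟩
      (a + 2) * n + (a + 2) * n                      ≤⟨ +-mono-≤ (deg′ s y) (deg′ s′ y′) ⟩
      2 * a * p + 2 * a * q                          ≡⟨ *-distribˡ-+ (2 * a) p q ⟨
      2 * a * (p + q)                                ≤⟨ *-monoʳ-≤ (2 * a) (length-filterᵇ-∧ (adjS D s y) (adjS D s′ y′) (allFin n)) ⟩
      2 * a * (length (allFin n) + r)                ≡⟨ cong (λ z → 2 * a * (z + r)) (length-tabulate {n = n} id) ⟩
      2 * a * (n + r)                                ≡⟨ lem₃ a n r ⟩
      2 * a * n + 2 * (a * r)                        ≤⟨ +-monoʳ-≤ (2 * a * n) (*-monoʳ-≤ 2 (*-monoʳ-≤ a (length-⊆ (filter⁺ _ (allFin⁺ n)) sub))) ⟩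
      2 * a * n + 2 * (a * size (sat D ((s , y) ∷ (s′ , y′) ∷ []))) ∎))
      where
      p = size (adjS D s y)
      q = size (adjS D s′ y′)
      r = size (λ v → adjS D s y v ∧ adjS D s′ y′ v)
      lem₂ : ∀ a n → 2 * a * n + 2 * (2 * n) ≡ (a + 2) * n + (a + 2) * n
      lem₂ = solve-∀
      lem₃ : ∀ a n r → 2 * a * (n + r) ≡ 2 * a * n + 2 * (a * r)
      lem₃ = solve-∀
      sub : ∀ {v} → v ∈ filterᵇ (λ v → adjS D s y v ∧ adjS D s′ y′ v) (allFin n) → v ∈ filterᵇ (sat D ((s , y) ∷ (s′ , y′) ∷ [])) (allFin n)
      sub {v} v∈ with Equivalence.to (T-∧ {adjS D s y v}) (proj₂ (∈-filterᵇ⁻ (allFin n) v∈))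
      ... | h , h′ = ∈-filterᵇ⁺ (∈-allFin v) (Equivalence.from T-∧ (h , Equivalence.from T-∧ (h′ , tt)))
    rich (_ ∷ _ ∷ _ ∷ _) (s≤s (s≤s ()))

-- Natural numbers, floors and unit fractions among the rationals

module Rationals where
  open import Defs using (toℚ)
  open import Data.Nat as ℕ using (ℕ; suc; zero)
  import Data.Nat.Properties as ℕₚ
  open import Data.Integer as ℤ using (ℤ; +_; +≤+)
  import Data.Integer.Properties as ℤₚ
  import Data.Integer.DivMod as ℤD
  open import Data.Rational
  open import Data.Rational.Properties
  import Data.Rational.Unnormalised as ℚᵘ
  import Data.Rational.Unnormalised.Properties as ℚᵘₚ
  open import Data.Rational.Literals using (fromℤ)
  open import Data.Product using (Σ; ∃; _×_; _,_)
  open import Relation.Binary.PropositionalEquality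

  -- `fromℤ` has denominator 1 by definition, while `toℚ` normalises a fraction; through `fromℤ`
  -- comparisons reduce to integers.
  toℚ≡fromℤ : ∀ n → toℚ n ≡ fromℤ (+ n)
  toℚ≡fromℤ n = ↥p/↧p≡p (fromℤ (+ n))

  fromℤ-mono-≤ : ∀ {x y} → x ℤ.≤ y → fromℤ x ≤ fromℤ y
  fromℤ-mono-≤ h = *≤* (ℤₚ.*-monoʳ-≤-nonNeg (+ 1) h)

  fromℤ-cancel-≤ : ∀ {x y} → fromℤ x ≤ fromℤ y → x ℤ.≤ y
  fromℤ-cancel-≤ {x} {y} (*≤* h) = subst₂ ℤ._≤_ (ℤₚ.*-identityʳ x) (ℤₚ.*-identityʳ y) h

  fromℤ-cancel-< : ∀ {x y} → fromℤ x < fromℤ y → x ℤ.< y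
  fromℤ-cancel-< {x} {y} (*<* h) = subst₂ ℤ._<_ (ℤₚ.*-identityʳ x) (ℤₚ.*-identityʳ y) h

  fromℤ-homo-+ : ∀ x y → fromℤ (x ℤ.+ y) ≡ fromℤ x + fromℤ y
  fromℤ-homo-+ x y = toℚᵘ-injective (ℚᵘₚ.≃-trans (ℚᵘ.*≡* eq) (ℚᵘₚ.≃-sym (toℚᵘ-homo-+ (fromℤ x) (fromℤ y))))
    where
    eq : (x ℤ.+ y) ℤ.* + 1 ≡ (x ℤ.* + 1 ℤ.+ y ℤ.* + 1) ℤ.* + 1
    eq = cong (ℤ._* + 1) (sym (cong₂ ℤ._+_ (ℤₚ.*-identityʳ x) (ℤₚ.*-identityʳ y)))

  fromℤ-homo-* : ∀ x y → fromℤ (x ℤ.* y) ≡ fromℤ x * fromℤ y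
  fromℤ-homo-* x y = toℚᵘ-injective (ℚᵘₚ.≃-sym (toℚᵘ-homo-* (fromℤ x) (fromℤ y)))

  toℚ-mono-≤ : ∀ {m n} → m ℕ.≤ n → toℚ m ≤ toℚ n
  toℚ-mono-≤ {m} {n} h = subst₂ _≤_ (sym (toℚ≡fromℤ m)) (sym (toℚ≡fromℤ n)) (fromℤ-mono-≤ (+≤+ h))

  toℚ-cancel-≤ : ∀ {m n} → toℚ m ≤ toℚ n → m ℕ.≤ n
  toℚ-cancel-≤ {m} {n} h = ℤₚ.drop‿+≤+ (fromℤ-cancel-≤ (subst₂ _≤_ (toℚ≡fromℤ m) (toℚ≡fromℤ n) h))

  toℚ-homo-+ : ∀ m n → toℚ (m ℕ.+ n) ≡ toℚ m + toℚ n
  toℚ-homo-+ m n = trans (toℚ≡fromℤ (m ℕ.+ n)) (trans (fromℤ-homo-+ (+ m) (+ n)) (cong₂ _+_ (sym (toℚ≡fromℤ m)) (sym (toℚ≡fromℤ n))))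

  toℚ-homo-* : ∀ m n → toℚ (m ℕ.* n) ≡ toℚ m * toℚ n
  toℚ-homo-* m n = trans (toℚ≡fromℤ (m ℕ.* n)) (trans (cong fromℤ (ℤₚ.pos-* m n)) (trans (fromℤ-homo-* (+ m) (+ n)) (cong₂ _*_ (sym (toℚ≡fromℤ m)) (sym (toℚ≡fromℤ n)))))

  0≤toℚ : ∀ n → 0ℚ ≤ toℚ n
  0≤toℚ n = toℚ-mono-≤ {0} {n} ℕ.z≤n

  floor-≤ : ∀ p → fromℤ (floor p) ≤ p
  floor-≤ p@(mkℚ n d _) = *≤* (ℤₚ.≤-trans (ℤD.[n/d]*d≤n n (+ suc d)) (ℤₚ.≤-reflexive (sym (ℤₚ.*-identityʳ n))))

  <-floor : ∀ p → p < fromℤ (ℤ.suc (floor p))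
  <-floor p@(mkℚ n d _) = *<* (subst₂ ℤ._<_ (sym (ℤₚ.*-identityʳ n)) (cong (λ z → ℤ.suc z ℤ.* + suc d) (sym (ℤD.div-pos-is-/ℕ n (suc d)))) (ℤD.n<s[n/ℕd]*d n (suc d)))

  ≤-floor : ∀ {z p} → fromℤ z ≤ p → z ℤ.≤ floor p
  ≤-floor {z} {p} h = ℤₚ.≤-trans (ℤₚ.i<j⇒i≤pred[j] (fromℤ-cancel-< (≤-<-trans h (<-floor p)))) (ℤₚ.≤-reflexive (ℤₚ.pred-suc (floor p)))

  toℚ-≤-floor : ∀ {m p} → + m ≡ floor p → toℚ m ≤ p
  toℚ-≤-floor {m} {p} eq = subst (_≤ p) (trans (cong fromℤ (sym eq)) (sym (toℚ≡fromℤ m))) (floor-≤ p)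

  <-toℚ-floor : ∀ {m p} → + m ≡ floor p → p < toℚ (suc m)
  <-toℚ-floor {m} {p} eq = subst (p <_) (trans (cong (fromℤ ∘′ ℤ.suc) (sym eq)) (sym (toℚ≡fromℤ (suc m)))) (<-floor p)
    where
    open import Function using (_∘′_)

  floor-nonNeg : ∀ {p} → 0ℚ ≤ p → ∃ λ s → + s ≡ floor p
  floor-nonNeg {p} h with floor p | ≤-floor {+ 0} {p} h
  ... | + s | _ = s , refl

  *-monoˡ : ∀ {r p q} → 0ℚ ≤ r → p ≤ q → r * p ≤ r * q
  *-monoˡ {r} 0≤r p≤q = *-monoˡ-≤-nonNeg r ⦃ nonNegative 0≤r ⦄ p≤q

  *-monoʳ : ∀ {r p q} → 0ℚ ≤ r → p ≤ q → p * r ≤ q * r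
  *-monoʳ {r} 0≤r p≤q = *-monoʳ-≤-nonNeg r ⦃ nonNegative 0≤r ⦄ p≤q

  unit-fraction : ∀ X .⦃ _ : ℕ.NonZero X ⦄ → toℚ X * (+ 1 / X) ≡ 1ℚ
  unit-fraction (suc x) = trans (cong (_* (+ 1 / suc x)) (toℚ≡fromℤ (suc x))) (toℚᵘ-injective
    (ℚᵘₚ.≃-trans (toℚᵘ-homo-* (fromℤ (+ suc x)) (+ 1 / suc x))
    (ℚᵘₚ.≃-trans (ℚᵘₚ.*-congˡ {ℚᵘ.mkℚᵘ (+ suc x) 0} (toℚᵘ-fromℚᵘ (ℚᵘ.mkℚᵘ (+ 1) x)))
      (ℚᵘ.*≡* (trans (ℤₚ.*-identityʳ (+ suc x ℤ.* + 1)) (trans (ℤₚ.*-comm (+ suc x) (+ 1)) (cong (λ z → + 1 ℤ.* + z) (sym (ℕₚ.*-identityˡ (suc x))))))))))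

  unit-fraction-positive : ∀ X .⦃ _ : ℕ.NonZero X ⦄ → 0ℚ < + 1 / X
  unit-fraction-positive (suc x) = positive⁻¹ (+ 1 / suc x) ⦃ normalize-pos 1 (suc x) ⦄

  ≤-unit-fraction : ∀ X .⦃ _ : ℕ.NonZero X ⦄ {p} → p ≤ + 1 / X → toℚ X * p ≤ 1ℚ
  ≤-unit-fraction X h = ≤-trans (*-monoˡ (0≤toℚ X) h) (≤-reflexive (unit-fraction X))

  -- The denominator of `p` works, since the product is the numerator, which is at least 1.
  archimedes : ∀ {p} → 0ℚ < p → ∃ λ d → 1ℚ ≤ toℚ (suc d) * p
  archimedes {p@(mkℚ n d c)} 0<p = d , ≤-trans (toℚ-mono-≤ {1} {ℤ.∣ n ∣} one≤) (≤-reflexive (sym eq))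
    where
    n≡ : + ℤ.∣ n ∣ ≡ n
    n≡ = ℤₚ.0≤i⇒+∣i∣≡i (ℤₚ.<⇒≤ (ℤ-pos 0<p))
      where
      ℤ-pos : 0ℚ < p → ℤ.0ℤ ℤ.< n
      ℤ-pos (*<* h) = subst (ℤ.0ℤ ℤ.<_) (ℤₚ.*-identityʳ n) h
    one≤ : 1 ℕ.≤ ℤ.∣ n ∣
    one≤ = ℕₚ.n≢0⇒n>0 (λ eq → <⇒≢ 0<p (sym (trans (sym (↥p/↧p≡p p)) (trans (cong (λ z → z / suc d) (trans (sym n≡) (cong +_ eq))) (0/n≡0 (suc d))))))
    eq : toℚ (suc d) * p ≡ toℚ ℤ.∣ n ∣
    eq = trans (cong (_* p) (toℚ≡fromℤ (suc d))) (trans (toℚᵘ-injective (ℚᵘₚ.≃-trans (toℚᵘ-homo-* (fromℤ (+ suc d)) p)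
      (ℚᵘ.*≡* (trans (ℤₚ.*-identityʳ (+ suc d ℤ.* n)) (trans (ℤₚ.*-comm (+ suc d) n) (cong (λ z → n ℤ.* + z) (sym (ℕₚ.*-identityˡ (suc d)))))))))
      (trans (cong fromℤ (sym n≡)) (sym (toℚ≡fromℤ ℤ.∣ n ∣))))

-- Choice of constants

module Assembly where
  open Combinatorics using (nbrs; Rich; finite-rich; finite-copy; count≡length; 1≤log; fiftyFour; fiftyFour≡; module Tree)
  open Rationals
  open import Defs
  open import Data.Nat as ℕ using (ℕ; suc; zero; _≥_; NonZero; s≤s; z≤n; _∸_; _^_)
  import Data.Nat.Properties as ℕₚ
  import Data.Nat.DivMod as ℕD
  open import Data.Nat.Tactic.RingSolver using (solve-∀)
  open import Data.Nat.Logarithm using (⌊log₂_⌋)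
  open import Data.Integer as ℤ using (+_)
  import Data.Integer.Properties as ℤₚ
  open import Data.Fin using (Fin)
  open import Data.Fin.Subset using (Subset; ∣_∣) renaming (_∈_ to _∈ₛ_; _⊆_ to _⊆ₛ_)
  open import Data.List using (length)
  open import Data.Product using (Σ; ∃; _×_; _,_; proj₁; proj₂)
  open import Data.Rational as ℚ using (ℚ; 0ℚ; 1ℚ; ½; _<_; _≤_; _+_; _-_; _*_; -_; floor)
  import Data.Rational.Properties as ℚₚ
  open import Data.Rational.Solver using (module +-*-Solver)
  open +-*-Solver using (solve; _:+_; _:*_; _:-_; _:=_)
  open import Relation.Binary.PropositionalEquality

  -- Times 2X, the left side plus 2X is at most 326n + 2376En, which is below 2 * 2700En = 2Kn, and
  -- 2Kn is at most 2X(m + 1). The added 2X pays for the rounding of `m`.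
  final-arith : ∀ E q n m k P X K → K ≡ 2700 ℕ.* E → X ≡ K ℕ.* q → 1 ℕ.≤ E → NonZero X →
    X ℕ.≤ n → X ℕ.* k ℕ.≤ X ℕ.+ n → X ℕ.* P ℕ.≤ n → n ℕ.≤ q ℕ.* suc m →
    54 ℕ.* (k ℕ.+ 2 ℕ.* E ℕ.* (9 ℕ.* P ℕ.+ k)) ℕ.+ 54 ℕ.≤ m
  final-arith E q n m k P X K K≡ X≡ 1≤E X≢0 X≤n Xk≤ XP≤n n≤ =
    ℕₚ.*-cancelˡ-≤ (2 ℕ.* X) ⦃ ℕₚ.m*n≢0 2 X ⦃ _ ⦄ ⦃ X≢0 ⦄ ⦄ (ℕₚ.+-cancelʳ-≤ (2 ℕ.* (X ℕ.* 1))
      (2 ℕ.* X ℕ.* (54 ℕ.* (k ℕ.+ 2 ℕ.* E ℕ.* (9 ℕ.* P ℕ.+ k)) ℕ.+ 54)) (2 ℕ.* X ℕ.* m) (begin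
    2 ℕ.* X ℕ.* (54 ℕ.* (k ℕ.+ 2 ℕ.* E ℕ.* (9 ℕ.* P ℕ.+ k)) ℕ.+ 54) ℕ.+ 2 ℕ.* (X ℕ.* 1)
      ≡⟨ lem₁ X k E P ⟩
    110 ℕ.* X ℕ.+ 108 ℕ.* (X ℕ.* k) ℕ.+ 216 ℕ.* (E ℕ.* (9 ℕ.* (X ℕ.* P) ℕ.+ X ℕ.* k))
      ≤⟨ ℕₚ.+-mono-≤ (ℕₚ.+-mono-≤ (ℕₚ.*-monoʳ-≤ 110 X≤n) (ℕₚ.*-monoʳ-≤ 108 Xk≤2n))
          (ℕₚ.*-monoʳ-≤ 216 (ℕₚ.*-monoʳ-≤ E (ℕₚ.+-mono-≤ (ℕₚ.*-monoʳ-≤ 9 XP≤n) Xk≤2n))) ⟩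
    110 ℕ.* n ℕ.+ 108 ℕ.* (n ℕ.+ n) ℕ.+ 216 ℕ.* (E ℕ.* (9 ℕ.* n ℕ.+ (n ℕ.+ n)))
      ≡⟨ lem₂ n E ⟩
    326 ℕ.* (1 ℕ.* n) ℕ.+ 2376 ℕ.* (E ℕ.* n)
      ≤⟨ ℕₚ.+-mono-≤ (ℕₚ.*-monoʳ-≤ 326 (ℕₚ.*-monoˡ-≤ n 1≤E)) (ℕₚ.m≤m+n (2376 ℕ.* (E ℕ.* n)) (2698 ℕ.* (E ℕ.* n))) ⟩
    326 ℕ.* (E ℕ.* n) ℕ.+ (2376 ℕ.* (E ℕ.* n) ℕ.+ 2698 ℕ.* (E ℕ.* n))
      ≡⟨ lem₄ (E ℕ.* n) ⟩
    2 ℕ.* (2700 ℕ.* (E ℕ.* n))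
      ≡⟨ cong (2 ℕ.*_) (sym (trans (cong (ℕ._* n) K≡) (ℕₚ.*-assoc 2700 E n))) ⟩
    2 ℕ.* (K ℕ.* n)
      ≤⟨ ℕₚ.*-monoʳ-≤ 2 (ℕₚ.*-monoʳ-≤ K n≤) ⟩
    2 ℕ.* (K ℕ.* (q ℕ.* suc m))
      ≡⟨ lem₅ K q m ⟩
    2 ℕ.* (K ℕ.* q) ℕ.* m ℕ.+ 2 ℕ.* (K ℕ.* q ℕ.* 1)
      ≡⟨ cong (λ z → 2 ℕ.* z ℕ.* m ℕ.+ 2 ℕ.* (z ℕ.* 1)) X≡ ⟨
    2 ℕ.* X ℕ.* m ℕ.+ 2 ℕ.* (X ℕ.* 1) ∎))
    where
    open ℕₚ.≤-Reasoning
    Xk≤2n : X ℕ.* k ℕ.≤ n ℕ.+ n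
    Xk≤2n = ℕₚ.≤-trans Xk≤ (ℕₚ.+-monoˡ-≤ n X≤n)
    lem₁ : ∀ X k E P → 2 ℕ.* X ℕ.* (54 ℕ.* (k ℕ.+ 2 ℕ.* E ℕ.* (9 ℕ.* P ℕ.+ k)) ℕ.+ 54) ℕ.+ 2 ℕ.* (X ℕ.* 1)
      ≡ 110 ℕ.* X ℕ.+ 108 ℕ.* (X ℕ.* k) ℕ.+ 216 ℕ.* (E ℕ.* (9 ℕ.* (X ℕ.* P) ℕ.+ X ℕ.* k))
    lem₁ = solve-∀
    lem₂ : ∀ n E → 110 ℕ.* n ℕ.+ 108 ℕ.* (n ℕ.+ n) ℕ.+ 216 ℕ.* (E ℕ.* (9 ℕ.* n ℕ.+ (n ℕ.+ n))) ≡ 326 ℕ.* (1 ℕ.* n) ℕ.+ 2376 ℕ.* (E ℕ.* n)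
    lem₂ = solve-∀
    lem₄ : ∀ x → 326 ℕ.* x ℕ.+ (2376 ℕ.* x ℕ.+ 2698 ℕ.* x) ≡ 2 ℕ.* (2700 ℕ.* x)
    lem₄ = solve-∀
    lem₅ : ∀ K q m → 2 ℕ.* (K ℕ.* (q ℕ.* suc m)) ≡ 2 ℕ.* (K ℕ.* q) ℕ.* m ℕ.+ 2 ℕ.* (K ℕ.* q ℕ.* 1)
    lem₅ = solve-∀

  abstract
    scale : ℕ → ℕ
    scale E = 2700 ℕ.* E

    scale≢0 : ∀ E .⦃ _ : NonZero E ⦄ → NonZero (scale E)
    scale≢0 E = ℕₚ.m*n≢0 2700 E

    2≤scale : ∀ E .⦃ _ : NonZero E ⦄ → 2 ℕ.≤ scale E
    2≤scale E = ℕₚ.≤-trans (s≤s (s≤s z≤n)) (ℕₚ.m≤m*n 2700 E)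

    2≤-from-fiftyFour : ∀ {x m} → x ℕ.+ fiftyFour ℕ.≤ m → 2 ℕ.≤ m
    2≤-from-fiftyFour {x} h = ℕₚ.≤-trans (s≤s (s≤s z≤n)) (ℕₚ.≤-trans (ℕₚ.≤-reflexive (sym fiftyFour≡)) (ℕₚ.≤-trans (ℕₚ.m≤n+m fiftyFour x) h))

    final-bound : ∀ E q n m k P X → X ≡ scale E ℕ.* q → 1 ℕ.≤ E → NonZero X →
      X ℕ.≤ n → X ℕ.* k ℕ.≤ X ℕ.+ n → X ℕ.* P ℕ.≤ n → n ℕ.≤ q ℕ.* suc m →
      fiftyFour ℕ.* (k ℕ.+ 2 ℕ.* E ℕ.* (9 ℕ.* P ℕ.+ k)) ℕ.+ fiftyFour ℕ.≤ m
    final-bound E q n m k P X X≡ 1≤E X≢0 X≤n Xk≤ XP≤n n≤ =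
      subst (λ c → c ℕ.* (k ℕ.+ 2 ℕ.* E ℕ.* (9 ℕ.* P ℕ.+ k)) ℕ.+ c ℕ.≤ m) (sym fiftyFour≡)
        (final-arith E q n m k P X (scale E) refl X≡ 1≤E X≢0 X≤n Xk≤ XP≤n n≤)

  module _ {a : ℕ} {α : ℚ} (1≤aα : 1ℚ ≤ toℚ a * α) where
    -- Multiplication by 2a turns 1/2 + α into a + 2aα, which is at least a + 2.
    degree-bound : ∀ {n y} → (½ + α) * toℚ n ≤ toℚ y → (a ℕ.+ 2) ℕ.* n ℕ.≤ 2 ℕ.* a ℕ.* y
    degree-bound {n} {y} h = toℚ-cancel-≤ (begin
      toℚ ((a ℕ.+ 2) ℕ.* n)                         ≡⟨ trans (toℚ-homo-* (a ℕ.+ 2) n) (cong (_* toℚ n) (toℚ-homo-+ a 2)) ⟩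
      (toℚ a + (1ℚ + 1ℚ)) * toℚ n                   ≤⟨ *-monoʳ (0≤toℚ n) (ℚₚ.+-monoʳ-≤ (toℚ a) (ℚₚ.+-mono-≤ 1≤aα 1≤aα)) ⟩
      (toℚ a + (toℚ a * α + toℚ a * α)) * toℚ n     ≡⟨ cong (λ z → (z + (toℚ a * α + toℚ a * α)) * toℚ n) (ℚₚ.*-identityʳ (toℚ a)) ⟨
      (toℚ a * (½ + ½) + (toℚ a * α + toℚ a * α)) * toℚ n ≡⟨ ring ½ α (toℚ a) (toℚ n) ⟩
      toℚ a * ((½ + α) * toℚ n) + toℚ a * ((½ + α) * toℚ n) ≤⟨ ℚₚ.+-mono-≤ (*-monoˡ (0≤toℚ a) h) (*-monoˡ (0≤toℚ a) h) ⟩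
      toℚ a * toℚ y + toℚ a * toℚ y                 ≡⟨ cong₂ _+_ (toℚ-homo-* a y) (toℚ-homo-* a y) ⟨
      toℚ (a ℕ.* y) + toℚ (a ℕ.* y)                 ≡⟨ toℚ-homo-+ (a ℕ.* y) (a ℕ.* y) ⟨
      toℚ (a ℕ.* y ℕ.+ a ℕ.* y)                     ≡⟨ cong toℚ (lem a y) ⟩
      toℚ (2 ℕ.* a ℕ.* y)                           ∎)
      where
      open ℚₚ.≤-Reasoning
      ring : ∀ h α A x → (A * (h + h) + (A * α + A * α)) * x ≡ A * ((h + α) * x) + A * ((h + α) * x)
      ring = solve 4 (λ h α A x → (A :* (h :+ h) :+ (A :* α :+ A :* α)) :* x := A :* ((h :+ α) :* x) :+ A :* ((h :+ α) :* x)) refl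
      lem : ∀ a y → a ℕ.* y ℕ.+ a ℕ.* y ≡ 2 ℕ.* a ℕ.* y
      lem = solve-∀

  toℚ-positive : ∀ X .⦃ _ : NonZero X ⦄ → ℚ.Positive (toℚ X)
  toℚ-positive (suc X) = ℚₚ.normalize-pos (suc X) 1

  scaled-≤ : ∀ X {p x y} → toℚ X * p ≤ 1ℚ → toℚ y ≤ p * toℚ x → X ℕ.* y ℕ.≤ x
  scaled-≤ X {p} {x} {y} Xp≤1 h = toℚ-cancel-≤ (begin
    toℚ (X ℕ.* y)        ≡⟨ toℚ-homo-* X y ⟩
    toℚ X * toℚ y        ≤⟨ *-monoˡ (0≤toℚ X) h ⟩
    toℚ X * (p * toℚ x)  ≡⟨ ℚₚ.*-assoc (toℚ X) p (toℚ x) ⟨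
    toℚ X * p * toℚ x    ≤⟨ *-monoʳ (0≤toℚ x) Xp≤1 ⟩
    1ℚ * toℚ x           ≡⟨ ℚₚ.*-identityˡ (toℚ x) ⟩
    toℚ x                ∎)
    where open ℚₚ.≤-Reasoning

  ≤-scaled : ∀ q {p x y} → 1ℚ ≤ toℚ q * p → p * toℚ x ≤ toℚ y → x ℕ.≤ q ℕ.* y
  ≤-scaled q {p} {x} {y} 1≤qp h = toℚ-cancel-≤ (begin
    toℚ x                ≡⟨ ℚₚ.*-identityˡ (toℚ x) ⟨
    1ℚ * toℚ x           ≤⟨ *-monoʳ (0≤toℚ x) 1≤qp ⟩
    toℚ q * p * toℚ x    ≡⟨ ℚₚ.*-assoc (toℚ q) p (toℚ x) ⟩
    toℚ q * (p * toℚ x)  ≤⟨ *-monoˡ (0≤toℚ q) h ⟩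
    toℚ q * toℚ y        ≡⟨ toℚ-homo-* q y ⟨
    toℚ (q ℕ.* y)        ∎)
    where open ℚₚ.≤-Reasoning

  module _ {μ ε : ℚ} {X : ℕ} .⦃ _ : NonZero X ⦄ (Xε≤1 : toℚ X * ε ≤ 1ℚ) (1≤Xμ : 1ℚ ≤ toℚ X * μ) (0≤ε : 0ℚ ≤ ε) where

    ε≤μ : ε ≤ μ
    ε≤μ = ℚₚ.*-cancelˡ-≤-pos (toℚ X) ⦃ toℚ-positive X ⦄ (ℚₚ.≤-trans Xε≤1 1≤Xμ)

    0≤μ-ε : 0ℚ ≤ μ - ε
    0≤μ-ε = ℚₚ.≤-trans (ℚₚ.≤-reflexive (sym (ℚₚ.+-inverseʳ ε))) (ℚₚ.+-monoˡ-≤ (- ε) ε≤μ)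

    -- Since μn = (μ - ε)n + εn with εn ≤ n/X, the rounding of `s` adds less than 1 to the
    -- difference.
    floor-gap : ∀ {n m s} → + m ≡ floor (μ * toℚ n) → + s ≡ floor ((μ - ε) * toℚ n) → s ℕ.≤ m × X ℕ.* (m ∸ s) ℕ.≤ X ℕ.+ n
    floor-gap {n} {m} {s} m≡ s≡ = s≤m , (ℕₚ.+-cancelʳ-≤ (X ℕ.* s) _ _ (NR.begin
        X ℕ.* (m ∸ s) ℕ.+ X ℕ.* s  NR.≡⟨ ℕₚ.*-distribˡ-+ X (m ∸ s) s ⟨
        X ℕ.* (m ∸ s ℕ.+ s)        NR.≡⟨ cong (X ℕ.*_) (ℕₚ.m∸n+n≡m s≤m) ⟩
        X ℕ.* m                    NR.≤⟨ Xm≤ ⟩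
        X ℕ.* suc s ℕ.+ n          NR.≡⟨ lem X s n ⟩
        X ℕ.+ n ℕ.+ X ℕ.* s        NR.∎))
      where
      module NR = ℕₚ.≤-Reasoning
      lem : ∀ X s n → X ℕ.* suc s ℕ.+ n ≡ X ℕ.+ n ℕ.+ X ℕ.* s
      lem = solve-∀
      x = toℚ n
      s≤m : s ℕ.≤ m
      s≤m = ℤₚ.drop‿+≤+ (subst (+ s ℤ.≤_) (sym m≡) (≤-floor (ℚₚ.≤-trans
        (ℚₚ.≤-trans (ℚₚ.≤-reflexive (sym (toℚ≡fromℤ s))) (toℚ-≤-floor s≡))
        (*-monoʳ (0≤toℚ n) (ℚₚ.≤-trans (ℚₚ.+-monoʳ-≤ μ (ℚₚ.neg-antimono-≤ 0≤ε)) (ℚₚ.≤-reflexive (ℚₚ.+-identityʳ μ)))))))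
      ring : ∀ X μ ε x → X * (μ * x) ≡ X * ((μ - ε) * x) + X * ε * x
      ring = solve 4 (λ X μ ε x → X :* (μ :* x) := X :* ((μ :- ε) :* x) :+ X :* ε :* x) refl
      Xm≤ : X ℕ.* m ℕ.≤ X ℕ.* suc s ℕ.+ n
      Xm≤ = toℚ-cancel-≤ (begin
        toℚ (X ℕ.* m)                              ≡⟨ toℚ-homo-* X m ⟩
        toℚ X * toℚ m                              ≤⟨ *-monoˡ (0≤toℚ X) (toℚ-≤-floor m≡) ⟩
        toℚ X * (μ * x)                            ≡⟨ ring (toℚ X) μ ε x ⟩
        toℚ X * ((μ - ε) * x) + toℚ X * ε * x      ≤⟨ ℚₚ.+-mono-≤ (*-monoˡ (0≤toℚ X) (ℚₚ.<⇒≤ (<-toℚ-floor s≡))) (*-monoʳ (0≤toℚ n) Xε≤1) ⟩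
        toℚ X * toℚ (suc s) + 1ℚ * x               ≡⟨ cong₂ _+_ (sym (toℚ-homo-* X (suc s))) (ℚₚ.*-identityˡ x) ⟩
        toℚ (X ℕ.* suc s) + x                      ≡⟨ toℚ-homo-+ (X ℕ.* suc s) n ⟨
        toℚ (X ℕ.* suc s ℕ.+ n)                    ∎)
        where open ℚₚ.≤-Reasoning

  *≤⇒≤/ : ∀ X .⦃ _ : NonZero X ⦄ {y n} → y ℕ.* X ℕ.≤ n → y ℕ.≤ n ℕ./ X
  *≤⇒≤/ X {y} h = ℕₚ.≤-trans (ℕₚ.≤-reflexive (sym (ℕD.m*n/n≡m y X))) (ℕD./-monoˡ-≤ X h)

  -- Used with μ₀ = 1 / a, ε₀ = c₀ = 1 / X and n₀ = X.
  record Constants (α μ : ℚ) : Set where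
    field
      a q E X : ℕ
      E≡     : E ≡ (2 ℕ.* a) ^ 3
      X≡     : X ≡ scale E ℕ.* q
      2≤a    : 2 ℕ.≤ a
      1≤q    : 1 ℕ.≤ q
      1≤aα   : 1ℚ ≤ toℚ a * α
      1≤qμ   : 1ℚ ≤ toℚ q * μ
      aμ≤1   : toℚ a * μ ≤ 1ℚ

    a≢0 : NonZero a
    a≢0 = ℕ.>-nonZero (ℕₚ.≤-trans (s≤s z≤n) 2≤a)

    q≢0 : NonZero q
    q≢0 = ℕ.>-nonZero 1≤q

    E≢0 : NonZero E
    E≢0 = subst NonZero (sym E≡) (ℕₚ.m^n≢0 (2 ℕ.* a) 3 ⦃ ℕₚ.m*n≢0 2 a ⦃ _ ⦄ ⦃ a≢0 ⦄ ⦄)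

    X≢0 : NonZero X
    X≢0 = subst NonZero (sym X≡) (ℕₚ.m*n≢0 (scale E) q ⦃ scale≢0 E ⦃ E≢0 ⦄ ⦄ ⦃ q≢0 ⦄)

    2≤X : 2 ℕ.≤ X
    2≤X = subst (2 ℕ.≤_) (sym X≡) (ℕₚ.≤-trans (2≤scale E ⦃ E≢0 ⦄) (ℕₚ.m≤m*n (scale E) q ⦃ q≢0 ⦄))

    1≤Xμ : 1ℚ ≤ toℚ X * μ
    1≤Xμ = ℚₚ.≤-trans 1≤qμ (*-monoʳ 0≤μ (toℚ-mono-≤ {q} {X} (subst (q ℕ.≤_) (sym X≡) (ℕₚ.m≤n*m q (scale E) ⦃ scale≢0 E ⦃ E≢0 ⦄ ⦄))))
      where
      0≤μ : 0ℚ ≤ μ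
      0≤μ = ℚₚ.*-cancelˡ-≤-pos (toℚ q) ⦃ toℚ-positive q ⦃ q≢0 ⦄ ⦄ (ℚₚ.≤-trans (ℚₚ.≤-reflexive (ℚₚ.*-zeroʳ (toℚ q)))
              (ℚₚ.≤-trans (0≤toℚ 1) 1≤qμ))

  module Main {α μ ε c : ℚ} (K : Constants α μ) (0<ε : 0ℚ < ε)
    (Xε≤1 : toℚ (Constants.X K) * ε ≤ 1ℚ) (Xc≤1 : toℚ (Constants.X K) * c ≤ 1ℚ) where
    open Constants K

    instance
      X-nonZero : NonZero X
      X-nonZero = X≢0

    robust-tree′ : ∀ {n s} → + s ≡ floor ((μ - ε) * toℚ n) → n ≥ X → (D : Digraph n) → MinSemiDegree≥ D ((½ + α) * toℚ n) →
      ∀ {m} → + m ≡ floor (μ * toℚ n) → (Tr : OrientedTree m) →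
      (∀ i → toℚ (deg (digraph Tr) i) * toℚ ⌊log₂ n ⌋ ≤ c * toℚ n) → (t : Fin m) →
      Σ (Subset n) λ A → Σ (Fin n) λ v → (+ ∣ A ∣ ≡ floor ((μ - ε) * toℚ n)) × (v ∈ₛ A) ×
        ((B : Subset n) → A ⊆ₛ B → + ∣ B ∣ ≡ floor (μ * toℚ n) → CopyIn Tr D B t v)
    robust-tree′ {n} {s} s≡ X≤n D semidegree {m} m≡ Tr degrees t = conclude
      (finite-copy Tr D t a (Δ ∸ 1) P k ⦃ a≢0 ⦄ rich am≤n 2≤m 2≤n deg≤ ΔL≤P
        (subst (λ z → fiftyFour ℕ.* (k ℕ.+ 2 ℕ.* z ℕ.* (9 ℕ.* P ℕ.+ k)) ℕ.+ fiftyFour ℕ.≤ m) E≡ large))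
      where
      0≤ε = ℚₚ.<⇒≤ 0<ε
      L P Δ : ℕ
      L = ⌊log₂ n ⌋
      P = n ℕ./ X
      rich : Rich a D
      rich = finite-rich D a 2≤a (λ v → let out , inn = semidegree v in degree-bound {a} {α} 1≤aα {n} {outdeg D v} out , degree-bound {a} {α} 1≤aα {n} {indeg D v} inn)
      am≤n : a ℕ.* m ℕ.≤ n
      am≤n = scaled-≤ a {μ} {n} {m} aμ≤1 (toℚ-≤-floor m≡)
      2≤n : 2 ℕ.≤ n
      2≤n = ℕₚ.≤-trans 2≤X X≤n
      k : ℕ
      k = m ∸ s
      gap : s ℕ.≤ m × X ℕ.* k ℕ.≤ X ℕ.+ n
      gap = floor-gap {X = X} Xε≤1 1≤Xμ 0≤ε m≡ s≡
      XP≤n : X ℕ.* P ℕ.≤ n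
      XP≤n = ℕₚ.≤-trans (ℕₚ.≤-reflexive (ℕₚ.*-comm X P)) (ℕD.m/n*n≤m n X)
      large : fiftyFour ℕ.* (k ℕ.+ 2 ℕ.* E ℕ.* (9 ℕ.* P ℕ.+ k)) ℕ.+ fiftyFour ℕ.≤ m
      large = final-bound E q n m k P X X≡ (ℕ.>-nonZero⁻¹ E ⦃ E≢0 ⦄) X≢0 X≤n (proj₂ gap) XP≤n
        (≤-scaled q {μ} {n} {suc m} 1≤qμ (ℚₚ.<⇒≤ (<-toℚ-floor m≡)))
      2≤m : 2 ℕ.≤ m
      2≤m = 2≤-from-fiftyFour large
      L≢0 : NonZero L
      L≢0 = ℕ.>-nonZero (1≤log 2≤n)
      -- The degree hypothesis with Xc ≤ 1 says that deg * L * X ≤ n; degrees are integers, so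
      -- rounding down after each division loses nothing.
      Δ = ℕ._/_ P L ⦃ L≢0 ⦄
      nbrs≤Δ : ∀ w → length (nbrs (digraph Tr) w) ℕ.≤ Δ
      nbrs≤Δ w = subst (ℕ._≤ Δ) (count≡length (adj (digraph Tr) w))
        (*≤⇒≤/ L ⦃ L≢0 ⦄ (*≤⇒≤/ X (ℕₚ.≤-trans (ℕₚ.≤-reflexive (ℕₚ.*-comm (deg (digraph Tr) w ℕ.* L) X))
          (scaled-≤ X {c} {n} {deg (digraph Tr) w ℕ.* L} Xc≤1 (ℚₚ.≤-trans (ℚₚ.≤-reflexive (toℚ-homo-* (deg (digraph Tr) w) L)) (degrees w))))))
      -- The degree bound enters as a successor; it is positive because the root has a neighbour.
      1≤Δ : 1 ℕ.≤ Δ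
      1≤Δ = let _ , grown , all = Tree.rooted-order Tr t in ℕₚ.≤-trans (Tree.d-positive Tr grown all 2≤m t) (nbrs≤Δ t)
      Δ≡ : suc (Δ ∸ 1) ≡ Δ
      Δ≡ = ℕₚ.m+[n∸m]≡n 1≤Δ
      deg≤ : ∀ w → length (nbrs (digraph Tr) w) ℕ.≤ suc (Δ ∸ 1)
      deg≤ w = ℕₚ.≤-trans (nbrs≤Δ w) (ℕₚ.≤-reflexive (sym Δ≡))
      ΔL≤P : suc (Δ ∸ 1) ℕ.* L ℕ.≤ P
      ΔL≤P = ℕₚ.≤-trans (ℕₚ.≤-reflexive (cong (ℕ._* L) Δ≡)) (ℕD.m/n*n≤m P L ⦃ L≢0 ⦄)
      conclude : Σ (Subset n) (λ A → Σ (Fin n) λ v → ∣ A ∣ ℕ.+ k ≡ m × v ∈ₛ A × (∀ B → A ⊆ₛ B → m ℕ.≤ ∣ B ∣ → CopyIn Tr D B t v)) → _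
      conclude (A , v , size , v∈A , copies) = A , v , trans (cong +_ ∣A∣≡s) s≡ , v∈A ,
        (λ B A⊆B ∣B∣≡ → copies B (λ {x} → A⊆B {x}) (ℕₚ.≤-reflexive (ℤₚ.+-injective (trans m≡ (sym ∣B∣≡)))))
        where
        ∣A∣≡s : ∣ A ∣ ≡ s
        ∣A∣≡s = ℕₚ.+-cancelʳ-≡ k ∣ A ∣ s (trans size (sym (ℕₚ.m+[n∸m]≡n (proj₁ gap))))

    robust-tree : ∀ {n} → n ≥ X → (D : Digraph n) → MinSemiDegree≥ D ((½ + α) * toℚ n) →
      ∀ {m} → + m ≡ floor (μ * toℚ n) → (Tr : OrientedTree m) →
      (∀ i → toℚ (deg (digraph Tr) i) * toℚ ⌊log₂ n ⌋ ≤ c * toℚ n) → (t : Fin m) →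
      Σ (Subset n) λ A → Σ (Fin n) λ v → (+ ∣ A ∣ ≡ floor ((μ - ε) * toℚ n)) × (v ∈ₛ A) ×
        ((B : Subset n) → A ⊆ₛ B → + ∣ B ∣ ≡ floor (μ * toℚ n) → CopyIn Tr D B t v)
    robust-tree {n} = robust-tree′ (proj₂ (floor-nonNeg (ℚₚ.≤-trans (ℚₚ.≤-reflexive (sym (ℚₚ.*-zeroˡ (toℚ n))))
      (*-monoʳ (0≤toℚ n) (0≤μ-ε {X = X} Xε≤1 1≤Xμ (ℚₚ.<⇒≤ 0<ε))))))

  -- The denominator must be at least 2, as `finite-rich` needs this for fewer than two constraints.
  double-archimedes : ∀ {p} → 0ℚ < p → ∃ λ d → 1ℚ ≤ toℚ (suc (suc d)) * p
  double-archimedes 0<p = let d , h = archimedes 0<p in d , ℚₚ.≤-trans h (*-monoʳ (ℚₚ.<⇒≤ 0<p) (toℚ-mono-≤ (ℕₚ.n≤1+n (suc d))))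

  constants : ∀ {α μ d} → 1ℚ ≤ toℚ (suc (suc d)) * α → 0ℚ < μ → μ ≤ + 1 ℚ./ suc (suc d) → Constants α μ
  constants {d = d} 1≤aα 0<μ μ≤ = record
    { a = suc (suc d) ; q = suc (proj₁ (archimedes 0<μ)) ; E≡ = refl ; X≡ = refl ; 2≤a = s≤s (s≤s z≤n) ; 1≤q = s≤s z≤n
    ; 1≤aα = 1≤aα ; 1≤qμ = proj₂ (archimedes 0<μ) ; aμ≤1 = ≤-unit-fraction (suc (suc d)) μ≤ }

open import Defs
open import Data.Nat using (ℕ; _≥_)
open import Data.Nat.Logarithm using (⌊log₂_⌋)
open import Data.Fin using (Fin)
open import Data.Fin.Subset using (Subset; _∈_; _⊆_; ∣_∣)
open import Data.Integer using (+_)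
open import Data.Rational using (ℚ; 0ℚ; 1ℚ; ½; _<_; _≤_; _+_; _-_; _*_; floor)
open import Data.Product using (Σ; _×_)
open import Relation.Binary.PropositionalEquality using (_≡_)

import Data.Rational as ℚ
open import Data.Nat using (suc)
open import Data.Product using (_,_; proj₁; proj₂)
open Rationals using (unit-fraction-positive; ≤-unit-fraction)
open Assembly using (module Constants; module Main; double-archimedes; constants)

theorem2p1 : (α : ℚ) → 0ℚ < α → α ≤ 1ℚ →
    Σ ℚ λ μ₀ → 0ℚ < μ₀ × ((μ : ℚ) → 0ℚ < μ → μ ≤ μ₀ →
    Σ ℚ λ ε₀ → 0ℚ < ε₀ × ((ε : ℚ) → 0ℚ < ε → ε ≤ ε₀ →
    Σ ℚ λ c₀ → 0ℚ < c₀ × ((c : ℚ) → 0ℚ < c → c ≤ c₀ →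
    Σ ℕ λ n₀ → (n : ℕ) → n ≥ n₀ →
    (D : Digraph n) → MinSemiDegree≥ D ((½ + α) * toℚ n) →
    (m : ℕ) → + m ≡ floor (μ * toℚ n) →
    (Tr : OrientedTree m) →
    (∀ i → toℚ (deg (digraph Tr) i) * toℚ ⌊log₂ n ⌋ ≤ c * toℚ n) →
    (t : Fin m) →
    Σ (Subset n) λ A → Σ (Fin n) λ v →
    (+ ∣ A ∣ ≡ floor ((μ - ε) * toℚ n)) × (v ∈ A) ×
    ((B : Subset n) → A ⊆ B → + ∣ B ∣ ≡ floor (μ * toℚ n) →
    CopyIn Tr D B t v))))
theorem2p1 α 0<α _ = + 1 ℚ./ suc (suc d) , unit-fraction-positive (suc (suc d)) , λ μ 0<μ μ≤μ₀ →
  let K   = constants {α} {μ} {d} (proj₂ (double-archimedes 0<α)) 0<μ μ≤μ₀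
      X   = Constants.X K
      r   = ℚ._/_ (+ 1) X ⦃ Constants.X≢0 K ⦄
      0<r = unit-fraction-positive X ⦃ Constants.X≢0 K ⦄
  -- The same fraction 1/X bounds both losses: up to rounding, ε ≤ 1/X gives |L| ≤ n/X, and c ≤ 1/X
  -- gives Δ log n ≤ n/X.
  in r , 0<r , λ ε 0<ε ε≤r → r , 0<r , λ c _ c≤r → X , λ n X≤n D semidegree m m≡ Tr degrees t →
    Main.robust-tree {α} {μ} {ε} {c} K 0<ε (≤-unit-fraction X ⦃ Constants.X≢0 K ⦄ ε≤r) (≤-unit-fraction X ⦃ Constants.X≢0 K ⦄ c≤r)
      X≤n D semidegree m≡ Tr degrees t
  where
  d = proj₁ (double-archimedes 0<α)
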